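{- For every language $L\subseteq\Sigma^*$ recognized by a 2D1CA, there exists a simple 2R1CA $M'$ which recognizes $L$ with no error: every $x\in L$ is accepted by $M'$ with probability $1$ and every $x\in\Sigma^*\setminus L$ is rejected by $M'$ with probability $1$.
   Context: Let $\Sigma$ be a finite alphabet, $\Gamma=\Sigma\cup\{\cent,\$\}$ with end-markers $\cent,\$\notin\Sigma$, $S=\{0,1\}$, $\mathrm{sign}(k)=0$ if $k=0$ and $1$ otherwise, and $\mu(\leftarrow)=-1,\mu(\downarrow)=0,\mu(\rightarrow)=+1$. 2D1CA: $M=(Q,\Sigma,\delta,q_0,Q_{\rm acc},Q_{\rm rej})$ with finite $Q$, initial state $q_0$, disjoint $Q_{\rm acc},Q_{\rm rej}\subset Q$, and $\delta:Q\times\Gamma\times S\to Q\times\{ -1,0,+1\}\times\{\leftarrow,\downarrow,\rightarrow\}$. On input $x$ of length $n$ the circular tape holds $w_x=\cent x\$$ at positions $0,\dots,n+1$ (modulo $n+2$); start in $q_0$, counter $0$, head at $0$; from (state $q$, counter $a$, head $b$), if $\delta(q,w_x(b),\mathrm{sign}(a))=(q',c,d)$ go to $(q',a+c,b+\mu(d))$; halt upon entering $Q_{\rm acc}$ (accept) or $Q_{\rm rej}$ (reject). $M$ recognizes $L$ if on every input it halts, accepting iff $x\in L$. 2Q1CA: $M=(Q,\Sigma,\delta,q_0,Q_{\rm acc},Q_{\rm rej})$ with finite $Q$, $q_0\in Q$, disjoint $Q_{\rm acc},Q_{\rm rej}\subset Q$, and $\delta:Q\times\Gamma\times S\times Q\times\{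 -1,0,+1\}\times\{\leftarrow,\downarrow,\rightarrow\}\to\mathbb{C}$ satisfying the well-formedness conditions below. For $\alpha,\beta\in\{ -2,\dots,2\}$ let $W_{\alpha,\beta}(q_1,\sigma_1,s_1;q_2,\sigma_2,s_2)=\sum_{q'\in Q}\sum\overline{\delta(q_1,\sigma_1,s_1,q',c_1,d_1)}\,\delta(q_2,\sigma_2,s_2,q',c_2,d_2)$, inner sum over $(c_1,d_1),(c_2,d_2)$ with $c_2-c_1=\alpha$, $\mu(d_2)-\mu(d_1)=\beta$. Well-formedness: for all $q_1,q_2\in Q$, $\sigma,\sigma_1,\sigma_2\in\Gamma$, $s,s_1,s_2\in S$: (i) $W_{0,0}(q_1,\sigma,s;q_2,\sigma,s)=[q_1=q_2]$; (ii) $W_{0,\beta}(q_1,\sigma_1,s;q_2,\sigma_2,s)=0$ for $\beta\in\{1,2\}$; (iii) $W_{\alpha,0}(q_1,\sigma,s_1;q_2,\sigma,s_2)=0$ for $\alpha\in\{1,2\}$; (iv) $W_{\alpha,\beta}(q_1,\sigma_1,s_1;q_2,\sigma_2,s_2)=0$ for $\alpha\in\{1,2\}$, $\beta\in\{ -2,-1,1,2\}$. On input $x$ of length $n$, configurations are $(q,a,b)\in Q\times\mathbb{Z}\times\{0,\dots,n+1\}$ and $U_x|q,a,b\rangle=\sum_{q',c,d}\delta(q,w_x(b),\mathrm{sign}(a),q',c,d)|q',a+c,b+\mu(d)\rangle$. Computation starts in $|q_0,0,0\rangle$; at each step $U_x$ is applied and then the state is measured w.r.t. the orthogonal decomposition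 into the spans of configurations whose state lies in $Q_{\rm acc}$, in $Q_{\rm rej}$, and in neither; outcomes "accept"/"reject" halt, otherwise the computation continues from the collapsed (renormalized) state. Acceptance (rejection) probability is the total probability of ever obtaining the outcome "accept" ("reject"). A 2R1CA is a 2Q1CA all of whose transition amplitudes $\delta(\cdot)$ lie in $\{0,1\}$. A 2Q1CA (or 2R1CA) is simple if there are linear operators $V_{\sigma,s}$ on $\ell_2(Q)$, a counter function $C:Q\times\Gamma\to\{ -1,0,+1\}$ and a head function $D:Q\to\{\leftarrow,\downarrow,\rightarrow\}$ with $\delta(q,\sigma,s,q',c,d)=\langle q'|V_{\sigma,s}|q\rangle$ if $C(q',\sigma)=c$ and $D(q')=d$, and $0$ otherwise. -}

module Defs where

open import Level using (Level)
open import Data.Bool using (Bool; true; false; T; _∨_; not; if_then_else_)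
open import Data.Empty using (⊥-elim)
open import Data.Fin as Fin using (Fin; toℕ; fromℕ<)
open import Data.Integer as ℤ using (ℤ; +_; 0ℤ; 1ℤ; -1ℤ)
import Data.Integer.DivMod as ℤ
import Data.Integer.Properties as ℤ
open import Data.List using (List; []; _∷_; length; map; foldr; allFin; upTo)
open import Data.List.Membership.Propositional using (_∈_)
open import Data.Nat as ℕ using (ℕ; zero; suc)
import Data.Nat.Properties as ℕ
open import Data.Product using (_×_; _,_; proj₁; ∃)
open import Data.Rational as ℚ using (ℚ; 0ℚ; 1ℚ)
import Data.Rational.Properties as ℚ
open import Data.Sum using (_⊎_)
open import Data.Vec using (Vec; fromList; _∷ʳ_; lookup)
  renaming (_∷_ to _∷ᵥ_; map to mapᵥ)
open import Function using (_⇔_; _↔_; Inverse)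
open import Function.Properties.Inverse using (Inverse⇒Injection)
open import Relation.Binary.Definitions using (DecidableEquality)
open import Relation.Binary.PropositionalEquality
  using (_≡_; refl; sym; trans; cong)
open import Relation.Nullary using (¬_; yes; no; ⌊_⌋)
open import Relation.Nullary.Decidable using (via-injection)
open import Relation.Unary using (Pred)

private
  variable
    a : Level

------------------------------------------------------------------------

record Finite (A : Set) : Set where
  field
    size : ℕ
    enum : A ↔ Fin size

  open Inverse enum public using () renaming (from to element)

  elements : List A
  elements = map element (allFin size)

  _≟_ : DecidableEquality A
  _≟_ = via-injection (Inverse⇒Injection enum) Fin._≟_

------------------------------------------------------------------------

-- The amplitudes are the complex numbers with rational real and imaginary
-- parts.  This subfield of ℂ contains 0 and 1 and is closed under
-- conjugation, so the automata over ℂ with all amplitudes in {0, 1} are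
-- exactly the automata over ℚ[i] with all amplitudes in {0, 1}; all vectors
-- and probabilities arising in their computations are also the same.

record ℚ[i] : Set where
  constructor _+_i
  field
    re im : ℚ

open ℚ[i] public

0ᶜ 1ᶜ : ℚ[i]
0ᶜ = 0ℚ + 0ℚ i
1ᶜ = 1ℚ + 0ℚ i

infixl 6 _+ᶜ_
infixl 7 _*ᶜ_

_+ᶜ_ _*ᶜ_ : ℚ[i] → ℚ[i] → ℚ[i]
z +ᶜ w = (re z ℚ.+ re w) + (im z ℚ.+ im w) i
z *ᶜ w = (re z ℚ.* re w ℚ.- im z ℚ.* im w) + (re z ℚ.* im w ℚ.+ im z ℚ.* re w) i

conj : ℚ[i] → ℚ[i]
conj z = re z + (ℚ.- im z) i

∣_∣² : ℚ[i] → ℚ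
∣ z ∣² = re z ℚ.* re z ℚ.+ im z ℚ.* im z

∑ᶜ : {A : Set} → List A → (A → ℚ[i]) → ℚ[i]
∑ᶜ xs f = foldr (λ x s → f x +ᶜ s) 0ᶜ xs

∑ : {A : Set} → List A → (A → ℚ) → ℚ
∑ xs f = foldr (λ x s → f x ℚ.+ s) 0ℚ xs

syntax ∑ᶜ xs (λ x → e) = ∑ᶜ[ x ← xs ] e
syntax ∑  xs (λ x → e) = ∑[ x ← xs ] e

infix 5 ∑ᶜ ∑

*ᶜ-zeroʳ : ∀ z {w} → w ≡ 0ᶜ → z *ᶜ w ≡ 0ᶜ
*ᶜ-zeroʳ z refl rewrite ℚ.*-zeroʳ (re z) | ℚ.*-zeroʳ (im z) = refl

∑ᶜ-zero : {A : Set} (xs : List A) {f : A → ℚ[i]} →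
          (∀ x → f x ≡ 0ᶜ) → ∑ᶜ xs f ≡ 0ᶜ
∑ᶜ-zero []       f≡0 = refl
∑ᶜ-zero (x ∷ xs) f≡0 rewrite f≡0 x | ∑ᶜ-zero xs f≡0 = refl

_ConvergesTo_ : (ℕ → ℚ) → ℚ → Set
s ConvergesTo l =
  ∀ (ε : ℚ) → 0ℚ ℚ.< ε → ∃ λ N → ∀ T → N ℕ.≤ T → ℚ.∣ s T ℚ.- l ∣ ℚ.< ε

------------------------------------------------------------------------

data Γ (Σ : Set) : Set where
  ¢ $ : Γ Σ
  input : Σ → Γ Σ

data S : Set where
  𝟎 𝟏 : S

sign : ℤ → S
sign k = if ⌊ k ℤ.≟ 0ℤ ⌋ then 𝟎 else 𝟏

data Change : Set where
  dec keep inc : Change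

⟦_⟧ : Change → ℤ
⟦ dec  ⟧ = -1ℤ
⟦ keep ⟧ = 0ℤ
⟦ inc  ⟧ = 1ℤ

∣a∣≤1+∣a-c∣ : ∀ a c → ℤ.∣ a ∣ ℕ.≤ suc ℤ.∣ a ℤ.- ⟦ c ⟧ ∣
∣a∣≤1+∣a-c∣ a c = begin
  ℤ.∣ a ∣                                ≡⟨ cong ℤ.∣_∣ a≡c+[a-c] ⟩
  ℤ.∣ ⟦ c ⟧ ℤ.+ (a ℤ.- ⟦ c ⟧) ∣          ≤⟨ ℤ.∣i+j∣≤∣i∣+∣j∣ ⟦ c ⟧ _ ⟩
  ℤ.∣ ⟦ c ⟧ ∣ ℕ.+ ℤ.∣ a ℤ.- ⟦ c ⟧ ∣      ≤⟨ ℕ.+-monoˡ-≤ _ (∣c∣≤1 c) ⟩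
  suc ℤ.∣ a ℤ.- ⟦ c ⟧ ∣                  ∎
  where
  open ℕ.≤-Reasoning

  ∣c∣≤1 : ∀ c → ℤ.∣ ⟦ c ⟧ ∣ ℕ.≤ 1
  ∣c∣≤1 dec  = ℕ.≤-refl
  ∣c∣≤1 keep = ℕ.z≤n
  ∣c∣≤1 inc  = ℕ.≤-refl

  a≡c+[a-c] : a ≡ ⟦ c ⟧ ℤ.+ (a ℤ.- ⟦ c ⟧)
  a≡c+[a-c] = trans (sym (ℤ.+-identityʳ a))
    (trans (cong (λ z → a ℤ.+ z) (sym (ℤ.+-inverseˡ ⟦ c ⟧)))
    (trans (sym (ℤ.+-assoc a (ℤ.- ⟦ c ⟧) ⟦ c ⟧)) (ℤ.+-comm _ ⟦ c ⟧)))

data Direction : Set where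
  ← ↓ ⟶ : Direction

μ : Direction → ℤ
μ ← = -1ℤ
μ ↓ = 0ℤ
μ ⟶ = 1ℤ

changes : List Change
changes = dec ∷ keep ∷ inc ∷ []

directions : List Direction
directions = ← ∷ ↓ ∷ ⟶ ∷ []

Position : ℕ → Set
Position n = Fin (2 ℕ.+ n)

infixl 6 _⊕_

_⊕_ : ∀ {n} → Position n → ℤ → Position n
_⊕_ {n} b z = fromℕ< (ℤ.n%ℕd<d (+ toℕ b ℤ.+ z) (2 ℕ.+ n))

tape : {Σ : Set} (x : List Σ) → Vec (Γ Σ) (2 ℕ.+ length x)
tape x = ¢ ∷ᵥ (mapᵥ input (fromList x) ∷ʳ $)

Config : Set → ℕ → Set
Config Q n = Q × ℤ × Position n

------------------------------------------------------------------------

record 2D1CA (Σ : Set) : Set₁ where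
  field
    Q        : Set
    finite   : Finite Q
    q₀       : Q
    acc rej  : Q → Bool
    disjoint : ∀ q → ¬ (T (acc q) × T (rej q))
    δ        : Q → Γ Σ → S → Q × Change × Direction

  module _ (x : List Σ) where

    initial : Config Q (length x)
    initial = q₀ , 0ℤ , Fin.zero

    next : Config Q (length x) → Config Q (length x)
    next (q , a , b) with δ q (lookup (tape x) b) (sign a)
    ... | q′ , c , d = q′ , a ℤ.+ ⟦ c ⟧ , b ⊕ μ d

    -- Some halting state is met from the given configuration, possibly at
    -- once, and the first such state lies in F ∈ {acc, rej}.
    data HaltsIn (F : Q → Bool) : Config Q (length x) → Set where
      done : ∀ {κ} → T (F (proj₁ κ)) → HaltsIn F κ
      step : ∀ {κ} → ¬ T (acc (proj₁ κ) ∨ rej (proj₁ κ)) →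
             HaltsIn F (next κ) → HaltsIn F κ

    Accepts Rejects : Set
    Accepts = HaltsIn acc initial
    Rejects = HaltsIn rej initial

  Recognizes : Pred (List Σ) a → Set a
  Recognizes L = ∀ x → (Accepts x ⊎ Rejects x) × (Accepts x ⇔ L x)

------------------------------------------------------------------------

Amplitudes : Set → Set → Set
Amplitudes Q Σ = Q → Γ Σ → S → Q → Change → Direction → ℚ[i]

module _ {Q Σ : Set} (finite : Finite Q) (δ : Amplitudes Q Σ) where
  open Finite finite

  W : ℤ → ℤ → Q → Γ Σ → S → Q → Γ Σ → S → ℚ[i]
  W α β q₁ σ₁ s₁ q₂ σ₂ s₂ =
    ∑ᶜ[ q′ ← elements ]
    ∑ᶜ[ c₁ ← changes ] ∑ᶜ[ d₁ ← directions ]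
    ∑ᶜ[ c₂ ← changes ] ∑ᶜ[ d₂ ← directions ]
      (if ⌊ ⟦ c₂ ⟧ ℤ.- ⟦ c₁ ⟧ ℤ.≟ α ⌋ then
        (if ⌊ μ d₂ ℤ.- μ d₁ ℤ.≟ β ⌋ then
          conj (δ q₁ σ₁ s₁ q′ c₁ d₁) *ᶜ δ q₂ σ₂ s₂ q′ c₂ d₂
        else 0ᶜ)
      else 0ᶜ)

  record WellFormed : Set where
    field
      orthonormal : ∀ q₁ q₂ σ s →
        W 0ℤ 0ℤ q₁ σ s q₂ σ s ≡ (if ⌊ q₁ ≟ q₂ ⌋ then 1ᶜ else 0ᶜ)
      separable-head : ∀ {β} → β ∈ + 1 ∷ + 2 ∷ [] →
        ∀ q₁ q₂ σ₁ σ₂ s → W 0ℤ β q₁ σ₁ s q₂ σ₂ s ≡ 0ᶜ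
      separable-counter : ∀ {α} → α ∈ + 1 ∷ + 2 ∷ [] →
        ∀ q₁ q₂ σ s₁ s₂ → W α 0ℤ q₁ σ s₁ q₂ σ s₂ ≡ 0ᶜ
      separable-both : ∀ {α β} →
        α ∈ + 1 ∷ + 2 ∷ [] → β ∈ ℤ.- + 2 ∷ ℤ.- + 1 ∷ + 1 ∷ + 2 ∷ [] →
        ∀ q₁ q₂ σ₁ σ₂ s₁ s₂ → W α β q₁ σ₁ s₁ q₂ σ₂ s₂ ≡ 0ᶜ

record 2Q1CA (Σ : Set) : Set₁ where
  field
    Q          : Set
    finite     : Finite Q
    q₀         : Q
    acc rej    : Q → Bool
    disjoint   : ∀ q → ¬ (T (acc q) × T (rej q))
    δ          : Amplitudes Q Σ
    wellFormed : WellFormed finite δ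

  open Finite finite public

  neither : Q → Bool
  neither q = not (acc q ∨ rej q)

  module _ (x : List Σ) where

    Vector : Set
    Vector = Config Q (length x) → ℚ[i]

    ∣q₀,0,0⟩ : Vector
    ∣q₀,0,0⟩ (q , a , b) =
      if ⌊ q ≟ q₀ ⌋ then
        (if ⌊ a ℤ.≟ 0ℤ ⌋ then
          (if ⌊ b Fin.≟ Fin.zero ⌋ then 1ᶜ else 0ᶜ)
        else 0ᶜ)
      else 0ᶜ

    -- The coefficient of U ψ at ∣q′,a′,b′⟩ collects the contributions of all
    -- ∣q,a,b⟩ and (c,d) with a + c = a′ and b + μ(d) = b′ (modulo n + 2), that
    -- is, a = a′ - c and b = b′ - μ(d).
    U : Vector → Vector
    U ψ (q′ , a′ , b′) =
      ∑ᶜ[ q ← elements ] ∑ᶜ[ c ← changes ] ∑ᶜ[ d ← directions ]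
        δ q (lookup (tape x) (b′ ⊕ (ℤ.- μ d))) (sign (a′ ℤ.- ⟦ c ⟧)) q′ c d
          *ᶜ ψ (q , a′ ℤ.- ⟦ c ⟧ , b′ ⊕ (ℤ.- μ d))

    P : (Q → Bool) → Vector → Vector
    P F ψ κ = if F (proj₁ κ) then ψ κ else 0ᶜ

    -- The vector reached when the first t measurements all gave "neither",
    -- without renormalization: its squared norm is the probability of that
    -- event, so that prob below is the product of this probability with the
    -- conditional one given by the renormalized vector.
    continuing : ℕ → Vector
    continuing zero    = ∣q₀,0,0⟩
    continuing (suc t) = P neither (U (continuing t))

    SupportedWithin : ℕ → Vector → Set
    SupportedWithin t ψ = ∀ q a b → t ℕ.< ℤ.∣ a ∣ → ψ (q , a , b) ≡ 0ᶜ

    U-support : ∀ {t ψ} → SupportedWithin t ψ → SupportedWithin (suc t) (U ψ)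
    U-support ψ≡0 q′ a′ b′ t<∣a′∣ =
      ∑ᶜ-zero elements λ q → ∑ᶜ-zero changes λ c → ∑ᶜ-zero directions λ d →
        *ᶜ-zeroʳ (δ q (lookup (tape x) (b′ ⊕ (ℤ.- μ d))) (sign (a′ ℤ.- ⟦ c ⟧)) q′ c d)
          (ψ≡0 q (a′ ℤ.- ⟦ c ⟧) (b′ ⊕ (ℤ.- μ d))
            (ℕ.s≤s⁻¹ (ℕ.≤-trans t<∣a′∣ (∣a∣≤1+∣a-c∣ a′ c))))

    continuing-support : ∀ t → SupportedWithin t (continuing t)
    continuing-support zero q a b 0<∣a∣ with q ≟ q₀ | a ℤ.≟ 0ℤ
    ... | no  _ | _        = refl
    ... | yes _ | no  _    = refl
    ... | yes _ | yes refl = ⊥-elim (ℕ.n≮n 0 0<∣a∣)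
    continuing-support (suc t) q a b t<∣a∣ with neither q
    ... | false = refl
    ... | true  = U-support (continuing-support t) q a b t<∣a∣

    counters : ℕ → List ℤ
    counters t = map (λ k → + k ℤ.- + t) (upTo (suc (2 ℕ.* t)))

    -- The squared norm of a vector supported on counter values a with
    -- -t ≤ a ≤ t.
    ∥_∥²[_] : Vector → ℕ → ℚ
    ∥ ψ ∥²[ t ] =
      ∑[ q ← elements ] ∑[ a ← counters t ] ∑[ b ← allFin (2 ℕ.+ length x) ]
        ∣ ψ (q , a , b) ∣²

    -- The probability that the computation halts exactly at step t + 1, with
    -- the outcome given by F ∈ {acc, rej}.  By continuing-support and
    -- U-support the window of counter values covers the support.
    prob : (Q → Bool) → ℕ → ℚ
    prob F t = ∥ P F (U (continuing t)) ∥²[ suc t ]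

    probUpTo : (Q → Bool) → ℕ → ℚ
    probUpTo F T = ∑[ t ← upTo T ] prob F t

    AcceptsWithProbability RejectsWithProbability : ℚ → Set
    AcceptsWithProbability p = probUpTo acc ConvergesTo p
    RejectsWithProbability p = probUpTo rej ConvergesTo p

  RecognizesWithoutError : Pred (List Σ) a → Set a
  RecognizesWithoutError L =
    ∀ x → (L x   → AcceptsWithProbability x 1ℚ)
        × (¬ L x → RejectsWithProbability x 1ℚ)

------------------------------------------------------------------------

Is2R1CA : ∀ {Σ} → 2Q1CA Σ → Set
Is2R1CA M = ∀ q σ s q′ c d → δ q σ s q′ c d ∈ 0ᶜ ∷ 1ᶜ ∷ []
  where open 2Q1CA M

record Simple {Σ} (M : 2Q1CA Σ) : Set where
  open 2Q1CA M
  field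
    -- V σ s q′ q is the matrix entry ⟨q′|V_{σ,s}|q⟩.
    V       : Γ Σ → S → Q → Q → ℚ[i]
    C       : Q → Γ Σ → Change
    D       : Q → Direction
    δ-on    : ∀ q σ s q′ c d → C q′ σ ≡ c × D q′ ≡ d →
              δ q σ s q′ c d ≡ V σ s q′ q
    δ-off   : ∀ q σ s q′ c d → ¬ (C q′ σ ≡ c × D q′ ≡ d) →
              δ q σ s q′ c d ≡ 0ᶜ

{-# OPTIONS --safe #-}
-- Touring the tree of predecessors of the halting configuration depth first (an
-- Euler tour) makes a deterministic machine reversible, since a tour can be run
-- backwards. For a one-counter machine this fails as it stands: if the walk with
-- nonzero counter can go round a cycle on which the counter decreases, the tree
-- of predecessors is infinite.
--
-- So the machine is first replaced by one without such cycles, which moves from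
-- one zero of the counter to the next by touring, in one of the two directions,
-- the tree of the excursion between them. One direction must reach the next
-- zero: a branch of infinite depth runs along a cycle, and of the children of a
-- node at most one lies on a cycle, so one of the two directions avoids it. A
-- tour caught in an infinite branch becomes periodic up to the counter; it is
-- recognised when it comes back, in the same state, to the rightmost cell of its
-- orbit (or to cell 0), and then reversed. Whether a cell is the rightmost one
-- of an orbit is a property of the tape to its left and hence of finite
-- information, which the technique of Hopcroft and Ullman keeps up to date when
-- the head moves left. A cyclic walk with nonzero counter would meet such a
-- cell; so there is none, all trees of predecessors of halting configurations
-- are finite, and the Euler tour of the new machine halts. Its transitions are
-- a permutation of the states, which is to say a simple 2R1CA.

module Submission where

open import Defs hiding (_+_i)
open import Data.Bool using (Bool; true; false; T; _∨_; _∧_; not; if_then_else_)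
import Data.Bool.Properties as Bool
open import Data.Empty using (⊥; ⊥-elim)
open import Data.Fin as Fin using (Fin; zero; suc; toℕ; fromℕ; inject₁)
import Data.Fin.Induction as Fin
import Data.Fin.Properties as Fin
open import Data.Integer as ℤ using (ℤ; +_; -[1+_]; 0ℤ; 1ℤ; -1ℤ)
import Data.Integer.DivMod as ℤ
import Data.Integer.Properties as ℤ
open import Data.List using (List; []; _∷_; foldr; allFin; applyUpTo; tabulate; length)
import Data.List.Properties as List
open import Data.List.Membership.Propositional using (_∈_)
open import Data.List.Relation.Unary.Any using (here; there)
open import Data.Maybe as Maybe using (Maybe; just; nothing)
open import Data.Maybe.Properties using (just-injective)
open import Data.Nat as ℕ using (ℕ; zero; suc; _+_; _*_; _∸_; _≤_; _<_; z≤n; s≤s)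
import Data.Nat.DivMod as ℕ
import Data.Nat.Properties as ℕ
open import Data.Product using (_×_; _,_; proj₁; proj₂; ∃; ∃₂)
open import Data.Product.Function.NonDependent.Propositional using (_×-↔_)
import Data.Product.Properties as Product
open import Data.Rational as ℚ using (ℚ; 0ℚ; 1ℚ)
import Data.Rational.Properties as ℚ
open import Data.Sum using (_⊎_; inj₁; inj₂)
open import Data.Sum.Function.Propositional using (_⊎-↔_)
open import Data.Unit using (⊤; tt)
open import Data.Vec as Vec using (Vec)
import Data.Vec.Properties as Vec
open import Function using (_∘_; id; _↔_; case_of_; mk↔ₛ′; Equivalence; Inverse)
open import Function.Properties.Inverse using (↔-sym; ↔-trans)
open import Induction.WellFounded using (Acc) renaming (acc to wf)
open import Level using (Level)
open import Relation.Binary.PropositionalEquality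
open import Relation.Nullary using (Dec; yes; no; ¬_; ¬?)
open import Relation.Nullary.Decidable using (⌊_⌋; _×-dec_; _⊎-dec_; decidable-stable; map′)
open import Relation.Unary using (Pred)

-- The tree of predecessors of a halting configuration also contains configurations that no
-- computation reaches: labels that belong to no tape, arbitrary memories, detours begun in the
-- middle. Cycles have to be excluded from every node, not only along actual runs. So the cycle
-- argument uses only that consecutive labels fit together locally; a detour started anywhere must
-- end, in `dead` if its data are inconsistent; and at nonzero counter the memory of firings only
-- grows, apart from a single change of direction. True labels matter only where the run on the
-- actual input is followed.
--
-- Without cycles at nonzero counter the trees are finite by counting: every bounded stretch of a
-- run meets counter zero, a configuration at zero is given by state and cell, and a run that halts
-- repeats no configuration.
--
-- Reversing a tour cannot lead astray: an excursion starts on the tour of the tree rooted at the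
-- next stop, and the root is the only stop of that tree.

iter : {A : Set} → (A → A) → ℕ → A → A
iter f zero    a = a
iter f (suc k) a = iter f k (f a)

module _ {A : Set} (f : A → A) where

  iter-+ : ∀ j k a → iter f (j + k) a ≡ iter f k (iter f j a)
  iter-+ zero    k a = refl
  iter-+ (suc j) k a = iter-+ j k (f a)

  iter-suc : ∀ k a → iter f (suc k) a ≡ f (iter f k a)
  iter-suc zero    a = refl
  iter-suc (suc k) a = iter-suc k (f a)

  iter-* : ∀ j k a → iter f k a ≡ a → iter f (j * k) a ≡ a
  iter-* zero    k a e = refl
  iter-* (suc j) k a e = trans (iter-+ k (j * k) a) (trans (cong (iter f (j * k)) e) (iter-* j k a e))

module _ {A : Set} {f g : A → A} (gf : ∀ a → g (f a) ≡ a) where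

  iter-cancel : ∀ k a → iter g k (iter f k a) ≡ a
  iter-cancel zero    a = refl
  iter-cancel (suc k) a =
    trans (cong (iter g k) (trans (cong g (iter-suc f k a)) (gf _))) (iter-cancel k a)

-- Finite types

module _ {A : Set} (F : Finite A) where
  open Finite F

  index : A → Fin size
  index = Inverse.to enum

  element∘index : ∀ a → element (index a) ≡ a
  element∘index = Inverse.strictlyInverseʳ enum

  index∘element : ∀ i → index (element i) ≡ i
  index∘element = Inverse.strictlyInverseˡ enum

  index-injective : ∀ {a b} → index a ≡ index b → a ≡ b
  index-injective {a} {b} e = trans (sym (element∘index a)) (trans (cong element e) (element∘index b))

  pigeonhole : (f : ℕ → A) → ∃₂ λ i j → i < j × j ≤ size × f i ≡ f j
  pigeonhole f with Fin.pigeonhole (ℕ.n<1+n size) (λ i → index (f (toℕ i)))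
  ... | i , j , i<j , e = toℕ i , toℕ j , i<j , ℕ.s≤s⁻¹ (Fin.toℕ<n j) , index-injective e

abstract

  fin-map : {A B : Set} → B ↔ A → Finite A → Finite B
  fin-map i F = record { size = size ; enum = ↔-trans i enum }
    where open Finite F

  fin-Fin : ∀ n → Finite (Fin n)
  fin-Fin n = record { size = n ; enum = mk↔ₛ′ id id (λ _ → refl) (λ _ → refl) }

  fin-× : {A B : Set} → Finite A → Finite B → Finite (A × B)
  fin-× F G = record
    { size = F.size * G.size
    ; enum = ↔-trans (F.enum ×-↔ G.enum) (↔-sym Fin.*↔×) }
    where module F = Finite F
          module G = Finite G

  fin-⊎ : {A B : Set} → Finite A → Finite B → Finite (A ⊎ B)
  fin-⊎ F G = record
    { size = F.size + G.size
    ; enum = ↔-trans (F.enum ⊎-↔ G.enum) (↔-sym Fin.+↔⊎) }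
    where module F = Finite F
          module G = Finite G

  fin-⊤ : Finite ⊤
  fin-⊤ = fin-map (mk↔ₛ′ (λ _ → zero) (λ _ → tt) (λ { zero → refl }) (λ _ → refl)) (fin-Fin 1)

  fin-Bool : Finite Bool
  fin-Bool = fin-map (mk↔ₛ′ (λ { false → inj₁ tt ; true → inj₂ tt })
    (λ { (inj₁ _) → false ; (inj₂ _) → true })
    (λ { (inj₁ _) → refl ; (inj₂ _) → refl }) (λ { false → refl ; true → refl })) (fin-⊎ fin-⊤ fin-⊤)

  fin-Maybe : {A : Set} → Finite A → Finite (Maybe A)
  fin-Maybe F = fin-map (mk↔ₛ′ (λ { nothing → inj₁ tt ; (just a) → inj₂ a })
    (λ { (inj₁ _) → nothing ; (inj₂ a) → just a })
    (λ { (inj₁ _) → refl ; (inj₂ _) → refl }) (λ { nothing → refl ; (just _) → refl })) (fin-⊎ fin-⊤ F)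

  fin-Vec : {A : Set} → Finite A → ∀ n → Finite (Vec A n)
  fin-Vec F zero = fin-map (mk↔ₛ′ (λ _ → tt) (λ _ → Vec.[]) (λ _ → refl) (λ { Vec.[] → refl })) fin-⊤
  fin-Vec F (suc n) = fin-map (mk↔ₛ′ (λ { (x Vec.∷ xs) → x , xs }) (λ { (x , xs) → x Vec.∷ xs })
    (λ _ → refl) (λ { (x Vec.∷ xs) → refl })) (fin-× F (fin-Vec F n))

  changeToFin : Change → Fin 3
  changeToFin dec  = zero
  changeToFin keep = suc zero
  changeToFin inc  = suc (suc zero)

  fin-Change : Finite Change
  fin-Change = fin-map (mk↔ₛ′ changeToFin
    (λ { zero → dec ; (suc zero) → keep ; (suc (suc zero)) → inc })
    (λ { zero → refl ; (suc zero) → refl ; (suc (suc zero)) → refl })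
    (λ { dec → refl ; keep → refl ; inc → refl })) (fin-Fin 3)

  fin-Direction : Finite Direction
  fin-Direction = fin-map (mk↔ₛ′ (λ { ← → zero ; ↓ → suc zero ; ⟶ → suc (suc zero) })
    (λ { zero → ← ; (suc zero) → ↓ ; (suc (suc zero)) → ⟶ })
    (λ { zero → refl ; (suc zero) → refl ; (suc (suc zero)) → refl })
    (λ { ← → refl ; ↓ → refl ; ⟶ → refl })) (fin-Fin 3)

-- Vectors, so that without extensionality the functions still form a finite type.
module _ {A : Set} (F : Finite A) where
  open Finite F

  _⇒_ : Set → Set
  _⇒_ B = Vec B size

  ⟪_⟫ : {B : Set} → (A → B) → _⇒_ B
  ⟪ f ⟫ = Vec.tabulate (f ∘ element)

  app : {B : Set} → _⇒_ B → A → B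
  app v a = Vec.lookup v (index F a)

  app-⟪⟫ : {B : Set} (f : A → B) → ∀ a → app ⟪ f ⟫ a ≡ f a
  app-⟪⟫ f a = trans (Vec.lookup∘tabulate (f ∘ element) (index F a)) (cong f (element∘index F a))

-- Finite deterministic processes

module _ {A : Set} (F : Finite A) where
  open Finite F

  any-below : {P : ℕ → Set} → (∀ k → Dec (P k)) → ∀ n → (∃ λ k → k < n × P k) ⊎ (∀ k → k < n → ¬ P k)
  any-below P? n with ℕ.anyUpTo? P? n
  ... | yes (k , k<n , p) = inj₁ (k , k<n , p)
  ... | no ¬p             = inj₂ λ k k<n p → ¬p (k , k<n , p)

  -- A repetition among the first values closes a cycle whose first lap avoids `P`; reducing the
  -- time modulo the length of the cycle shows that all laps do.
  escape : {P : A → Set} → (∀ a → Dec (P a)) → (f : A → A) →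
           (∀ a k → iter f (suc k) a ≡ a → ¬ (∀ t → ¬ P (iter f t a))) →
           ∀ a → ∃ λ k → k ≤ size × P (iter f k a)
  escape {P} P? f acyclic a with any-below (λ k → P? (iter f k a)) (suc size)
  ... | inj₁ (k , k<n , p) = k , ℕ.s≤s⁻¹ k<n , p
  ... | inj₂ none with pigeonhole F (λ k → iter f k a)
  ... | i , j , i<j , j≤n , e = ⊥-elim (acyclic b d loop never)
    where
    b = iter f i a
    d = j ∸ suc i
    j≡ : i + suc d ≡ j
    j≡ = trans (ℕ.+-suc i d) (ℕ.m+[n∸m]≡n i<j)
    loop : iter f (suc d) b ≡ b
    loop = trans (sym (iter-+ f i (suc d) a)) (trans (cong (λ k → iter f k a) j≡) (sym e))
    small : ∀ t → t < suc d → ¬ P (iter f t b)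
    small t t<d p = none (i + t)
      (s≤s (ℕ.≤-trans (ℕ.<⇒≤ (ℕ.<-≤-trans (ℕ.+-monoʳ-< i t<d) (ℕ.≤-reflexive j≡))) j≤n))
      (subst P (sym (iter-+ f i t a)) p)
    never : ∀ t → ¬ P (iter f t b)
    never t p = small (t ℕ.% suc d) (ℕ.m%n<n t (suc d)) (subst P
      (trans (cong (λ k → iter f k b) (trans (ℕ.m≡m%n+[m/n]*n t (suc d))
                (ℕ.+-comm (t ℕ.% suc d) _)))
        (trans (iter-+ f ((t ℕ./ suc d) * suc d) (t ℕ.% suc d) b)
          (cong (iter f (t ℕ.% suc d)) (iter-* f (t ℕ./ suc d) (suc d) b loop)))) p)

  -- Pigeonhole gives equal points at times `k < l` of the orbit, with `l` at most `size`. From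
  -- there `k * c` further steps complete `k` laps and return to `s`, so the difference `l ∸ k` is a
  -- period of `s` itself and not only of a later point.
  loop-short : (f : A → A) → ∀ s → (∃ λ k → iter f (suc k) s ≡ s) → ∃ λ k → k < size × iter f (suc k) s ≡ s
  loop-short f s (c , e) with pigeonhole F (λ k → iter f k s)
  ... | k , l , k<l , l≤n , e′ = d , ℕ.<-≤-trans (ℕ.∸-monoʳ-< (s≤s z≤n) k<l) l≤n , (begin
    iter f (suc d) s                              ≡⟨ cong (iter f (suc d)) (iter-* f k (suc c) s e) ⟨
    iter f (suc d) (iter f (k * suc c) s)         ≡⟨ iter-+ f (k * suc c) (suc d) s ⟨
    iter f (k * suc c + suc d) s                  ≡⟨ cong (λ x → iter f x s) arith ⟩
    iter f (l + k * c) s                          ≡⟨ iter-+ f l (k * c) s ⟩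
    iter f (k * c) (iter f l s)                   ≡⟨ cong (iter f (k * c)) e′ ⟨
    iter f (k * c) (iter f k s)                   ≡⟨ iter-+ f k (k * c) s ⟨
    iter f (k + k * c) s                          ≡⟨ cong (λ x → iter f x s) (ℕ.*-suc k c) ⟨
    iter f (k * suc c) s                          ≡⟨ iter-* f k (suc c) s e ⟩
    s                                             ∎)
    where
    open ≡-Reasoning
    d = l ∸ suc k
    arith : k * suc c + suc d ≡ l + k * c
    arith = begin
      k * suc c + suc d        ≡⟨ cong (λ x → x + suc d) (ℕ.*-suc k c) ⟩
      k + k * c + suc d        ≡⟨ cong (λ x → x + suc d) (ℕ.+-comm k (k * c)) ⟩
      k * c + k + suc d        ≡⟨ ℕ.+-assoc (k * c) k (suc d) ⟩
      k * c + (k + suc d)      ≡⟨ cong (λ x → k * c + x) (trans (ℕ.+-suc k d) (ℕ.m+[n∸m]≡n k<l)) ⟩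
      k * c + l                ≡⟨ ℕ.+-comm (k * c) l ⟩
      l + k * c                ∎

module Absorbing {A : Set} (F : Finite A) (f : A → A) (P : A → Set) (P? : ∀ (a : A) → Dec (P a))
                 (fixed : ∀ (a : A) → P a → f a ≡ a) where
  open Finite F using (size)

  settled-iter : ∀ k s → P s → iter f k s ≡ s
  settled-iter zero    s e = refl
  settled-iter (suc k) s e = trans (cong (iter f k) (fixed s e)) (settled-iter k s e)

  settled-≤ : ∀ {k l} s → k ≤ l → P (iter f k s) → iter f l s ≡ iter f k s
  settled-≤ {k} {l} s k≤l e = trans (cong (λ x → iter f x s) (sym (ℕ.m+[n∸m]≡n k≤l)))
    (trans (iter-+ f k (l ∸ k) s) (settled-iter (l ∸ k) _ e))

  -- A settled point is fixed, hence still there at the later time `k + K * suc d`, when the loop is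
  -- back at its unsettled start.
  never-settles : ∀ s k d → iter f (suc d) (iter f k s) ≡ iter f k s → ¬ P (iter f k s) →
                  ∀ K → ¬ P (iter f K s)
  never-settles s k d loop ¬e K e = ¬e (subst P (trans (sym (settled-≤ s K≤big e)) big≡) e)
    where
    K≤big : K ≤ k + K * suc d
    K≤big = ℕ.≤-trans (ℕ.m≤m*n K (suc d)) (ℕ.m≤n+m _ k)
    big≡ : iter f (k + K * suc d) s ≡ iter f k s
    big≡ = trans (iter-+ f k (K * suc d) s) (iter-* f K (suc d) (iter f k s) loop)

  settles-early : ∀ s → (∃ λ k → P (iter f k s)) → ∃ λ k → k ≤ size × P (iter f k s)
  settles-early s (K , e) with any-below F (λ k → P? (iter f k s)) (suc size)
  ... | inj₁ (k , k<n , e′) = k , ℕ.s≤s⁻¹ k<n , e′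
  ... | inj₂ none with pigeonhole F (λ k → iter f k s)
  ...   | k , l , k<l , l≤n , e′ = ⊥-elim (never-settles s k (l ∸ suc k)
    (trans (sym (iter-+ f k (suc (l ∸ suc k)) s)) (trans (cong (λ x → iter f x s)
      (trans (ℕ.+-suc k (l ∸ suc k)) (ℕ.m+[n∸m]≡n k<l))) (sym e′)))
    (none k (s≤s (ℕ.≤-trans (ℕ.<⇒≤ k<l) l≤n))) K e)

  settled-size : ∀ s {k} → P (iter f k s) → iter f size s ≡ iter f k s
  settled-size s {k} e with settles-early s (k , e)
  ... | l , l≤n , e′ with ℕ.≤-total k l
  ...   | inj₁ k≤l = settled-≤ s (ℕ.≤-trans k≤l l≤n) e
  ...   | inj₂ l≤k = trans (settled-≤ s l≤n e′) (sym (settled-≤ s l≤k e′))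

least : {P : ℕ → Set} → (∀ k → Dec (P k)) → ∀ n →
        (∃ λ k → k < n × P k × (∀ l → l < k → ¬ P l)) ⊎ (∀ k → k < n → ¬ P k)
least P? zero = inj₂ λ _ ()
least P? (suc n) with least P? n
... | inj₁ (k , k<n , p , m) = inj₁ (k , ℕ.m<n⇒m<1+n k<n , p , m)
... | inj₂ none with P? n
...   | yes p = inj₁ (n , ℕ.≤-refl , p , none)
...   | no ¬p = inj₂ λ k k<1+n p → case-≤ k (ℕ.m≤n⇒m<n∨m≡n (ℕ.s≤s⁻¹ k<1+n)) p
  where
  case-≤ : ∀ k → k < n ⊎ k ≡ n → ¬ _
  case-≤ k (inj₁ k<n) p = none k k<n p
  case-≤ k (inj₂ refl) p = ¬p p

module _ {A : Set} (F : Finite A) where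
  open Finite F using (size)

  pigeonhole-≤ : (f : ∀ k → k ≤ size → A) → ∃₂ λ j k → ∃₂ λ j≤ k≤ → j < k × f j j≤ ≡ f k k≤
  pigeonhole-≤ f with Fin.pigeonhole (ℕ.n<1+n size) (λ x → index F (f (toℕ x) (ℕ.s≤s⁻¹ (Fin.toℕ<n x))))
  ... | j , k , j<k , e = toℕ j , toℕ k , _ , _ , j<k , index-injective F e

  -- Room for `suc size` disjoint windows of length `suc L`, one more than there are values.
  recurrence-bound : ℕ → ℕ
  recurrence-bound L = suc size * suc L

  -- Marks that occur in every window of length L + 1 repeat a value of f.
  module Recurrence {P : ℕ → Set} (f : ℕ → A) (L : ℕ)
    (windows : ∀ (u : ℕ) → u + L < recurrence-bound L → ∃ λ (v : ℕ) → u ≤ v × v ≤ u + L × P v) where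

    block-end : ∀ k → suc (k * suc L + L) ≡ suc k * suc L
    block-end k = trans (sym (ℕ.+-suc (k * suc L) L)) (ℕ.+-comm (k * suc L) (suc L))

    inside : ∀ k → k ≤ size → k * suc L + L < suc size * suc L
    inside k k≤ = ℕ.≤-trans (ℕ.≤-reflexive (block-end k)) (ℕ.*-monoˡ-≤ (suc L) (s≤s k≤))

    mark : ∀ k → k ≤ size → ∃ λ v → k * suc L ≤ v × v ≤ k * suc L + L × P v
    mark k k≤ = windows (k * suc L) (inside k k≤)

    recurs : ∃₂ λ u v → u < v × v < recurrence-bound L × P u × P v × f u ≡ f v
    recurs with pigeonhole-≤ (λ k k≤ → f (proj₁ (mark k k≤)))
    ... | j , k , j≤ , k≤ , j<k , e with mark j j≤ | mark k k≤
    ...   | u , _ , u≤ , pu | v , ≤v , v≤ , pv = u , v ,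
      ℕ.≤-trans (s≤s u≤) (ℕ.≤-trans (ℕ.≤-reflexive (block-end j)) (ℕ.≤-trans (ℕ.*-monoˡ-≤ (suc L) j<k) ≤v)) ,
      ℕ.≤-<-trans v≤ (inside k k≤) , pu , pv , e

-- Moves on the circular tape

module _ {n : ℕ} where

  toℕ-⊕ : ∀ (b : Position n) z → toℕ (b ⊕ z) ≡ (+ toℕ b ℤ.+ z) ℤ.%ℕ (2 + n)
  toℕ-⊕ b z = Fin.toℕ-fromℕ< _

  toℕ-⊕-0 : ∀ (b : Position n) → toℕ (b ⊕ 0ℤ) ≡ toℕ b
  toℕ-⊕-0 b = trans (toℕ-⊕ b 0ℤ) (trans (cong (ℤ._%ℕ (2 + n)) (ℤ.+-identityʳ (+ toℕ b)))
    (ℕ.m<n⇒m%n≡m (Fin.toℕ<n b)))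

  ⊕-0 : ∀ (b : Position n) → b ⊕ 0ℤ ≡ b
  ⊕-0 b = Fin.toℕ-injective (toℕ-⊕-0 b)

  toℕ-right : ∀ (b : Position n) → suc (toℕ b) < 2 + n → toℕ (b ⊕ 1ℤ) ≡ suc (toℕ b)
  toℕ-right b lt = trans (toℕ-⊕ b 1ℤ)
    (trans (cong (ℕ._% (2 + n)) (ℕ.+-comm (toℕ b) 1)) (ℕ.m<n⇒m%n≡m lt))

  toℕ-wrap : ∀ (b : Position n) → toℕ b ≡ suc n → toℕ (b ⊕ 1ℤ) ≡ 0
  toℕ-wrap b e = trans (toℕ-⊕ b 1ℤ)
    (trans (cong (ℕ._% (2 + n)) (trans (ℕ.+-comm (toℕ b) 1) (cong suc e))) (ℕ.n%n≡0 (2 + n)))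

  toℕ-left : ∀ (b : Position n) {k} → toℕ b ≡ suc k → toℕ (b ⊕ -1ℤ) ≡ k
  toℕ-left b {k} e = trans (toℕ-⊕ b -1ℤ)
    (trans (cong (λ m → (+ m ℤ.+ -1ℤ) ℤ.%ℕ (2 + n)) e)
      (ℕ.m<n⇒m%n≡m (ℕ.<-trans (ℕ.n<1+n k) (subst (_< 2 + n) e (Fin.toℕ<n b)))))

  toℕ-unwrap : ∀ (b : Position n) → toℕ b ≡ 0 → toℕ (b ⊕ -1ℤ) ≡ suc n
  toℕ-unwrap b e = trans (toℕ-⊕ b -1ℤ)
    (trans (cong (λ m → (+ m ℤ.+ -1ℤ) ℤ.%ℕ (2 + n)) e) lemma)
    where
    1%N≡1 : 1 ℕ.% (2 + n) ≡ 1
    1%N≡1 = ℕ.m<n⇒m%n≡m 1<N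
      where 1<N : 1 < 2 + n
            1<N = s≤s (s≤s z≤n)
    lemma : -1ℤ ℤ.%ℕ (2 + n) ≡ suc n
    lemma with 1 ℕ.% (2 + n) | 1%N≡1
    ... | _ | refl = refl

  right-left : ∀ (b : Position n) → b ⊕ 1ℤ ⊕ -1ℤ ≡ b
  right-left b with suc (toℕ b) ℕ.<? 2 + n
  ... | yes lt = Fin.toℕ-injective (toℕ-left (b ⊕ 1ℤ) (toℕ-right b lt))
  ... | no ¬lt = Fin.toℕ-injective (trans (toℕ-unwrap (b ⊕ 1ℤ) (toℕ-wrap b e)) (sym e))
    where e = ℕ.≤-antisym (ℕ.s≤s⁻¹ (Fin.toℕ<n b)) (ℕ.s≤s⁻¹ (ℕ.≮⇒≥ ¬lt))

  left-right : ∀ (b : Position n) → b ⊕ -1ℤ ⊕ 1ℤ ≡ b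
  left-right b = go (toℕ b) refl
    where
    go : ∀ k → toℕ b ≡ k → b ⊕ -1ℤ ⊕ 1ℤ ≡ b
    go zero e = Fin.toℕ-injective (trans (toℕ-wrap _ (toℕ-unwrap b e)) (sym e))
    go (suc k) e = Fin.toℕ-injective (trans (trans
      (toℕ-right (b ⊕ -1ℤ) (subst (_< 2 + n) (trans e (cong suc (sym (toℕ-left b e)))) (Fin.toℕ<n b)))
      (cong suc (toℕ-left b e))) (sym e))

  ⊕-⊖ : ∀ (b : Position n) d → b ⊕ μ d ⊕ (ℤ.- μ d) ≡ b
  ⊕-⊖ b ← = left-right b
  ⊕-⊖ b ↓ = trans (⊕-0 _) (⊕-0 b)
  ⊕-⊖ b ⟶ = right-left b

  ⊖-⊕ : ∀ (b : Position n) d → b ⊕ (ℤ.- μ d) ⊕ μ d ≡ b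
  ⊖-⊕ b ← = right-left b
  ⊖-⊕ b ↓ = trans (⊕-0 _) (⊕-0 b)
  ⊖-⊕ b ⟶ = left-right b

-- Inverse moves and the sign of the counter

opposite : Direction → Direction
opposite ← = ⟶
opposite ↓ = ↓
opposite ⟶ = ←

negate : Change → Change
negate dec = inc
negate keep = keep
negate inc = dec

μ-opposite : ∀ d → μ (opposite d) ≡ ℤ.- μ d
μ-opposite ← = refl
μ-opposite ↓ = refl
μ-opposite ⟶ = refl

⟦⟧-negate : ∀ c → ⟦ negate c ⟧ ≡ ℤ.- ⟦ c ⟧
⟦⟧-negate dec = refl
⟦⟧-negate keep = refl
⟦⟧-negate inc = refl

plus-minus : ∀ a c → a ℤ.+ c ℤ.- c ≡ a
plus-minus a c = trans (ℤ.+-assoc a c (ℤ.- c)) (trans (cong (λ z → a ℤ.+ z) (ℤ.+-inverseʳ c)) (ℤ.+-identityʳ a))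

minus-plus : ∀ a c → a ℤ.- c ℤ.+ c ≡ a
minus-plus a c = trans (ℤ.+-assoc a (ℤ.- c) c) (trans (cong (λ z → a ℤ.+ z) (ℤ.+-inverseˡ c)) (ℤ.+-identityʳ a))

sign-≢0 : ∀ {a} → sign a ≡ 𝟏 → a ≢ 0ℤ
sign-≢0 () refl

≢0-sign : ∀ {a} → a ≢ 0ℤ → sign a ≡ 𝟏
≢0-sign {a} a≢0 with a ℤ.≟ 0ℤ
... | yes e = ⊥-elim (a≢0 e)
... | no _ = refl

≡0-sign : ∀ {a} → sign a ≡ 𝟎 → a ≡ 0ℤ
≡0-sign {a} e with a ℤ.≟ 0ℤ
... | yes e = e

positive-sign : ∀ {a} → 0ℤ ℤ.< a → sign a ≡ 𝟏
positive-sign 0<a = ≢0-sign λ e → ℤ.<⇒≢ 0<a (sym e)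

negative-sign : ∀ {a} → a ℤ.< 0ℤ → sign a ≡ 𝟏
negative-sign a<0 = ≢0-sign λ e → ℤ.<⇒≢ a<0 e

-- The counter changes by at most one and cannot jump over zero.
positive-nocross : ∀ {a} c → 0ℤ ℤ.< a → sign (a ℤ.+ ⟦ c ⟧) ≡ 𝟏 → 0ℤ ℤ.< a ℤ.+ ⟦ c ⟧
positive-nocross {+ suc zero} dec _ ()
positive-nocross {+ suc (suc k)} dec _ _ = ℤ.+<+ (s≤s z≤n)
positive-nocross {+ suc k} keep _ _ = ℤ.+<+ (s≤s z≤n)
positive-nocross {+ suc k} inc _ _ = ℤ.+<+ (s≤s z≤n)
positive-nocross {+ zero} c (ℤ.+<+ ()) _
positive-nocross { -[1+ k ]} c () _

negative-nocross : ∀ {a} c → a ℤ.< 0ℤ → sign (a ℤ.+ ⟦ c ⟧) ≡ 𝟏 → a ℤ.+ ⟦ c ⟧ ℤ.< 0ℤ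
negative-nocross { -[1+ zero ]} inc _ ()
negative-nocross { -[1+ suc k ]} inc _ _ = ℤ.-<+
negative-nocross { -[1+ k ]} keep _ _ = ℤ.-<+
negative-nocross { -[1+ k ]} dec _ _ = ℤ.-<+
negative-nocross {+ k} c (ℤ.+<+ ()) _

-- Orbits that repeat up to a shift of the counter

module Shift {X B : Set} (f : X × ℤ × B → X × ℤ × B) (ok : X × ℤ × B → Set) (e : ℤ) where

  shift : X × ℤ × B → X × ℤ × B
  shift (t , a , b) = t , a ℤ.+ e , b

  module _ (ok-shift : ∀ c → ok c → ok (shift c))
           (equivariant : ∀ c → ok c → ok (f c) → f (shift c) ≡ shift (f c))
           (c : X × ℤ × B) (k : ℕ)
           (window : ∀ u → u < suc k → ok (iter f u c))
           (lap : iter f (suc k) c ≡ shift c) where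

    Good : ℕ → Set
    Good u = ok (iter f u c) × iter f (suc k + u) c ≡ shift (iter f u c)

    good-below : ∀ m u → u < m → Good u
    good : ∀ u → Good u

    -- A time beyond the first lap is the shifted copy of the time one lap earlier, and `ok`
    -- survives the shift.
    ok-at : ∀ m u → (∀ v → v < u → Good v) → ok (iter f u c)
    ok-at m u ih with u ℕ.<? suc k
    ... | yes u<p = window u u<p
    ... | no ¬u<p = subst ok (trans (sym (proj₂ v-good)) (cong (λ x → iter f x c) p+v≡u)) (ok-shift _ (proj₁ v-good))
      where
      v = u ∸ suc k
      p+v≡u : suc k + v ≡ u
      p+v≡u = ℕ.m+[n∸m]≡n (ℕ.≮⇒≥ ¬u<p)
      v-good : Good v
      v-good = ih v (ℕ.≤-trans (s≤s (ℕ.m≤n+m v k)) (ℕ.≤-reflexive p+v≡u))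

    good-below (suc m) u (s≤s u≤m) = okᵤ , lapᵤ u refl
      where
      ih : ∀ v → v < u → Good v
      ih v v<u = good-below m v (ℕ.<-≤-trans v<u u≤m)
      okᵤ : ok (iter f u c)
      okᵤ = ok-at m u ih
      lapᵤ : ∀ x → x ≡ u → iter f (suc k + x) c ≡ shift (iter f x c)
      lapᵤ zero _ = trans (cong (λ x → iter f x c) (ℕ.+-identityʳ (suc k))) lap
      lapᵤ (suc x) refl = begin
        iter f (suc k + suc x) c           ≡⟨ cong (λ x → iter f x c) (ℕ.+-suc (suc k) x) ⟩
        iter f (suc (suc k + x)) c         ≡⟨ iter-suc f (suc k + x) c ⟩
        f (iter f (suc k + x) c)           ≡⟨ cong f (proj₂ prev) ⟩
        f (shift (iter f x c))             ≡⟨ equivariant _ (proj₁ prev) (subst ok (iter-suc f x c) okᵤ) ⟩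
        shift (f (iter f x c))             ≡⟨ cong shift (iter-suc f x c) ⟨
        shift (iter f (suc x) c)           ∎
        where
        open ≡-Reasoning
        prev : Good x
        prev = ih x ℕ.≤-refl

    good u = good-below (suc u) u ℕ.≤-refl

    forever : ∀ u → ok (iter f u c)
    forever u = proj₁ (good u)

-- The Euler tour of a tree of predecessors

below-last : ∀ {m} → Fin (suc m) → Maybe (Fin m)
below-last {zero}  zero    = nothing
below-last {suc m} zero    = just zero
below-last {suc m} (suc k) = Maybe.map suc (below-last k)

below-last-inject₁ : ∀ {m} (k : Fin m) → below-last (inject₁ k) ≡ just k
below-last-inject₁ zero    = refl
below-last-inject₁ (suc k) = cong (Maybe.map suc) (below-last-inject₁ k)

below-last-fromℕ : ∀ m → below-last (fromℕ m) ≡ nothing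
below-last-fromℕ zero    = refl
below-last-fromℕ (suc m) = cong (Maybe.map suc) (below-last-fromℕ m)

data Last-View {m} : Fin (suc m) → Set where
  inject : (k : Fin m) → Last-View (inject₁ k)
  last   : Last-View (fromℕ m)

last-view : ∀ {m} (k : Fin (suc m)) → Last-View k
last-view {zero}  zero = last
last-view {suc m} zero = inject zero
last-view {suc m} (suc k) with last-view k
... | inject l = inject (suc l)
... | last     = last

-- `h` says where trees are cut, and may depend on the sign of the counter. The final machine takes
-- the halting states; the excursions between zeros of the counter take `zeroOr`.
module Euler {Σ Q : Set} (F : Finite Q) (δ : Q → Γ Σ → S → Q × Change × Direction) (h : Q → S → Bool) where

  -- A candidate child is named by its edge: its own state, and the change and direction of the
  -- transition to the parent. All nodes thus have the same slots, and the name alone tells how to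
  -- move there and back.
  FC : Finite (Q × Change × Direction)
  FC = fin-× F (fin-× fin-Change fin-Direction)

  m : ℕ
  m = Finite.size FC

  child : Fin m → Q
  child k = proj₁ (Finite.element FC k)

  childC : Fin m → Change
  childC k = proj₁ (proj₂ (Finite.element FC k))

  childD : Fin m → Direction
  childD k = proj₂ (proj₂ (Finite.element FC k))

  up : Γ Σ → S → Q → Q × Fin m
  up σ s q = proj₁ (δ q σ s) , index FC (q , proj₂ (δ q σ s))

  -- The first component cuts the tree: a stopped node is nobody's child.
  Real : Γ Σ → S → Q → Fin m → Set
  Real σ s q k = h (child k) s ≡ false × up σ s (child k) ≡ (q , k)

  real? : ∀ σ s q k → Dec (Real σ s q k)
  real? σ s q k = (h (child k) s Bool.≟ false) ×-dec
    Product.≡-dec (Finite._≟_ F) Fin._≟_ (up σ s (child k)) (q , k)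

  real-δ : ∀ {σ s q k} → Real σ s q k → δ (child k) σ s ≡ (q , childC k , childD k)
  real-δ {σ} {s} {q} {k} (_ , e) = cong₂ _,_ (cong proj₁ e)
    (cong proj₂ (trans (sym (element∘index FC _)) (cong (Finite.element FC) (cong proj₂ e))))

  child-up : ∀ σ s q → child (proj₂ (up σ s q)) ≡ q
  child-up σ s q = cong proj₁ (element∘index FC _)

  up-real : ∀ σ s q → h q s ≡ false → Real σ s (proj₁ (up σ s q)) (proj₂ (up σ s q))
  up-real σ s q e rewrite child-up σ s q = e , refl

  -- In try q j the head is at a node of the tree with state q whose first j
  -- candidate children are done with; in arr q k it has moved to where the k-th
  -- candidate child of such a node would be. Counter and head move according to
  -- the new state only, which makes the tour a simple machine.
  data State : Set where
    try : Q → Fin (suc m) → State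
    arr : Q → Fin m → State

  fin-State : Finite State
  fin-State = fin-map (mk↔ₛ′ (λ { (try q j) → inj₁ (q , j) ; (arr q k) → inj₂ (q , k) })
    (λ { (inj₁ (q , j)) → try q j ; (inj₂ (q , k)) → arr q k })
    (λ { (inj₁ _) → refl ; (inj₂ _) → refl })
    (λ { (try _ _) → refl ; (arr _ _) → refl }))
    (fin-⊎ (fin-× F (fin-Fin (suc m))) (fin-× F (fin-Fin m)))

  opaque

    -- A stopped node is a root, and there the tour starts over. This closes its orbit and keeps `V`
    -- invertible.
    ascend : Bool → Q → Q × Fin m → State
    ascend true  q _ = try q zero
    ascend false q (q′ , k) = try q′ (suc k)

    leave : Γ Σ → S → Q → Maybe (Fin m) → State
    leave σ s q (just k) = arr q k
    leave σ s q nothing  = ascend (h q s) q (up σ s q)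

    enter : ∀ {σ s} q k → Dec (Real σ s q k) → State
    enter q k (yes _) = try (child k) zero
    enter q k (no _)  = try q (suc k)

    V : Γ Σ → S → State → State
    V σ s (try q j) = leave σ s q (below-last j)
    V σ s (arr q k) = enter q k (real? σ s q k)

    retreat : Bool → Q → Q × Fin m → State
    retreat true  q _ = try q (fromℕ m)
    retreat false q (q′ , k) = arr q′ k

    reenter : ∀ {σ s} q k → Dec (Real σ s q k) → State
    reenter q k (yes _) = try (child k) (fromℕ m)
    reenter q k (no _)  = arr q k

    V⁻¹ : Γ Σ → S → State → State
    V⁻¹ σ s (try q zero)    = retreat (h q s) q (up σ s q)
    V⁻¹ σ s (try q (suc k)) = reenter q k (real? σ s q k)
    V⁻¹ σ s (arr q k)       = try q (inject₁ k)

    retreat-real : ∀ {σ s q k} → Real σ s q k → retreat (h (child k) s) (child k) (up σ s (child k)) ≡ arr q k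
    retreat-real {k = k} (e , e′) = cong₂ (λ b x → retreat b (child k) x) e e′

    leave-real : ∀ {σ s q k} → Real σ s q k → leave σ s (child k) (below-last (fromℕ m)) ≡ try q (suc k)
    leave-real {σ} {s} {k = k} (e , e′) = trans (cong (leave σ s (child k)) (below-last-fromℕ m))
      (cong₂ (λ b x → ascend b (child k) x) e e′)

    V⁻¹∘V : ∀ σ s t → V⁻¹ σ s (V σ s t) ≡ t
    V⁻¹∘V σ s (try q j) with last-view j
    ... | inject k rewrite below-last-inject₁ k = refl
    ... | last rewrite below-last-fromℕ m with h q s in e
    ...   | true rewrite e = refl
    ...   | false with real? σ s (proj₁ (up σ s q)) (proj₂ (up σ s q))
    ...     | yes _ = cong (λ q → try q (fromℕ m)) (child-up σ s q)
    ...     | no ¬r = ⊥-elim (¬r (up-real σ s q e))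
    V⁻¹∘V σ s (arr q k) with real? σ s q k in eq
    ... | yes r = retreat-real r
    ... | no _ rewrite eq = refl

    V∘V⁻¹ : ∀ σ s t → V σ s (V⁻¹ σ s t) ≡ t
    V∘V⁻¹ σ s (try q zero) with h q s in e
    ... | true rewrite below-last-fromℕ m | e = refl
    ... | false with real? σ s (proj₁ (up σ s q)) (proj₂ (up σ s q))
    ...   | yes _ = cong (λ q → try q zero) (child-up σ s q)
    ...   | no ¬r = ⊥-elim (¬r (up-real σ s q e))
    V∘V⁻¹ σ s (try q (suc k)) with real? σ s q k in eq
    ... | yes r = leave-real r
    ... | no _ rewrite eq = refl
    V∘V⁻¹ σ s (arr q k) rewrite below-last-inject₁ k = refl

  C : State → Change
  C (try q zero)    = keep
  C (try q (suc k)) = childC k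
  C (arr q k)       = negate (childC k)

  D : State → Direction
  D (try q zero)    = ↓
  D (try q (suc k)) = childD k
  D (arr q k)       = opposite (childD k)

  module Run {n : ℕ} (w : Position n → Γ Σ) where

    K R : Set
    K = Config Q n
    R = Config State n

    rstep : R → R
    rstep (t , a , b) = V (w b) (sign a) t , a ℤ.+ ⟦ C (V (w b) (sign a) t) ⟧ , b ⊕ μ (D (V (w b) (sign a) t))

    unmove : R → ℤ × Position n
    unmove (t , a , b) = a ℤ.- ⟦ C t ⟧ , b ⊕ (ℤ.- μ (D t))

    rback : R → R
    rback c = V⁻¹ (w (proj₂ (unmove c))) (sign (proj₁ (unmove c))) (proj₁ c) , unmove c

    rback-rstep : ∀ c → rback (rstep c) ≡ c
    rback-rstep (t , a , b)
      rewrite plus-minus a ⟦ C (V (w b) (sign a) t) ⟧ | ⊕-⊖ b (D (V (w b) (sign a) t)) | V⁻¹∘V (w b) (sign a) t = refl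

    mnext : K → K
    mnext (q , a , b) = proj₁ (δ q (w b) (sign a)) , a ℤ.+ ⟦ proj₁ (proj₂ (δ q (w b) (sign a))) ⟧
      , b ⊕ μ (proj₂ (proj₂ (δ q (w b) (sign a))))

    stop : K → Bool
    stop (q , a , b) = h q (sign a)

    stopped : R → Bool
    stopped (try q j , a , b) = h q (sign a)
    stopped (arr q k , a , b) = false

    at : K → Fin (suc m) → R
    at (q , a , b) j = try q j , a , b

    trial : K → Fin m → R
    trial (q , a , b) k = arr q k , a ℤ.- ⟦ childC k ⟧ , b ⊕ (ℤ.- μ (childD k))

    ch : K → Fin m → K
    ch (q , a , b) k = child k , a ℤ.- ⟦ childC k ⟧ , b ⊕ (ℤ.- μ (childD k))

    slot : K → Fin m
    slot (q , a , b) = proj₂ (up (w b) (sign a) q)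

    IsChild : K → Fin m → Set
    IsChild κ@(q , _) k = Real (w (proj₂ (proj₂ (ch κ k)))) (sign (proj₁ (proj₂ (ch κ k)))) q k

    isChild? : ∀ κ k → Dec (IsChild κ k)
    isChild? κ k = real? _ _ _ _

    child-stop : ∀ κ k → IsChild κ k → stop (ch κ k) ≡ false
    child-stop κ k r = proj₁ r

    child-mnext : ∀ κ k → IsChild κ k → mnext (ch κ k) ≡ κ
    child-mnext κ@(q , a , b) k r rewrite real-δ r = cong (q ,_) (cong₂ _,_ (minus-plus a _) (⊖-⊕ b (childD k)))

    child-slot : ∀ κ k → IsChild κ k → slot (ch κ k) ≡ k
    child-slot κ k (_ , e) = cong proj₂ e

    childC-slot : ∀ κ → childC (slot κ) ≡ proj₁ (proj₂ (δ (proj₁ κ) (w (proj₂ (proj₂ κ))) (sign (proj₁ (proj₂ κ)))))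
    childC-slot κ = cong (proj₁ ∘ proj₂) (element∘index FC _)

    childD-slot : ∀ κ → childD (slot κ) ≡ proj₂ (proj₂ (δ (proj₁ κ) (w (proj₂ (proj₂ κ))) (sign (proj₁ (proj₂ κ)))))
    childD-slot κ = cong (proj₂ ∘ proj₂) (element∘index FC _)

    ch-slot : ∀ κ → ch (mnext κ) (slot κ) ≡ κ
    ch-slot κ@(q , a , b) rewrite childC-slot κ | childD-slot κ | child-up (w b) (sign a) q =
      cong (q ,_) (cong₂ _,_ (plus-minus a _) (⊕-⊖ b (proj₂ (proj₂ (δ q (w b) (sign a))))))

    slot-isChild : ∀ κ → stop κ ≡ false → IsChild (mnext κ) (slot κ)
    slot-isChild κ@(q , a , b) e = subst (λ κ′ → Real (w (proj₂ (proj₂ κ′))) (sign (proj₁ (proj₂ κ′))) (proj₁ (mnext κ)) (slot κ))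
      (sym (ch-slot κ)) (up-real (w b) (sign a) q e)

    opaque
      unfolding V

      rstep-down : ∀ κ k → rstep (at κ (inject₁ k)) ≡ trial κ k
      rstep-down (q , a , b) k rewrite below-last-inject₁ k | ⟦⟧-negate (childC k) | μ-opposite (childD k) = refl

      rstep-enter : ∀ κ k → IsChild κ k → rstep (trial κ k) ≡ at (ch κ k) zero
      rstep-enter κ@(q , a , b) k r with isChild? κ k
      ... | yes _ = cong (try (child k) zero ,_) (cong₂ _,_ (ℤ.+-identityʳ _) (⊕-0 _))
      ... | no ¬r = ⊥-elim (¬r r)

      rstep-skip : ∀ κ k → ¬ IsChild κ k → rstep (trial κ k) ≡ at κ (suc k)
      rstep-skip κ@(q , a , b) k ¬r with isChild? κ k
      ... | yes r = ⊥-elim (¬r r)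
      ... | no _ = cong (try q (suc k) ,_) (cong₂ _,_ (minus-plus a _) (⊖-⊕ b (childD k)))

      rstep-up : ∀ κ → stop κ ≡ false → rstep (at κ (fromℕ m)) ≡ at (mnext κ) (suc (slot κ))
      rstep-up κ@(q , a , b) e rewrite below-last-fromℕ m | e | childC-slot κ | childD-slot κ = refl

    infix 4 _↝_
    infixr 5 _◅_

    data _↝_ : R → R → Set where
      ε   : ∀ {c} → c ↝ c
      _◅_ : ∀ {c c′} → stopped c ≡ false → rstep c ↝ c′ → c ↝ c′

    infixr 5 _◅◅_
    _◅◅_ : ∀ {c c′ c″} → c ↝ c′ → c′ ↝ c″ → c ↝ c″
    ε        ◅◅ q = q
    (e ◅ p) ◅◅ q = e ◅ (p ◅◅ q)

    one : ∀ {c c′} → stopped c ≡ false → rstep c ≡ c′ → c ↝ c′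
    one e refl = e ◅ ε

    skip : ∀ κ k → stop κ ≡ false → ¬ IsChild κ k → at κ (inject₁ k) ↝ at κ (suc k)
    skip κ k e ¬r = one e (rstep-down κ k) ◅◅ one refl (rstep-skip κ k ¬r)

    climb : ∀ κ → stop κ ≡ false → at κ (fromℕ m) ↝ at (mnext κ) (suc (slot κ))
    climb κ e = one e (rstep-up κ e)

    through : ∀ κ k → IsChild κ k → at (ch κ k) zero ↝ at (ch κ k) (fromℕ m) →
              trial κ k ↝ at κ (suc k)
    through κ k r p = one refl (rstep-enter κ k r) ◅◅ p ◅◅
      subst (λ c → at (ch κ k) (fromℕ m) ↝ c)
        (cong₂ (λ κ k → at κ (suc k)) (child-mnext κ k r) (child-slot κ k r))
        (climb (ch κ k) (child-stop κ k r))

    visit : ∀ κ k → stop κ ≡ false → IsChild κ k → at (ch κ k) zero ↝ at (ch κ k) (fromℕ m) →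
            at κ (inject₁ k) ↝ at κ (suc k)
    visit κ k e r p = one e (rstep-down κ k) ◅◅ through κ k r p

    ↝-iter : ∀ {c c′} → c ↝ c′ → ∃ λ k → iter rstep k c ≡ c′ × (∀ u → u < k → stopped (iter rstep u c) ≡ false)
    ↝-iter ε = 0 , refl , λ _ ()
    ↝-iter (e ◅ p) with ↝-iter p
    ... | k , e′ , none = suc k , e′ , λ { zero _ → e ; (suc u) (s≤s u<k) → none u u<k }

    _≺_ : K → K → Set
    κ′ ≺ κ = stop κ′ ≡ false × mnext κ′ ≡ κ

    -- Well-founded induction on the tree and, within a node, downward induction on the cursor: each
    -- slot is skipped, or its finite subtree is toured first.
    down-acc : ∀ {κ} → Acc _≺_ κ → stop κ ≡ false → ∀ j → at κ j ↝ at κ (fromℕ m)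
    down-acc {κ} (wf rec) e = Fin.>-weakInduction (λ j → at κ j ↝ at κ (fromℕ m)) ε λ k p → step k ◅◅ p
      where
      step : ∀ k → at κ (inject₁ k) ↝ at κ (suc k)
      step k with isChild? κ k
      ... | no ¬r = skip κ k e ¬r
      ... | yes r = visit κ k e r (down-acc (rec (child-stop κ k r , child-mnext κ k r)) (child-stop κ k r) zero)

    -- A halting configuration starts the tour at a stopped node, so the first
    -- step is taken unconditionally.
    data Reaches (y : K) : K → Set where
      here : ∀ {κ} → κ ≡ y → stop κ ≡ true → Reaches y κ
      next : ∀ {κ} → stop κ ≡ false → Reaches y (mnext κ) → Reaches y κ

    reaches-stop : ∀ {y κ} → Reaches y κ → stop y ≡ true
    reaches-stop (here refl e) = e
    reaches-stop (next _ p) = reaches-stop p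

    acc-below : ∀ {y κ} → Acc _≺_ y → Reaches y κ → Acc _≺_ κ
    acc-below a (here refl _) = a
    acc-below a (next e p) with acc-below a p
    ... | wf rec = rec (e , refl)

    -- At each node of the path to the root the remaining slots are finished before the tour climbs;
    -- `j′` records the slot through which the root is entered.
    tour-from : ∀ {y κ} → Acc _≺_ y → Reaches y κ → ∀ j → ∃ λ j′ → at κ j ↝ at y j′
    tour-from a (here refl _) j = j , ε
    tour-from {κ = κ} a r@(next e p) j with tour-from a p (suc (slot κ))
    ... | j′ , q = j′ , down-acc (acc-below a r) e j ◅◅ climb κ e ◅◅ q

    first : ∀ {m} → Fin m → ∃ λ (k : Fin m) → zero ≡ inject₁ k
    first {suc m} _ = zero , refl

    tour-halts : ∀ {y κ} → Acc _≺_ y → Reaches y κ → ∃ λ j → rstep (at κ zero) ↝ at y j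
    tour-halts {κ = κ} a r@(next _ _) with tour-from a r zero
    tour-halts a (next _ _) | j , _ ◅ q = j , q
    tour-halts a r@(next e _) | j , ε with trans (sym e) (reaches-stop r)
    ... | ()
    -- The start may itself be the root; then the tour leaves for slot 0 and comes back. The index
    -- only witnesses that there is a slot at all, so that cursor `zero` is not the last one.
    tour-halts {κ = κ} (wf rec) (here refl e) with first (index FC (proj₁ κ , keep , ↓))
    ... | k , 0≡k = suc k , subst (_↝ at κ (suc k))
                      (sym (trans (cong (λ j → rstep (at κ j)) 0≡k) (rstep-down κ k))) go
      where
      go : trial κ k ↝ at κ (suc k)
      go with isChild? κ k
      ... | no ¬r = one refl (rstep-skip κ k ¬r)
      ... | yes r = through κ k r (down-acc (rec (child-stop κ k r , child-mnext κ k r)) (child-stop κ k r) zero)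

    module Lap where

      counter : R → ℤ
      counter (_ , a , _) = a

      Live : R → Set
      Live c = sign (counter c) ≡ 𝟏 × stopped c ≡ false

      module _ (Side : ℤ → Set) (side-sign : ∀ {a} → Side a → sign a ≡ 𝟏)
               (nocross : ∀ {a} c → Side a → sign (a ℤ.+ ⟦ c ⟧) ≡ 𝟏 → Side (a ℤ.+ ⟦ c ⟧)) where

        Ok : R → Set
        Ok c = Side (counter c) × stopped c ≡ false

        ok-live : ∀ {c} → Ok c → Live c
        ok-live (s , e) = side-sign s , e

        ok-along : ∀ u c → Side (counter c) → (∀ v → v ≤ u → Live (iter rstep v c)) → Ok (iter rstep u c)
        ok-along zero c s live = s , proj₂ (live 0 z≤n)
        ok-along (suc u) c s live = ok-along u (rstep c) (nocross (C (V (w (proj₂ (proj₂ c))) (sign (counter c)) (proj₁ c))) s (proj₁ (live 1 (s≤s z≤n))))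
          λ v v≤u → live (suc v) (s≤s v≤u)

        module _ (e : ℤ) (side-+ : ∀ {a} → Side a → Side (a ℤ.+ e)) where
          open Shift rstep Ok e using (shift)

          stopped-shift : ∀ c → Side (counter c) → stopped (shift c) ≡ stopped c
          stopped-shift (try q j , a , b) s rewrite side-sign s | side-sign (side-+ s) = refl
          stopped-shift (arr q k , a , b) s = refl

          ok-shift : ∀ c → Ok c → Ok (shift c)
          ok-shift c (s , st) = side-+ s , trans (stopped-shift c s) st

          +-swapʳ : ∀ a x → a ℤ.+ e ℤ.+ x ≡ a ℤ.+ x ℤ.+ e
          +-swapʳ a x = trans (ℤ.+-assoc a e x) (trans (cong (λ z → a ℤ.+ z) (ℤ.+-comm e x)) (sym (ℤ.+-assoc a x e)))

          -- The tour sees only the sign of the counter, which the shift preserves on one side of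
          -- zero.
          rstep-shift : ∀ c → Ok c → Ok (rstep c) → rstep (shift c) ≡ shift (rstep c)
          rstep-shift (t , a , b) (s , _) _ rewrite side-sign s | side-sign (side-+ s) =
            cong (λ z → V (w b) 𝟏 t , z , b ⊕ μ (D (V (w b) 𝟏 t))) (+-swapʳ a _)

          rback-shift : ∀ c → Ok c → Ok (rback c) → rback (shift c) ≡ shift (rback c)
          rback-shift (t , a , b) _ (s , _) rewrite +-swapʳ a (ℤ.- ⟦ C t ⟧) | side-sign s | side-sign (side-+ s) = refl

          forward-forever : ∀ c k → (∀ u → u < suc k → Ok (iter rstep u c)) → iter rstep (suc k) c ≡ shift c →
                            ∀ u → Live (iter rstep u c)
          forward-forever c k win lap u = ok-live {iter rstep u c} (Shift.forever rstep Ok e ok-shift rstep-shift c k win lap u)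

          backward-forever : ∀ c k → (∀ u → u < suc k → Ok (iter rback u c)) → iter rback (suc k) c ≡ shift c →
                             ∀ u → Live (iter rback u c)
          backward-forever c k win lap u = ok-live {iter rback u c} (Shift.forever rback Ok e ok-shift rback-shift c k win lap u)

      rback-iter : ∀ u v c → iter rback u (iter rstep (u + v) c) ≡ iter rstep v c
      rback-iter u v c = trans (cong (iter rback u) (trans (cong (λ x → iter rstep x c) (ℕ.+-comm u v)) (iter-+ rstep v u c)))
        (iter-cancel rback-rstep u (iter rstep v c))

      place : R → State × Position n
      place (t , _ , b) = t , b

      -- A live stretch that returns to the same place, only with a different
      -- counter, repeats for ever in the direction in which the counter moves
      -- away from zero.
      lap : ∀ c k → (∀ u → u ≤ suc k → Live (iter rstep u c)) → place (iter rstep (suc k) c) ≡ place c →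
            (∀ u → Live (iter rstep u c)) ⊎ (∀ u → Live (iter rback u (iter rstep (suc k) c)))
      lap c k live pl = cases (counter c) refl (ℤ.≤-total 0ℤ e)
        where
        c′ = iter rstep (suc k) c
        e = counter c′ ℤ.- counter c
        a+e : counter c ℤ.+ e ≡ counter c′
        a+e = trans (ℤ.+-comm (counter c) e) (minus-plus (counter c′) (counter c))
        a-e : counter c′ ℤ.+ ℤ.- e ≡ counter c
        a-e = trans (cong (λ z → z ℤ.+ ℤ.- e) (sym a+e)) (plus-minus (counter c) e)
        up-lap : c′ ≡ Shift.shift rstep Live e c
        up-lap = trans (cong₂ (λ p a → proj₁ p , a , proj₂ p) pl refl) (cong (λ a → proj₁ c , a , proj₂ (proj₂ c)) (sym a+e))
        down-lap : iter rback (suc k) c′ ≡ Shift.shift rback Live (ℤ.- e) c′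
        down-lap = trans (iter-cancel rback-rstep (suc k) c)
          (trans (cong₂ (λ p a → proj₁ p , a , proj₂ p) (sym pl) refl) (cong (λ a → proj₁ c′ , a , proj₂ (proj₂ c′)) (sym a-e)))
        module Sided (Side : ℤ → Set) (ss : ∀ {a} → Side a → sign a ≡ 𝟏)
                     (nc : ∀ {a} c → Side a → sign (a ℤ.+ ⟦ c ⟧) ≡ 𝟏 → Side (a ℤ.+ ⟦ c ⟧)) (s₀ : Side (counter c)) where
          ok : ∀ u → u ≤ suc k → Ok Side ss nc (iter rstep u c)
          ok u u≤ = ok-along Side ss nc u c s₀ λ v v≤u → live v (ℕ.≤-trans v≤u u≤)
          fwd : (∀ {a} → Side a → Side (a ℤ.+ e)) → ∀ u → Live (iter rstep u c)
          fwd add = forward-forever Side ss nc e add c k (λ u u<p → ok u (ℕ.<⇒≤ u<p)) up-lap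
          bwd : (∀ {a} → Side a → Side (a ℤ.+ ℤ.- e)) → ∀ u → Live (iter rback u c′)
          bwd add = backward-forever Side ss nc (ℤ.- e) add c′ k
            (λ u u<p → subst (Ok Side ss nc) (sym (trans (cong (λ x → iter rback u (iter rstep x c)) (sym (ℕ.m+[n∸m]≡n (ℕ.<⇒≤ u<p))))
              (rback-iter u (suc k ∸ u) c))) (ok (suc k ∸ u) (ℕ.m∸n≤m (suc k) u))) down-lap
        cases : ∀ a → counter c ≡ a → 0ℤ ℤ.≤ e ⊎ e ℤ.≤ 0ℤ →
                (∀ u → Live (iter rstep u c)) ⊎ (∀ u → Live (iter rback u c′))
        cases (+ zero) ea _ = ⊥-elim (sign-≢0 (proj₁ (live 0 z≤n)) ea)
        cases (+ suc x) ea (inj₁ 0≤e) = inj₁ (Sided.fwd (0ℤ ℤ.<_) positive-sign positive-nocross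
          (subst (0ℤ ℤ.<_) (sym ea) (ℤ.+<+ (s≤s z≤n))) λ 0<a → ℤ.+-mono-<-≤ 0<a 0≤e)
        cases (+ suc x) ea (inj₂ e≤0) = inj₂ (Sided.bwd (0ℤ ℤ.<_) positive-sign positive-nocross
          (subst (0ℤ ℤ.<_) (sym ea) (ℤ.+<+ (s≤s z≤n))) λ 0<a → ℤ.+-mono-<-≤ 0<a (ℤ.neg-mono-≤ e≤0))
        cases -[1+ x ] ea (inj₁ 0≤e) = inj₂ (Sided.bwd (ℤ._< 0ℤ) negative-sign negative-nocross
          (subst (ℤ._< 0ℤ) (sym ea) ℤ.-<+) λ a<0 → ℤ.+-mono-<-≤ a<0 (ℤ.neg-mono-≤ 0≤e))
        cases -[1+ x ] ea (inj₂ e≤0) = inj₁ (Sided.fwd (ℤ._< 0ℤ) negative-sign negative-nocross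
          (subst (ℤ._< 0ℤ) (sym ea) ℤ.-<+) λ a<0 → ℤ.+-mono-<-≤ a<0 e≤0)

    -- Finiteness of the trees of predecessors

    module Bounded where

      Node : Set
      Node = Q × Position n

      -- The machine at nonzero counter, with the value of the counter forgotten. Halted nodes are
      -- made fixed points so that `Absorbing` applies.
      walk : Node → Node
      walk (q , b) = if h q 𝟏 then (q , b) else (proj₁ (δ q (w b) 𝟏) , b ⊕ μ (proj₂ (proj₂ (δ q (w b) 𝟏))))

      Halts : Node → Set
      Halts v = ∃ λ k → h (proj₁ (iter walk k v)) 𝟏 ≡ true

      halts-next : ∀ q b → Halts (proj₁ (δ q (w b) 𝟏) , b ⊕ μ (proj₂ (proj₂ (δ q (w b) 𝟏)))) → Halts (q , b)
      halts-next q b (k , e) with h q 𝟏 in eq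
      ... | true  = 0 , eq
      ... | false = suc k , trans (cong (λ v → h (proj₁ (iter walk k v)) 𝟏)
        (cong (λ z → if z then (q , b) else (proj₁ (δ q (w b) 𝟏) , b ⊕ μ (proj₂ (proj₂ (δ q (w b) 𝟏))))) eq)) e

      module _ (halts : ∀ (v : Node) → Halts v) where

        fin-Node : Finite Node
        fin-Node = fin-× F (fin-Fin (2 + n))

        L B : ℕ
        L = Finite.size fin-Node
        B = recurrence-bound fin-Node L

        halts-early : ∀ v → ∃ λ k → k ≤ L × h (proj₁ (iter walk k v)) 𝟏 ≡ true
        halts-early v = Absorbing.settles-early fin-Node walk (λ v → h (proj₁ v) 𝟏 ≡ true) (λ v → h (proj₁ v) 𝟏 Bool.≟ true)
          (λ v e → cong (λ z → if z then v else _) e) v (halts v)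

        node : K → Node
        node (q , a , b) = q , b

        node-mnext : ∀ κ → stop κ ≡ false → sign (proj₁ (proj₂ κ)) ≡ 𝟏 → node (mnext κ) ≡ walk (node κ)
        node-mnext (q , a , b) e s = trans (cong (λ s → proj₁ (δ q (w b) s) , b ⊕ μ (proj₂ (proj₂ (δ q (w b) s)))) s)
          (cong (λ z → if z then (q , b) else (proj₁ (δ q (w b) 𝟏) , b ⊕ μ (proj₂ (proj₂ (δ q (w b) 𝟏))))) (sym (trans (cong (h q) (sym s)) e)))

        module _ (κ : K) (t : ℕ) (moving : ∀ (u : ℕ) → u < t → stop (iter mnext u κ) ≡ false)
                 (stops : stop (iter mnext t κ) ≡ true) (late : B ≤ t) where

          c : ℕ → K
          c u = iter mnext u κ

          Zero : ℕ → Set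
          Zero u = sign (proj₁ (proj₂ (c u))) ≡ 𝟎

          nonzero : ∀ s → s ≢ 𝟎 → s ≡ 𝟏
          nonzero 𝟎 ne = ⊥-elim (ne refl)
          nonzero 𝟏 _ = refl

          node-run : ∀ u k → u + k ≤ t → (∀ v → v < k → ¬ Zero (u + v)) → node (c (u + k)) ≡ iter walk k (node (c u))
          node-run u zero _ _ = cong (node ∘ c) (ℕ.+-identityʳ u)
          node-run u (suc k) u+k≤ nz = trans (cong node (trans (cong c (ℕ.+-suc u k)) (iter-suc mnext (u + k) κ)))
            (trans (node-mnext (c (u + k)) (moving (u + k) (ℕ.≤-trans (ℕ.≤-reflexive (sym (ℕ.+-suc u k))) u+k≤)) (nonzero _ (nz k ℕ.≤-refl)))
            (trans (cong walk (node-run u k (ℕ.≤-trans (ℕ.+-monoʳ-≤ u (ℕ.n≤1+n k)) u+k≤) (λ v v<k → nz v (ℕ.m<n⇒m<1+n v<k))))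
              (sym (iter-suc walk k _))))

          zero? : ∀ u → Dec (Zero u)
          zero? u with sign (proj₁ (proj₂ (c u)))
          ... | 𝟎 = yes refl
          ... | 𝟏 = no λ ()

          -- At nonzero counter the run follows `walk`, which halts within `L` steps; a longer
          -- stretch that is still moving must meet a zero.
          windows : ∀ u → u + L < B → ∃ λ v → u ≤ v × v ≤ u + L × Zero v
          windows u lt with any-below fin-Node (λ k → zero? (u + k)) (suc L)
          ... | inj₁ (k , k≤ , z) = u + k , ℕ.m≤m+n u k , ℕ.+-monoʳ-≤ u (ℕ.s≤s⁻¹ k≤) , z
          ... | inj₂ nz with halts-early (node (c u))
          ...   | k , k≤L , stopping = ⊥-elim (Bool.not-¬ {x = false} refl (trans (sym (trans (cong (h (proj₁ (c (u + k)))) (sym (nonzero _ (nz k (s≤s k≤L))))) (moving (u + k) u+k<t)))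
            (trans (cong (λ v → h (proj₁ v) 𝟏) (node-run u k (ℕ.<⇒≤ u+k<t) (λ v v<k → nz v (ℕ.≤-trans v<k (ℕ.≤-trans k≤L (ℕ.n≤1+n L)))))) stopping)))
            where
            u+k<t : u + k < t
            u+k<t = ℕ.<-≤-trans (ℕ.≤-<-trans (ℕ.+-monoʳ-≤ u k≤L) lt) late

          open Recurrence fin-Node (node ∘ c) L windows

          same-zero : ∀ κ κ′ → sign (proj₁ (proj₂ κ)) ≡ 𝟎 → sign (proj₁ (proj₂ κ′)) ≡ 𝟎 → node κ ≡ node κ′ → κ ≡ κ′
          same-zero (q , a , b) (q′ , a′ , b′) z z′ e =
            cong₂ (λ v a → proj₁ v , a , proj₂ v) e (trans (≡0-sign {a} z) (sym (≡0-sign {a′} z′)))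

          -- A repeated configuration would bring the halt forward to a time at which the run is
          -- still moving.
          no-return : ∀ u v → u < v → v < B → c u ≢ c v
          no-return u v u<v v<B e = Bool.not-¬ {x = false} refl
            (trans (sym (moving (u + (t ∸ v)) early)) (trans (cong stop again) stops))
            where
            v≤t : v ≤ t
            v≤t = ℕ.≤-trans (ℕ.<⇒≤ v<B) late
            early : u + (t ∸ v) < t
            early = ℕ.<-≤-trans (ℕ.+-monoˡ-< (t ∸ v) u<v) (ℕ.≤-reflexive (ℕ.m+[n∸m]≡n v≤t))
            again : c (u + (t ∸ v)) ≡ c t
            again = trans (iter-+ mnext u (t ∸ v) κ) (trans (cong (iter mnext (t ∸ v)) e)
              (trans (sym (iter-+ mnext v (t ∸ v) κ)) (cong c (ℕ.m+[n∸m]≡n v≤t))))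

          too-late : ⊥
          too-late = let u , v , u<v , v<B , zu , zv , e = recurs in no-return u v u<v v<B (same-zero (c u) (c v) zu zv e)

        -- `t` is the distance to the halting configuration and `f` the depth still allowed; depth
        -- `B` is excluded by `too-late`.
        acc-above : ∀ f t κ → t + f ≡ B → (∀ u → u < t → stop (iter mnext u κ) ≡ false) → stop (iter mnext t κ) ≡ true → Acc _≺_ κ
        acc-above zero t κ e moving stops = ⊥-elim (too-late κ t moving stops (ℕ.≤-reflexive (trans (sym e) (ℕ.+-identityʳ t))))
        acc-above (suc f) t κ e moving stops = wf λ { {κ′} (st , refl) → acc-above f (suc t) κ′ (trans (sym (ℕ.+-suc t f)) e)
          (λ { zero _ → st ; (suc u) (s≤s u<t) → moving u u<t }) stops }

        halting-acc : ∀ κ → stop κ ≡ true → Acc _≺_ κ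
        halting-acc κ e = acc-above B 0 κ refl (λ _ ()) e

-- Stopping also at counter zero cuts a run into excursions; inside one of them the machine is blind
-- to the value of the counter.
zeroOr : {Q : Set} → (Q → Bool) → Q → S → Bool
zeroOr halted q 𝟎 = true
zeroOr halted q 𝟏 = halted q

zeroOr-𝟏 : ∀ {Q : Set} {halted : Q → Bool} {q} s → zeroOr halted q s ≡ false → s ≡ 𝟏
zeroOr-𝟏 𝟏 _ = refl

-- Labels: what happens to the left of a cell

module Labels {Σ A : Set} (FA : Finite A) (ν ν⁻¹ : Γ Σ → A → A)
              (ν⁻¹∘ν : ∀ (σ : Γ Σ) (s : A) → ν⁻¹ σ (ν σ s) ≡ s) (D : A → Direction) where

  -- The label of a cell maps a state entering the part of the tape between ¢ and
  -- that cell from the right to the state in which the head returns, if it does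
  -- so without reaching ¢.
  Label : Set
  Label = FA ⇒ Maybe A

  -- One move as seen from a cell: `exit` goes on to the right, `stay` is back in the cell, possibly
  -- after an excursion to its left, and `lost` is an excursion for which the label has no return.
  data Move : Set where
    exit stay : A → Move
    lost      : Move

  land : Maybe A → Move
  land (just t) = stay t
  land nothing  = lost

  move : Direction → Label → A → Move
  move ⟶ p t = exit t
  move ↓ p t = stay t
  move ← p t = land (app FA p t)

  mv : Γ Σ → Label → A → Move
  mv σ p s = move (D (ν σ s)) p (ν σ s)

  follow : Move → A → A
  follow (stay t) s = t
  follow (exit _) s = s
  follow lost     s = s

  data IsStay : Move → Set where
    stay : ∀ t → IsStay (stay t)

  isStay? : ∀ x → Dec (IsStay x)
  isStay? (exit _) = no λ ()
  isStay? (stay t) = yes (stay t)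
  isStay? lost     = no λ ()

  follow-¬stay : ∀ x s → ¬ IsStay x → follow x s ≡ s
  follow-¬stay (exit _) s _ = refl
  follow-¬stay (stay t) s ¬p = ⊥-elim (¬p (stay t))
  follow-¬stay lost     s _ = refl

  result : Move → Maybe A
  result (exit t) = just t
  result (stay _) = nothing
  result lost     = nothing

  module _ (σ : Γ Σ) (p : Label) where

    f : A → A
    f s = follow (mv σ p s) s

    Settled : A → Set
    Settled s = ¬ IsStay (mv σ p s)

    settled? : ∀ s → Dec (Settled s)
    settled? s = ¬? (isStay? (mv σ p s))

    open Absorbing FA f Settled settled? (λ s e → follow-¬stay _ s e)

    -- `f` stands still once the cell is left for good, so `size` iterations decide; a walk that
    -- still stays by then is caught in a loop and has no result.
    run : A → Maybe A
    run s = result (mv σ p (iter f (Finite.size FA) s))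

    Exits : A → A → Set
    Exits s t = ∃ λ k → mv σ p (iter f k s) ≡ exit t

    exits-out : ∀ {s t} → mv σ p s ≡ exit t → Exits s t
    exits-out e = 0 , e

    exits-stay : ∀ {s s₁ t} → mv σ p s ≡ stay s₁ → Exits s₁ t → Exits s t
    exits-stay {s} {s₁} {t} e (k , e′) = suc k ,
      trans (cong (λ x → mv σ p (iter f k x)) (cong (λ x → follow x s) e)) e′

    exit-settled : ∀ {s t} → mv σ p s ≡ exit t → Settled s
    exit-settled e st with subst IsStay e st
    ... | ()

    run-complete : ∀ {s t} → Exits s t → run s ≡ just t
    run-complete {s} {t} (k , e) = trans (cong (λ x → result (mv σ p x)) (settled-size s {k} (exit-settled e))) (cong result e)

    run-sound : ∀ {s t} → run s ≡ just t → Exits s t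
    run-sound {s} {t} e = Finite.size FA , lemma _ e
      where
      lemma : ∀ x → result x ≡ just t → x ≡ exit t
      lemma (exit _) refl = refl

    Loop : A → Set
    Loop s = IsStay (mv σ p s) × ∃ λ k → iter f (suc k) s ≡ s

    loop? : ∀ s → Dec (IsStay (mv σ p s) × ∃ λ k → k < Finite.size FA × iter f (suc k) s ≡ s)
    loop? s = isStay? _ ×-dec ℕ.anyUpTo? (λ k → Finite._≟_ FA (iter f (suc k) s) s) (Finite.size FA)

    opaque

      looping : A → Bool
      looping s = ⌊ loop? s ⌋

      looping-complete : ∀ {s} → Loop s → looping s ≡ true
      looping-complete {s} (st , l) with loop? s
      ... | yes _ = refl
      ... | no ¬l = ⊥-elim (¬l (st , loop-short FA f s l))

      looping-sound : ∀ {s} → looping s ≡ true → Loop s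
      looping-sound {s} e with loop? s
      ... | yes (st , k , _ , e′) = st , k , e′

  blank : Label
  blank = ⟪_⟫ FA λ _ → nothing

  -- Both end-markers reset the label: ¢ because an excursion that reaches it counts as failed, $
  -- because its right neighbour on the circle is cell 0.
  step : Label → Γ Σ → Label
  step p ¢ = blank
  step p $ = blank
  step p σ@(input _) = ⟪_⟫ FA (run σ p)

  -- A node fires if the walk from it returns to it without leaving the cells
  -- between ¢ and the node's own, or if it is at ¢.
  fire : Γ Σ → Label → A → Bool
  fire ¢           p s = true
  fire σ@(input _) p s = looping σ p s
  fire σ@ $        p s = looping σ p s

  app-blank : ∀ s → app FA blank s ≡ nothing
  app-blank = app-⟪⟫ FA _

  module Tape {n : ℕ} (w : Position n → Γ Σ) (w0 : w zero ≡ ¢)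
              (w¢ : ∀ (b : Position n) → w b ≡ ¢ → b ≡ zero) (w$ : ∀ (b : Position n) → w b ≡ $ → toℕ b ≡ suc n)
              (wN : ∀ (b : Position n) → toℕ b ≡ suc n → w b ≡ $) where

    ρ : A × Position n → A × Position n
    ρ (s , b) = ν (w b) s , b ⊕ μ (D (ν (w b) s))

    ρ⁻¹ : A × Position n → A × Position n
    ρ⁻¹ (s , b) = ν⁻¹ (w (b ⊕ (ℤ.- μ (D s)))) s , b ⊕ (ℤ.- μ (D s))

    ρ⁻¹∘ρ : ∀ u → ρ⁻¹ (ρ u) ≡ u
    ρ⁻¹∘ρ (s , b) rewrite ⊕-⊖ b (D (ν (w b) s)) | ν⁻¹∘ν (w b) s = refl

    z<⇒≢¢ : ∀ b → 1 ≤ toℕ b → w b ≢ ¢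
    z<⇒≢¢ b 1≤b e with w¢ b e
    z<⇒≢¢ b () e | refl

    inner : ∀ b → 1 ≤ toℕ b → toℕ b < suc n → ∃ λ x → w b ≡ input x
    inner b 1≤b b<n with w b in e
    ... | ¢ = ⊥-elim (z<⇒≢¢ b 1≤b e)
    ... | $ = ⊥-elim (ℕ.<-irrefl (w$ b e) b<n)
    ... | input x = x , refl

    Z : Set
    Z = A × Position n × Label

    -- A right move computes the new label; a left move may take any label that leads to the old
    -- one. Nothing ties the labels to the tape, since false labels have to be covered too.
    Relabel : Direction → Label → Γ Σ → Label → Γ Σ → Set
    Relabel ← p σ p′ σ′ = step p′ σ′ ≡ p
    Relabel ↓ p σ p′ σ′ = p′ ≡ p
    Relabel ⟶ p σ p′ σ′ = p′ ≡ step p σ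

    LStep : Z → Z → Set
    LStep (s , b , p) (s′ , b′ , p′) = (s′ , b′) ≡ ρ (s , b) × Relabel (D s′) p (w b) p′ (w b′)

    pos : Z → ℕ
    pos (_ , b , _) = toℕ b

    Quiet : Z → Set
    Quiet (s , b , p) = fire (w b) p s ≡ false

    quiet-positive : ∀ z → Quiet z → 1 ≤ pos z
    quiet-positive (s , b , p) e with toℕ b in eq
    ... | suc _ = s≤s z≤n
    ... | zero with Fin.toℕ-injective {j = zero} eq
    ...   | refl with subst (λ σ → fire σ p s ≡ false) w0 e
    ...     | ()

    infixr 5 _∷_
    data Walk (r : ℕ) : ℕ → Z → Z → Set where
      []  : ∀ {z} → Walk r 0 z z
      _∷_ : ∀ {k z z′ z″} → (pos z ≤ r × Quiet z) × LStep z z′ → Walk r k z′ z″ → Walk r (suc k) z z″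

    widen : ∀ {r r′ k z z′} → r ≤ r′ → Walk r k z z′ → Walk r′ k z z′
    widen r≤ [] = []
    widen r≤ (((a , q) , l) ∷ W) = ((ℕ.≤-trans a r≤ , q) , l) ∷ widen r≤ W

    _++_ : ∀ {r k l z z′ z″} → Walk r k z z′ → Walk r l z′ z″ → Walk r (k + l) z z″
    [] ++ W′ = W′
    (x ∷ W) ++ W′ = x ∷ (W ++ W′)

    -- This allows a cycle to be restarted at its rightmost node.
    highest : ∀ {r k z z′} → Walk r (suc k) z z′ → ∃ λ m → ∃₂ λ l l′ →
              Walk (pos m) l z m × Walk (pos m) (suc l′) m z′
    highest {z = z} (((a , q) , l) ∷ []) = z , 0 , 0 , [] , (((ℕ.≤-refl , q) , l) ∷ [])
    highest {z = z} (((a , q) , l) ∷ W@(_ ∷ _)) with highest W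
    ... | m , k₁ , k₂ , W₁ , W₂ with ℕ.≤-total (pos z) (pos m)
    ...   | inj₁ z≤m = m , suc k₁ , k₂ , ((z≤m , q) , l) ∷ W₁ , W₂
    ...   | inj₂ m≤z = z , 0 , k₁ + suc k₂ , [] , ((ℕ.≤-refl , q) , l) ∷ widen m≤z (W₁ ++ W₂)

    step-exits : ∀ b p {s t} → 1 ≤ toℕ b → toℕ b < suc n → Exits (w b) p s t → app FA (step p (w b)) s ≡ just t
    step-exits b p {s} 1≤b b<n e with w b | inner b 1≤b b<n
    ... | _ | x , refl = trans (app-⟪⟫ FA _ s) (run-complete (input x) p e)

    mv-left : ∀ σ p s {t} → D (ν σ s) ≡ ← → app FA p (ν σ s) ≡ just t → mv σ p s ≡ stay t
    mv-left σ p s e e′ rewrite e | e′ = refl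

    pred-toℕ : ∀ {k} → 1 ≤ k → ∃ λ c → k ≡ suc c
    pred-toℕ (s≤s {n = c} _) = c , refl

    source-positive : ∀ {r k z z′} → Walk r k z z′ → pos z < pos z′ → 1 ≤ pos z
    source-positive [] lt = ⊥-elim (ℕ.<-irrefl refl lt)
    source-positive {z = z} (((_ , q) , _) ∷ _) lt = quiet-positive z q

    -- A quiet walk that has to climb above cell b first arrives at the next
    -- cell, with the label that the step function predicts, in the state that
    -- this label predicts.
    Passage : ℕ → ℕ → A → Position n → Label → Z → Set
    Passage r k s b p z = ∃ λ t → ∃ λ b′ → ∃ λ k′ → k′ < k × Walk r k′ (t , b′ , step p (w b)) z ×
      toℕ b′ ≡ suc (toℕ b) × Exits (w b) p s t

    later : ∀ {r k k′ s s₁ b p z} → k ≤ k′ → mv (w b) p s ≡ stay s₁ → Passage r k s₁ b p z → Passage r k′ s b p z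
    later {b = b} {p} k≤k′ e (t , b′ , l , l<k , W , eb , ex) =
      t , b′ , l , ℕ.<-≤-trans l<k k≤k′ , W , eb , exits-stay (w b) p e ex

    first-passage : ∀ K {k r s b p z} → k ≤ K → Walk r k (s , b , p) z → toℕ b < pos z → Passage r k s b p z
    passage-by : ∀ K {k r s b p z} → k ≤ K → 1 ≤ toℕ b → toℕ b < pos z → pos z ≤ suc n →
      ∀ d → D (ν (w b) s) ≡ d → ∀ z′ → (proj₁ z′ , proj₁ (proj₂ z′)) ≡ (ν (w b) s , b ⊕ μ d) →
      Relabel d p (w b) (proj₂ (proj₂ z′)) (w (proj₁ (proj₂ z′))) → Walk r k z′ z → Passage r (suc k) s b p z
    -- The walk has gone left to `c` and must climb again. Its first return to `b` is what `p`
    -- predicts, as `p` is the step from the label `p′` chosen at `c`; from there the walk continues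
    -- with the old label.
    passage-left : ∀ K {k r s b c p z} → k ≤ K → 1 ≤ toℕ b → toℕ b < pos z → pos z ≤ suc n →
      D (ν (w b) s) ≡ ← → toℕ b ≡ suc (toℕ c) → ∀ p′ → step p′ (w c) ≡ p →
      Walk r k (ν (w b) s , c , p′) z → Passage r k (ν (w b) s) c p′ z → Passage r (suc k) s b p z

    first-passage K k≤K [] b<z = ⊥-elim (ℕ.<-irrefl refl b<z)
    first-passage (suc K) {suc k} {r} {s} {b} {p} {z} (s≤s k≤K) (_∷_ {z′ = z′} ((b≤r , q) , (e , rl)) W) b<z =
      passage-by K k≤K (quiet-positive (s , b , p) q) b<z (ℕ.s≤s⁻¹ (Fin.toℕ<n (proj₁ (proj₂ z))))
        (D (ν (w b) s)) refl z′ e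
        (subst (λ d → Relabel d p (w b) (proj₂ (proj₂ z′)) (w (proj₁ (proj₂ z′)))) (cong (D ∘ proj₁) e) rl) W

    passage-by K {k} {r} {s} {b} {p} {z} k≤K 1≤b b<z z≤N ⟶ d (s′ , b′ , p′) refl rl W =
      ν (w b) s , b ⊕ 1ℤ , k , ℕ.≤-refl , subst (λ p → Walk r k (ν (w b) s , b ⊕ 1ℤ , p) z) rl W ,
      toℕ-right b (s≤s (ℕ.<-≤-trans b<z z≤N)) , exits-out (w b) p (cong (λ d → move d p (ν (w b) s)) d)
    passage-by K {k} {r} {s} {b} {p} {z} k≤K 1≤b b<z z≤N ↓ d (s′ , b′ , p′) refl rl W =
      later (ℕ.n≤1+n k) (cong (λ d → move d p (ν (w b) s)) d)
        (first-passage K k≤K (subst₂ (λ b p → Walk r k (ν (w b₀) s , b , p) z) (⊕-0 b) rl W) b<z)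
      where b₀ = b
    passage-by K {k} {r} {s} {b} {p} {z} k≤K 1≤b b<z z≤N ← d (s′ , b′ , p′) refl rl W =
      passage-left K k≤K 1≤b b<z z≤N d b≡ p′ rl W
        (first-passage K k≤K W (ℕ.<-trans (ℕ.≤-reflexive (sym b≡)) b<z))
      where
      b≡ : toℕ b ≡ suc (toℕ (b ⊕ -1ℤ))
      b≡ = trans (proj₂ (pred-toℕ 1≤b)) (cong suc (sym (toℕ-left b (proj₂ (pred-toℕ 1≤b)))))

    passage-left K {k} {r} {s} {b} {c} {p} {z} k≤K 1≤b b<z z≤N d b≡ p′ rl W (t₁ , b₁ , k₁ , k₁<k , W₁ , eb₁ , ex₁) =
      later (ℕ.≤-trans (ℕ.<⇒≤ k₁<k) (ℕ.n≤1+n k)) stays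
        (first-passage K (ℕ.≤-trans (ℕ.<⇒≤ k₁<k) k≤K)
          (subst₂ (λ b p → Walk r k₁ (t₁ , b , p) z) (Fin.toℕ-injective (trans eb₁ (sym b≡))) rl W₁) b<z)
      where
      c<b : toℕ c < toℕ b
      c<b = ℕ.≤-reflexive (sym b≡)
      stays : mv (w b) p s ≡ stay t₁
      stays = mv-left (w b) p s d (subst (λ p → app FA p (ν (w b) s) ≡ just t₁) rl
        (step-exits c p′ (source-positive W (ℕ.<-trans c<b b<z)) (ℕ.<-trans c<b (ℕ.<-≤-trans b<z z≤N)) ex₁))

    Stays : Γ Σ → Label → A → A → Set
    Stays σ p s t = ∃ λ k → iter (f σ p) k s ≡ t

    stays-next : ∀ {σ p s s₁ t} → mv σ p s ≡ stay s₁ → Stays σ p s₁ t → Stays σ p s t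
    stays-next {σ} {p} {s} e (k , e′) = suc k , trans (cong (λ x → iter (f σ p) k (follow x s)) e) e′

    source-positive′ : ∀ {r k z z′} → Walk r k z z′ → 1 ≤ pos z′ → 1 ≤ pos z
    source-positive′ [] 1≤z = 1≤z
    source-positive′ {z = z} (((_ , q) , _) ∷ _) _ = quiet-positive z q

    source-bounded : ∀ {r k z z′} → Walk r k z z′ → pos z′ ≤ r → pos z ≤ r
    source-bounded [] z≤r = z≤r
    source-bounded (((z≤r , _) , _) ∷ _) _ = z≤r

    top-step : ∀ K {k s b p t pt} → k ≤ K → Walk (toℕ b) (suc k) (s , b , p) (t , b , pt) →
               ∃ λ s₁ → mv (w b) p s ≡ stay s₁ × Stays (w b) p s₁ t
    top-walk : ∀ K {k s b p t pt} → k ≤ K → Walk (toℕ b) k (s , b , p) (t , b , pt) → Stays (w b) p s t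
    top-by : ∀ K {k s b p t pt} → k ≤ K → 1 ≤ toℕ b → ∀ d → D (ν (w b) s) ≡ d → ∀ z′ →
      (proj₁ z′ , proj₁ (proj₂ z′)) ≡ (ν (w b) s , b ⊕ μ d) →
      Relabel d p (w b) (proj₂ (proj₂ z′)) (w (proj₁ (proj₂ z′))) → Walk (toℕ b) k z′ (t , b , pt) →
      ∃ λ s₁ → mv (w b) p s ≡ stay s₁ × Stays (w b) p s₁ t

    top-walk K k≤K [] = 0 , refl
    top-walk (suc K) (s≤s k≤K) W@(_ ∷ _) with top-step K k≤K W
    ... | s₁ , e , st = stays-next e st

    top-step K {s = s} {b} {p} k≤K (_∷_ {z′ = z′} ((_ , q) , (e , rl)) W) =
      top-by K k≤K (quiet-positive (s , b , p) q) (D (ν (w b) s)) refl z′ e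
        (subst (λ d → Relabel d p (w b) (proj₂ (proj₂ z′)) (w (proj₁ (proj₂ z′)))) (cong (D ∘ proj₁) e) rl) W

    -- A move to the right exceeds the bound `b`, or wraps from the last cell to cell 0, where every
    -- node fires.
    top-by K {s = s} {b} {p} k≤K 1≤b ⟶ d (s′ , b′ , p′) refl rl W with suc (toℕ b) ℕ.<? 2 + n
    ... | yes lt = ⊥-elim (ℕ.<-irrefl refl (ℕ.<-≤-trans (ℕ.≤-reflexive (sym (toℕ-right b lt))) (source-bounded W ℕ.≤-refl)))
    ... | no ¬lt with subst (1 ≤_) (toℕ-wrap b (ℕ.≤-antisym (ℕ.s≤s⁻¹ (Fin.toℕ<n b)) (ℕ.s≤s⁻¹ (ℕ.≮⇒≥ ¬lt)))) (source-positive′ W 1≤b)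
    ...   | ()
    top-by K {k} {s} {b} {p} {t} {pt} k≤K 1≤b ↓ d (s′ , b′ , p′) refl rl W =
      ν (w b) s , cong (λ d → move d p (ν (w b) s)) d ,
      top-walk K k≤K (subst₂ (λ b′ p → Walk (toℕ b) k (ν (w b) s , b′ , p) (t , b , pt)) (⊕-0 b) rl W)
    top-by K {k} {s} {b} {p} {t} {pt} k≤K 1≤b ← d (s′ , b′ , p′) refl rl W
      with first-passage K k≤K W (ℕ.≤-reflexive (sym b≡))
      where
      b≡ : toℕ b ≡ suc (toℕ (b ⊕ -1ℤ))
      b≡ = trans (proj₂ (pred-toℕ 1≤b)) (cong suc (sym (toℕ-left b (proj₂ (pred-toℕ 1≤b)))))
    ... | t₁ , b₁ , k₁ , k₁<k , W₁ , eb₁ , ex₁ =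
      t₁ , mv-left (w b) p s d (subst (λ p → app FA p (ν (w b) s) ≡ just t₁) rl
        (step-exits (b ⊕ -1ℤ) p′ (source-positive′ W 1≤b) c<n+1 ex₁)) ,
      top-walk K (ℕ.≤-trans (ℕ.<⇒≤ k₁<k) k≤K)
        (subst₂ (λ b′ p → Walk (toℕ b) k₁ (t₁ , b′ , p) (t , b , pt)) (Fin.toℕ-injective (trans eb₁ (sym b≡))) rl W₁)
      where
      b≡ : toℕ b ≡ suc (toℕ (b ⊕ -1ℤ))
      b≡ = trans (proj₂ (pred-toℕ 1≤b)) (cong suc (sym (toℕ-left b (proj₂ (pred-toℕ 1≤b)))))
      c<n+1 : toℕ (b ⊕ -1ℤ) < suc n
      c<n+1 = ℕ.<-≤-trans (ℕ.≤-reflexive (sym b≡)) (ℕ.s≤s⁻¹ (Fin.toℕ<n b))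

    fire-looping : ∀ {b p s} → 1 ≤ toℕ b → fire (w b) p s ≡ looping (w b) p s
    fire-looping {b} 1≤b with w b in e
    ... | ¢ = ⊥-elim (z<⇒≢¢ b 1≤b e)
    ... | $ = refl
    ... | input _ = refl

    -- The rightmost node of the cycle would fire, whatever the labels are.
    no-quiet-cycle : ∀ {r k z} → ¬ Walk r (suc k) z z
    no-quiet-cycle W with highest W
    ... | (s , b , p) , l , l′ , W₁ , W₂ = quiet (W₂ ++ W₁)
      where
      quiet : ∀ {k} → ¬ Walk (toℕ b) (suc k) (s , b , p) (s , b , p)
      quiet W@(((_ , q) , _) ∷ _) with top-step _ ℕ.≤-refl W
      ... | s₁ , e , (j , e′) with trans (sym (looping-complete (w b) p {s} (subst IsStay (sym e) (stay s₁) ,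
              j , trans (cong (λ x → iter (f (w b) p) j (follow x s)) e) e′)))
              (trans (sym (fire-looping {b} {p} {s} (quiet-positive (s , b , p) q))) q)
      ...   | ()

    sweep : Label × Position n → Label × Position n
    sweep (p , c) = step p (w c) , c ⊕ 1ℤ

    swept : ℕ → Label × Position n
    swept k = iter sweep k (blank , zero)

    lab : Position n → Label
    lab b = proj₁ (swept (toℕ b))

    toℕ-swept : ∀ k → k < 2 + n → toℕ (proj₂ (swept k)) ≡ k
    toℕ-swept zero    _  = refl
    toℕ-swept (suc k) lt = trans (cong (toℕ ∘ proj₂) (iter-suc sweep k (blank , zero)))
      (trans (toℕ-right (proj₂ (swept k)) (subst (λ k → suc k < 2 + n) (sym ih) lt)) (cong suc ih))
      where ih = toℕ-swept k (ℕ.<-trans (ℕ.n<1+n k) lt)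

    lab-suc : ∀ {b b′} → toℕ b′ ≡ suc (toℕ b) → lab b′ ≡ step (lab b) (w b)
    lab-suc {b} {b′} e = trans (cong (proj₁ ∘ swept) e) (trans (cong proj₁ (iter-suc sweep (toℕ b) (blank , zero)))
      (cong (λ c → step (lab b) (w c)) (Fin.toℕ-injective (toℕ-swept (toℕ b) (Fin.toℕ<n b)))))

    step-last : ∀ b p → toℕ b ≡ suc n → step p (w b) ≡ blank
    step-last b p e rewrite wN b e = refl

    -- At the last cell the sweep wraps around, and the reset by `$` agrees with the blank label of
    -- cell 0.
    lab-right : ∀ b → lab (b ⊕ 1ℤ) ≡ step (lab b) (w b)
    lab-right b with suc (toℕ b) ℕ.<? 2 + n
    ... | yes lt = lab-suc (toℕ-right b lt)
    ... | no ¬lt = trans (cong (proj₁ ∘ swept) (toℕ-wrap b e)) (sym (step-last b (lab b) e))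
      where e = ℕ.≤-antisym (ℕ.s≤s⁻¹ (Fin.toℕ<n b)) (ℕ.s≤s⁻¹ (ℕ.≮⇒≥ ¬lt))

    data Confined (r : ℕ) : ℕ → A × Position n → A × Position n → Set where
      []  : ∀ {u} → Confined r 0 u u
      _∷_ : ∀ {k u v} → 1 ≤ toℕ (proj₂ u) × toℕ (proj₂ u) ≤ r → Confined r k (ρ u) v → Confined r (suc k) u v

    _+++_ : ∀ {r k l u v x} → Confined r k u v → Confined r l v x → Confined r (k + l) u x
    [] +++ c = c
    (a ∷ c) +++ c′ = a ∷ (c +++ c′)

    confined-widen : ∀ {r r′ k u v} → r ≤ r′ → Confined r k u v → Confined r′ k u v
    confined-widen _ [] = []
    confined-widen r≤ ((a , b) ∷ c) = (a , ℕ.≤-trans b r≤) ∷ confined-widen r≤ c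

    Excursion : ℕ → A × Position n → A × Position n → Set
    Excursion r u v = ∃ λ k → Confined r (suc k) u v

    _then_ : ∀ {r u v x} → Excursion r u v → Excursion r v x → Excursion r u x
    (k , c) then (l , c′) = k + suc l , c +++ c′

    one-step : ∀ b s {d} → 1 ≤ toℕ b → D (ν (w b) s) ≡ d → Excursion (toℕ b) (s , b) (ν (w b) s , b ⊕ μ d)
    one-step b s 1≤b refl = 0 , ((1≤b , ℕ.≤-refl) ∷ [])

    -- True labels, unlike guessed ones, promise only excursions that take place. The induction is
    -- on the cell, since the label of a cell is built from that of its left neighbour.
    label-sound : ∀ K b b′ {s t} → toℕ b ≤ K → toℕ b′ ≡ suc (toℕ b) → app FA (lab b′) s ≡ just t →
                  Excursion (toℕ b) (s , b) (t , b′)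

    stay-sound : ∀ K b {s t} → toℕ b ≤ suc K → 1 ≤ toℕ b → mv (w b) (lab b) s ≡ stay t → Excursion (toℕ b) (s , b) (t , b)
    stay-sound K b {s} {t} b≤K 1≤b e = go (D (ν (w b) s)) refl e
      where
      landed : ∀ x {t} → land x ≡ stay t → x ≡ just t
      landed (just _) refl = refl
      go : ∀ d → D (ν (w b) s) ≡ d → move d (lab b) (ν (w b) s) ≡ stay t → Excursion (toℕ b) (s , b) (t , b)
      go ↓ d refl = subst (λ b′ → Excursion (toℕ b) (s , b) (ν (w b) s , b′)) (⊕-0 b) (one-step b s 1≤b d)
      go ← d e = one-step b s 1≤b d then (proj₁ sub , confined-widen (ℕ.<⇒≤ (ℕ.≤-reflexive (sym b≡))) (proj₂ sub))
        where
        b≡ : toℕ b ≡ suc (toℕ (b ⊕ -1ℤ))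
        b≡ = trans (proj₂ (pred-toℕ 1≤b)) (cong suc (sym (toℕ-left b (proj₂ (pred-toℕ 1≤b)))))
        sub = label-sound K (b ⊕ -1ℤ) b (ℕ.s≤s⁻¹ (ℕ.≤-trans (ℕ.≤-reflexive (sym b≡)) b≤K)) b≡ (landed (app FA (lab b) (ν (w b) s)) e)

    stays-sound : ∀ K b k {s t} → toℕ b ≤ suc K → 1 ≤ toℕ b → iter (f (w b) (lab b)) k s ≡ t →
                  s ≡ t ⊎ Excursion (toℕ b) (s , b) (t , b)
    stays-sound K b zero    b≤K 1≤b e = inj₁ e
    stays-sound K b (suc k) {s} b≤K 1≤b e with mv (w b) (lab b) s in eq
    ... | exit _ = stays-sound K b k b≤K 1≤b e
    ... | lost   = stays-sound K b k b≤K 1≤b e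
    ... | stay s₁ with stays-sound K b k b≤K 1≤b e
    ...   | inj₁ refl = inj₂ (stay-sound K b b≤K 1≤b eq)
    ...   | inj₂ c = inj₂ (stay-sound K b b≤K 1≤b eq then c)

    exit-sound : ∀ b b′ {s t} → 1 ≤ toℕ b → toℕ b′ ≡ suc (toℕ b) → mv (w b) (lab b) s ≡ exit t →
                 Excursion (toℕ b) (s , b) (t , b′)
    exit-sound b b′ {s} {t} 1≤b b′≡ e = go (D (ν (w b) s)) refl e
      where
      not-land : ∀ x → land x ≢ exit t
      not-land (just _) ()
      not-land nothing ()
      go : ∀ d → D (ν (w b) s) ≡ d → move d (lab b) (ν (w b) s) ≡ exit t → Excursion (toℕ b) (s , b) (t , b′)
      go ⟶ d refl = subst (λ c → Excursion (toℕ b) (s , b) (ν (w b) s , c))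
        (Fin.toℕ-injective (trans (toℕ-right b (subst (_< 2 + n) b′≡ (Fin.toℕ<n b′))) (sym b′≡))) (one-step b s 1≤b d)
      go ← d e = ⊥-elim (not-land (app FA (lab b) (ν (w b) s)) e)

    exits-sound : ∀ K b b′ {s t} → toℕ b ≤ suc K → 1 ≤ toℕ b → toℕ b′ ≡ suc (toℕ b) → Exits (w b) (lab b) s t →
                  Excursion (toℕ b) (s , b) (t , b′)
    exits-sound K b b′ {s} {t} b≤K 1≤b b′≡ (k , e) with stays-sound K b k {s} b≤K 1≤b refl
    ... | inj₁ s≡ = exit-sound b b′ 1≤b b′≡ (subst (λ s → mv (w b) (lab b) s ≡ exit t) (sym s≡) e)
    ... | inj₂ c = c then exit-sound b b′ 1≤b b′≡ e

    label-sound K b b′ {s} {t} b≤K b′≡ e = go K b≤K (toℕ b) refl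
      where
      e′ : app FA (step (lab b) (w b)) s ≡ just t
      e′ = trans (cong (λ p → app FA p s) (sym (lab-suc {b} {b′} b′≡))) e
      unblank : ∀ {A : Set} p → p ≡ blank → app FA p s ≡ just t → A
      unblank p refl e with trans (sym (app-blank s)) e
      ... | ()
      exits : ∀ σ → app FA (step (lab b) σ) s ≡ just t → Exits σ (lab b) s t
      exits ¢ e = unblank _ refl e
      exits $ e = unblank _ refl e
      exits (input x) e = run-sound (input x) (lab b) (trans (sym (app-⟪⟫ FA (run (input x) (lab b)) s)) e)
      go : ∀ K → toℕ b ≤ K → ∀ k → toℕ b ≡ k → Excursion (toℕ b) (s , b) (t , b′)
      go K b≤K zero eb = unblank (step (lab b) (w b)) (cong (step (lab b)) (trans (cong w (Fin.toℕ-injective {j = zero} eb)) w0)) e′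
      go zero b≤K (suc k) eb with subst (_≤ 0) eb b≤K
      ... | ()
      go (suc K) b≤K (suc k) eb = exits-sound K b b′ b≤K (ℕ.≤-trans (s≤s z≤n) (ℕ.≤-reflexive (sym eb))) b′≡ (exits (w b) e′)

    looping-confined : ∀ b s → 1 ≤ toℕ b → looping (w b) (lab b) s ≡ true → Excursion (toℕ b) (s , b) (s , b)
    looping-confined b s 1≤b e with looping-sound (w b) (lab b) e
    ... | st , k , e′ with mv (w b) (lab b) s in eq
    looping-confined b s 1≤b e | stay .s₁ , k , e′ | stay s₁ with stays-sound (toℕ b) b k (ℕ.n≤1+n _) 1≤b e′
    ...   | inj₁ refl = stay-sound (toℕ b) b (ℕ.n≤1+n _) 1≤b eq
    ...   | inj₂ c = stay-sound (toℕ b) b (ℕ.n≤1+n _) 1≤b eq then c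

    confined-iter : ∀ {r k u v} → Confined r k u v → iter ρ k u ≡ v
    confined-iter [] = refl
    confined-iter (_ ∷ c) = confined-iter c

    confined-forever : ∀ {r u} → Excursion r u u → ∀ k {v} → Excursion r v u →
                       1 ≤ toℕ (proj₂ (iter ρ k v)) × toℕ (proj₂ (iter ρ k v)) ≤ r
    confined-forever cyc zero (_ , a ∷ _) = a
    confined-forever cyc (suc k) (zero , _ ∷ []) = confined-forever cyc k cyc
    confined-forever cyc (suc k) (suc l , _ ∷ c) = confined-forever cyc k (l , c)

    Firing : A × Position n → Set
    Firing (s , b) = fire (w b) (lab b) s ≡ true

    firing-case : ∀ s b → Firing (s , b) → toℕ b ≡ 0 ⊎ 1 ≤ toℕ b × Excursion (toℕ b) (s , b) (s , b)
    firing-case s b e = go (toℕ b) refl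
      where
      go : ∀ k → toℕ b ≡ k → toℕ b ≡ 0 ⊎ 1 ≤ toℕ b × Excursion (toℕ b) (s , b) (s , b)
      go zero eb = inj₁ eb
      go (suc k) eb = inj₂ (1≤b , looping-confined b s 1≤b (trans (sym (fire-looping {b} {lab b} {s} 1≤b)) e))
        where
        1≤b : 1 ≤ toℕ b
        1≤b = ℕ.≤-trans (s≤s z≤n) (ℕ.≤-reflexive (sym eb))

    -- The common cell is the rightmost cell of the orbit, or cell 0.
    firing-same-cell : ∀ u k → Firing u → Firing (iter ρ k u) → proj₂ u ≡ proj₂ (iter ρ k u)
    firing-same-cell u k e e′ = Fin.toℕ-injective (compare (firing-case _ _ e) (firing-case _ _ e′))
      where
      v = iter ρ k u
      back : ∀ {r} → Excursion r v v → ∃ λ l → iter ρ l v ≡ u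
      -- The period of `v` is `suc l`. After `k` laps the last `k` steps are undone by the inverse,
      -- and the same `k` inverse steps lead from `v` to `u`; so `k * l` forward steps from `v`
      -- reach `u`, which therefore lies on the cycle of `v`.
      back (l , c) = k * l , trans (sym (iter-cancel ρ⁻¹∘ρ k _))
        (trans (cong (iter ρ⁻¹ k) (trans (sym (iter-+ ρ (k * l) k v))
          (trans (cong (λ x → iter ρ x v) (trans (ℕ.+-comm (k * l) k) (sym (ℕ.*-suc k l)))) (iter-* ρ k (suc l) v (confined-iter c)))))
        (iter-cancel ρ⁻¹∘ρ k u))
      within : ∀ {r} → Excursion r v v → 1 ≤ toℕ (proj₂ u) × toℕ (proj₂ u) ≤ r
      within c with back c
      ... | l , refl′ = subst (λ u → 1 ≤ toℕ (proj₂ u) × toℕ (proj₂ u) ≤ _) refl′ (confined-forever c l c)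
      compare : toℕ (proj₂ u) ≡ 0 ⊎ 1 ≤ toℕ (proj₂ u) × Excursion (toℕ (proj₂ u)) u u →
                toℕ (proj₂ v) ≡ 0 ⊎ 1 ≤ toℕ (proj₂ v) × Excursion (toℕ (proj₂ v)) v v →
                toℕ (proj₂ u) ≡ toℕ (proj₂ v)
      compare (inj₁ a) (inj₁ b) = trans a (sym b)
      compare (inj₁ a) (inj₂ (_ , c)) with subst (1 ≤_) a (proj₁ (within c))
      ... | ()
      compare (inj₂ (_ , c)) (inj₁ b) with subst (1 ≤_) b (proj₁ (confined-forever c k c))
      ... | ()
      compare (inj₂ (_ , c)) (inj₂ (_ , c′)) = ℕ.≤-antisym (proj₂ (within c′)) (proj₂ (confined-forever c k c))

count : ∀ {n} → Vec.Vec Bool n → ℕ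
count Vec.[] = 0
count (true  Vec.∷ v) = suc (count v)
count (false Vec.∷ v) = count v

count≤n : ∀ {n} (v : Vec.Vec Bool n) → count v ≤ n
count≤n Vec.[] = z≤n
count≤n (true  Vec.∷ v) = s≤s (count≤n v)
count≤n (false Vec.∷ v) = ℕ.m≤n⇒m≤1+n (count≤n v)

count-insert : ∀ {n} (v : Vec.Vec Bool n) k → Vec.lookup v k ≡ false → count (v Vec.[ k ]≔ true) ≡ suc (count v)
count-insert (true  Vec.∷ v) (suc k) e = cong suc (count-insert v k e)
count-insert (false Vec.∷ v) zero    e = refl
count-insert (false Vec.∷ v) (suc k) e = count-insert v k e

-- Simple automata from permutations of the states

+ᶜ-identityˡ : ∀ z → 0ᶜ +ᶜ z ≡ z
+ᶜ-identityˡ z = cong₂ Defs._+_i (ℚ.+-identityˡ (re z)) (ℚ.+-identityˡ (im z))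

+ᶜ-identityʳ : ∀ z → z +ᶜ 0ᶜ ≡ z
+ᶜ-identityʳ z = cong₂ Defs._+_i (ℚ.+-identityʳ (re z)) (ℚ.+-identityʳ (im z))

*ᶜ-zeroˡ : ∀ z → 0ᶜ *ᶜ z ≡ 0ᶜ
*ᶜ-zeroˡ z rewrite ℚ.*-zeroˡ (re z) | ℚ.*-zeroˡ (im z) = refl

1ᶜ≢0ᶜ : 1ᶜ ≢ 0ᶜ
1ᶜ≢0ᶜ ()

module Single {X : Set} (_⊹_ : X → X → X) (o : X) (idˡ : ∀ (x : X) → o ⊹ x ≡ x) (idʳ : ∀ (x : X) → x ⊹ o ≡ x) where

  module _ {A : Set} where

    sum : List A → (A → X) → X
    sum xs f = foldr (λ x s → f x ⊹ s) o xs

    sum-cong : ∀ xs {f g : A → X} → (∀ x → f x ≡ g x) → sum xs f ≡ sum xs g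
    sum-cong [] e = refl
    sum-cong (x ∷ xs) e = cong₂ _⊹_ (e x) (sum-cong xs e)

    sum-o : ∀ xs {f : A → X} → (∀ x → f x ≡ o) → sum xs f ≡ o
    sum-o [] e = refl
    sum-o (x ∷ xs) e = trans (cong₂ _⊹_ (e x) (sum-o xs e)) (idˡ o)

    sum-tabulate-o : ∀ {n} (h : Fin n → A) (f : A → X) → (∀ l → f (h l) ≡ o) → sum (tabulate h) f ≡ o
    sum-tabulate-o {zero}  h f e = refl
    sum-tabulate-o {suc n} h f e = trans (cong₂ _⊹_ (e zero) (sum-tabulate-o (h ∘ suc) f (e ∘ suc))) (idˡ o)

    sum-tabulate : ∀ {n} (h : Fin n → A) (f : A → X) k → (∀ l → l ≢ k → f (h l) ≡ o) → sum (tabulate h) f ≡ f (h k)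
    sum-tabulate h f zero e = trans (cong (λ z → f (h zero) ⊹ z) (sum-tabulate-o (h ∘ suc) f (λ l → e (suc l) λ ()))) (idʳ _)
    sum-tabulate h f (suc k) e = trans (cong₂ _⊹_ (e zero λ ()) (sum-tabulate (h ∘ suc) f k λ l l≢k → e (suc l) (l≢k ∘ Fin.suc-injective))) (idˡ _)

    sum-applyUpTo-o : ∀ n (h : ℕ → A) (f : A → X) → (∀ l → l < n → f (h l) ≡ o) → sum (applyUpTo h n) f ≡ o
    sum-applyUpTo-o zero    h f e = refl
    sum-applyUpTo-o (suc n) h f e = trans (cong₂ _⊹_ (e 0 (s≤s z≤n)) (sum-applyUpTo-o n (h ∘ suc) f λ l l<n → e (suc l) (s≤s l<n))) (idˡ o)

    sum-applyUpTo : ∀ n (h : ℕ → A) (f : A → X) k → k < n → (∀ l → l ≢ k → f (h l) ≡ o) → sum (applyUpTo h n) f ≡ f (h k)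
    sum-applyUpTo (suc n) h f zero _ e = trans (cong (λ z → f (h 0) ⊹ z) (sum-applyUpTo-o n (h ∘ suc) f (λ l _ → e (suc l) λ ()))) (idʳ _)
    sum-applyUpTo (suc n) h f (suc k) (s≤s k<n) e =
      trans (cong₂ _⊹_ (e 0 λ ()) (sum-applyUpTo n (h ∘ suc) f k k<n λ l l≢k → e (suc l) (l≢k ∘ ℕ.suc-injective))) (idˡ _)

    sum-elements : (F : Finite A) (f : A → X) → ∀ a → (∀ b → b ≢ a → f b ≡ o) → sum (Finite.elements F) f ≡ f a
    sum-elements F f a e = trans (cong (λ xs → sum xs f) (List.map-tabulate (λ k → k) (Finite.element F)))
      (trans (sum-tabulate (Finite.element F) f (index F a) λ l l≢ → e _ λ eq → l≢ (trans (sym (index∘element F l)) (cong (index F) eq)))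
        (cong f (element∘index F a)))

eqC : Change → Change → Bool
eqC dec  dec  = true
eqC keep keep = true
eqC inc  inc  = true
eqC _    _    = false

eqD : Direction → Direction → Bool
eqD ← ← = true
eqD ↓ ↓ = true
eqD ⟶ ⟶ = true
eqD _ _ = false

eqC-sound : ∀ c c′ → eqC c c′ ≡ true → c ≡ c′
eqC-sound dec  dec  _ = refl
eqC-sound keep keep _ = refl
eqC-sound inc  inc  _ = refl

eqD-sound : ∀ d d′ → eqD d d′ ≡ true → d ≡ d′
eqD-sound ← ← _ = refl
eqD-sound ↓ ↓ _ = refl
eqD-sound ⟶ ⟶ _ = refl

eqC-refl : ∀ c → eqC c c ≡ true
eqC-refl dec  = refl
eqC-refl keep = refl
eqC-refl inc  = refl

eqD-refl : ∀ d → eqD d d ≡ true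
eqD-refl ← = refl
eqD-refl ↓ = refl
eqD-refl ⟶ = refl

bit : Bool → ℚ[i]
bit b = if b then 1ᶜ else 0ᶜ

move-bit : Bool → Change → Direction → Change → Direction → ℚ[i]
move-bit h c* d* c d = bit (h ∧ (eqC c* c ∧ eqD d* d))

∑ᶜ-changes : (f : Change → ℚ[i]) → ∀ c* → (∀ c → eqC c* c ≡ false → f c ≡ 0ᶜ) → ∑ᶜ changes f ≡ f c*
∑ᶜ-changes f dec e rewrite e keep refl | e inc refl = +ᶜ-identityʳ _
∑ᶜ-changes f keep e rewrite e dec refl | e inc refl = trans (+ᶜ-identityˡ _) (+ᶜ-identityʳ _)
∑ᶜ-changes f inc e rewrite e dec refl | e keep refl = trans (+ᶜ-identityˡ _) (trans (+ᶜ-identityˡ _) (+ᶜ-identityʳ _))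

∑ᶜ-directions : (f : Direction → ℚ[i]) → ∀ d* → (∀ d → eqD d* d ≡ false → f d ≡ 0ᶜ) → ∑ᶜ directions f ≡ f d*
∑ᶜ-directions f ← e rewrite e ↓ refl | (e ⟶ refl) = +ᶜ-identityʳ _
∑ᶜ-directions f ↓ e rewrite (e ← refl) | (e ⟶ refl) = trans (+ᶜ-identityˡ _) (+ᶜ-identityʳ _)
∑ᶜ-directions f ⟶ e rewrite (e ← refl) | e ↓ refl = trans (+ᶜ-identityˡ _) (trans (+ᶜ-identityˡ _) (+ᶜ-identityʳ _))

paired : ℤ → ℤ → (x y : Bool) → Change → Direction → Change → Direction → ℚ[i]
paired α β x y c₁ d₁ c₂ d₂ =
  if ⌊ ⟦ c₂ ⟧ ℤ.- ⟦ c₁ ⟧ ℤ.≟ α ⌋ then (if ⌊ μ d₂ ℤ.- μ d₁ ℤ.≟ β ⌋ then conj (bit x) *ᶜ bit y else 0ᶜ) else 0ᶜ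

if-0 : ∀ b {z} → z ≡ 0ᶜ → (if b then z else 0ᶜ) ≡ 0ᶜ
if-0 true  e = e
if-0 false e = refl

paired-0 : ∀ α β x y c₁ d₁ c₂ d₂ → x ∧ y ≡ false → paired α β x y c₁ d₁ c₂ d₂ ≡ 0ᶜ
paired-0 α β x y c₁ d₁ c₂ d₂ e = if-0 ⌊ ⟦ c₂ ⟧ ℤ.- ⟦ c₁ ⟧ ℤ.≟ α ⌋ (if-0 ⌊ μ d₂ ℤ.- μ d₁ ℤ.≟ β ⌋ (product x y e))
  where
  product : ∀ x y → x ∧ y ≡ false → conj (bit x) *ᶜ bit y ≡ 0ᶜ
  product false false _ = refl
  product false true  _ = refl
  product true  false _ = refl

paired-diagonal : ∀ α β x y c d → α ≢ 0ℤ ⊎ β ≢ 0ℤ → paired α β x y c d c d ≡ 0ᶜ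
paired-diagonal α β x y c d ne rewrite ℤ.+-inverseʳ ⟦ c ⟧ | ℤ.+-inverseʳ (μ d) with 0ℤ ℤ.≟ α | 0ℤ ℤ.≟ β
... | no _ | _ = refl
... | yes _ | no _ = refl
... | yes refl | yes refl with ne
...   | inj₁ n = ⊥-elim (n refl)
...   | inj₂ n = ⊥-elim (n refl)

∧-true : ∀ {x y} → x ∧ y ≡ true → x ≡ true × y ≡ true
∧-true {true} {true} _ = refl , refl

-- Both amplitudes lead to the same state, which dictates change and direction; where both are
-- nonzero the differences vanish.
off-diagonal : ∀ α β h₁ h₂ c* d* c₁ d₁ c₂ d₂ → α ≢ 0ℤ ⊎ β ≢ 0ℤ →
  paired α β (h₁ ∧ (eqC c* c₁ ∧ eqD d* d₁)) (h₂ ∧ (eqC c* c₂ ∧ eqD d* d₂)) c₁ d₁ c₂ d₂ ≡ 0ᶜ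
off-diagonal α β h₁ h₂ c* d* c₁ d₁ c₂ d₂ ne = go _ _ refl refl
  where
  x₁ x₂ : Bool
  x₁ = h₁ ∧ (eqC c* c₁ ∧ eqD d* d₁)
  x₂ = h₂ ∧ (eqC c* c₂ ∧ eqD d* d₂)
  go : ∀ y₁ y₂ → x₁ ≡ y₁ → x₂ ≡ y₂ → paired α β x₁ x₂ c₁ d₁ c₂ d₂ ≡ 0ᶜ
  go false y₂ e₁ e₂ = paired-0 α β x₁ x₂ c₁ d₁ c₂ d₂ (cong (_∧ x₂) e₁)
  go true false e₁ e₂ = paired-0 α β x₁ x₂ c₁ d₁ c₂ d₂ (trans (cong (x₁ ∧_) e₂) (Bool.∧-zeroʳ x₁))
  go true true e₁ e₂ with ∧-true {h₁} e₁ | ∧-true {h₂} e₂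
  ... | _ , f₁ | _ , f₂ with ∧-true {eqC c* c₁} f₁ | ∧-true {eqC c* c₂} f₂
  ...   | cc₁ , dd₁ | cc₂ , dd₂ with eqC-sound c* c₁ cc₁ | eqC-sound c* c₂ cc₂ | eqD-sound d* d₁ dd₁ | eqD-sound d* d₂ dd₂
  ...     | refl | refl | refl | refl = paired-diagonal α β x₁ x₂ c* d* ne

diagonal : ∀ h₁ h₂ c* d* →
  (∑ᶜ[ c₁ ← changes ] ∑ᶜ[ d₁ ← directions ] ∑ᶜ[ c₂ ← changes ] ∑ᶜ[ d₂ ← directions ]
    paired 0ℤ 0ℤ (h₁ ∧ (eqC c* c₁ ∧ eqD d* d₁)) (h₂ ∧ (eqC c* c₂ ∧ eqD d* d₂)) c₁ d₁ c₂ d₂) ≡ bit (h₁ ∧ h₂)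
diagonal h₁ h₂ c* d* =
  trans (∑ᶜ-changes f₁ c* λ c₁ e₁ → ∑ᶜ-zero directions λ d₁ → ∑ᶜ-zero changes λ c₂ → ∑ᶜ-zero directions λ d₂ →
      left-0 c₁ d₁ c₂ d₂ (cong (λ z → h₁ ∧ (z ∧ eqD d* d₁)) e₁))
  (trans (∑ᶜ-directions f₂ d* λ d₁ e₁ → ∑ᶜ-zero changes λ c₂ → ∑ᶜ-zero directions λ d₂ →
      left-0 c* d₁ c₂ d₂ (trans (cong (λ z → h₁ ∧ (eqC c* c* ∧ z)) e₁) (cong (h₁ ∧_) (Bool.∧-zeroʳ (eqC c* c*)))))
  (trans (∑ᶜ-changes f₃ c* λ c₂ e₂ → ∑ᶜ-zero directions λ d₂ →
      right-0 c₂ d₂ (cong (λ z → h₂ ∧ (z ∧ eqD d* d₂)) e₂))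
  (trans (∑ᶜ-directions (term c* d* c*) d* λ d₂ e₂ →
      right-0 c* d₂ (trans (cong (λ z → h₂ ∧ (eqC c* c* ∧ z)) e₂) (cong (h₂ ∧_) (Bool.∧-zeroʳ (eqC c* c*)))))
  (centre h₁ h₂ c* d*))))
  where
  x y : Change → Direction → Bool
  x c d = h₁ ∧ (eqC c* c ∧ eqD d* d)
  y c d = h₂ ∧ (eqC c* c ∧ eqD d* d)
  term : Change → Direction → Change → Direction → ℚ[i]
  term c₁ d₁ c₂ d₂ = paired 0ℤ 0ℤ (x c₁ d₁) (y c₂ d₂) c₁ d₁ c₂ d₂
  f₁ f₃ : Change → ℚ[i]
  f₂ : Direction → ℚ[i]
  f₁ c₁ = ∑ᶜ[ d₁ ← directions ] ∑ᶜ[ c₂ ← changes ] ∑ᶜ[ d₂ ← directions ] term c₁ d₁ c₂ d₂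
  f₂ d₁ = ∑ᶜ[ c₂ ← changes ] ∑ᶜ[ d₂ ← directions ] term c* d₁ c₂ d₂
  f₃ c₂ = ∑ᶜ[ d₂ ← directions ] term c* d* c₂ d₂
  left-0 : ∀ c₁ d₁ c₂ d₂ → x c₁ d₁ ≡ h₁ ∧ false → term c₁ d₁ c₂ d₂ ≡ 0ᶜ
  left-0 c₁ d₁ c₂ d₂ e = paired-0 0ℤ 0ℤ (x c₁ d₁) (y c₂ d₂) c₁ d₁ c₂ d₂ (cong (_∧ y c₂ d₂) (trans e (Bool.∧-zeroʳ h₁)))
  right-0 : ∀ c₂ d₂ → y c₂ d₂ ≡ h₂ ∧ false → term c* d* c₂ d₂ ≡ 0ᶜ
  right-0 c₂ d₂ e = paired-0 0ℤ 0ℤ (x c* d*) (y c₂ d₂) c* d* c₂ d₂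
    (trans (cong (x c* d* ∧_) (trans e (Bool.∧-zeroʳ h₂))) (Bool.∧-zeroʳ (x c* d*)))
  values : ∀ h₁ h₂ → conj (bit (h₁ ∧ true)) *ᶜ bit (h₂ ∧ true) ≡ bit (h₁ ∧ h₂)
  values false false = refl
  values false true  = refl
  values true  false = refl
  values true  true  = refl
  centre : ∀ h₁ h₂ c d → paired 0ℤ 0ℤ (h₁ ∧ (eqC c c ∧ eqD d d)) (h₂ ∧ (eqC c c ∧ eqD d d)) c d c d ≡ bit (h₁ ∧ h₂)
  centre h₁ h₂ c d rewrite ℤ.+-inverseʳ ⟦ c ⟧ | ℤ.+-inverseʳ (μ d) | eqC-refl c | eqD-refl d = values h₁ h₂

module Permutation {Σ A : Set} (F : Finite A) (V V⁻¹ : Γ Σ → S → A → A)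
  (V⁻¹∘V : ∀ (σ : Γ Σ) (s : S) (t : A) → V⁻¹ σ s (V σ s t) ≡ t) (C : A → Change) (D : A → Direction)
  (t₀ : A) (acc rej : A → Bool) (disjoint : ∀ (t : A) → ¬ (T (acc t) × T (rej t))) where

  open Finite F

  hit : A → Γ Σ → S → A → Bool
  hit t σ s t′ = ⌊ V σ s t ≟ t′ ⌋

  amplitude : Amplitudes A Σ
  amplitude t σ s t′ c d = move-bit (hit t σ s t′) (C t′) (D t′) c d

  module ℂ-sum = Single _+ᶜ_ 0ᶜ +ᶜ-identityˡ +ᶜ-identityʳ
  module ℚ-sum = Single ℚ._+_ 0ℚ ℚ.+-identityˡ ℚ.+-identityʳ

  ≟-yes : ∀ {t t′} → t ≡ t′ → ⌊ t ≟ t′ ⌋ ≡ true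
  ≟-yes {t} {t′} e with t ≟ t′
  ... | yes _ = refl
  ... | no ne = ⊥-elim (ne e)

  ≟-no : ∀ {t t′} → t ≢ t′ → ⌊ t ≟ t′ ⌋ ≡ false
  ≟-no {t} {t′} ne with t ≟ t′
  ... | yes e = ⊥-elim (ne e)
  ... | no _ = refl

  W-zero : ∀ α β → α ≢ 0ℤ ⊎ β ≢ 0ℤ → ∀ t₁ σ₁ s₁ t₂ σ₂ s₂ → W F amplitude α β t₁ σ₁ s₁ t₂ σ₂ s₂ ≡ 0ᶜ
  W-zero α β ne t₁ σ₁ s₁ t₂ σ₂ s₂ = ∑ᶜ-zero elements λ t′ →
    ∑ᶜ-zero changes λ c₁ → ∑ᶜ-zero directions λ d₁ → ∑ᶜ-zero changes λ c₂ → ∑ᶜ-zero directions λ d₂ →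
      off-diagonal α β (hit t₁ σ₁ s₁ t′) (hit t₂ σ₂ s₂ t′) (C t′) (D t′) c₁ d₁ c₂ d₂ ne

  -- The only nonzero amplitude from `t` is at `V σ s t`, and `V⁻¹` shows that two sources with the
  -- same target coincide.
  W-diagonal : ∀ t₁ t₂ σ s → W F amplitude 0ℤ 0ℤ t₁ σ s t₂ σ s ≡ (if ⌊ t₁ ≟ t₂ ⌋ then 1ᶜ else 0ᶜ)
  W-diagonal t₁ t₂ σ s = trans
    (ℂ-sum.sum-cong elements {g = λ t′ → bit (hit t₁ σ s t′ ∧ hit t₂ σ s t′)} λ t′ → diagonal (hit t₁ σ s t′) (hit t₂ σ s t′) (C t′) (D t′))
    (trans (ℂ-sum.sum-elements F (λ t′ → bit (hit t₁ σ s t′ ∧ hit t₂ σ s t′)) (V σ s t₁)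
      λ t′ ne → cong (λ h → bit (h ∧ hit t₂ σ s t′)) (≟-no (≢-sym ne)))
    (trans (cong (λ h → bit (h ∧ hit t₂ σ s (V σ s t₁))) (≟-yes refl)) (cong bit (same (t₁ ≟ t₂)))))
    where
    same : (d : Dec (t₁ ≡ t₂)) → hit t₂ σ s (V σ s t₁) ≡ ⌊ d ⌋
    same (yes e) = ≟-yes (cong (V σ s) (sym e))
    same (no ne) = ≟-no λ e → ne (trans (sym (V⁻¹∘V σ s t₁)) (trans (cong (V⁻¹ σ s) (sym e)) (V⁻¹∘V σ s t₂)))

  one-two : ∀ {α} → α ∈ + 1 ∷ + 2 ∷ [] → α ≢ 0ℤ
  one-two (here refl) ()
  one-two (there (here refl)) ()

  machine : 2Q1CA Σ
  machine = record
    { Q = A ; finite = F ; q₀ = t₀ ; acc = acc ; rej = rej ; disjoint = disjoint ; δ = amplitude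
    ; wellFormed = record
      { orthonormal = W-diagonal
      ; separable-head = λ β∈ t₁ t₂ σ₁ σ₂ s → W-zero 0ℤ _ (inj₂ (one-two β∈)) t₁ σ₁ s t₂ σ₂ s
      ; separable-counter = λ α∈ t₁ t₂ σ s₁ s₂ → W-zero _ 0ℤ (inj₁ (one-two α∈)) t₁ σ s₁ t₂ σ s₂
      ; separable-both = λ α∈ _ t₁ t₂ σ₁ σ₂ s₁ s₂ → W-zero _ _ (inj₁ (one-two α∈)) t₁ σ₁ s₁ t₂ σ₂ s₂ } }

  bit-∈ : ∀ b → bit b ∈ 0ᶜ ∷ 1ᶜ ∷ []
  bit-∈ false = here refl
  bit-∈ true  = there (here refl)

  reversible : Is2R1CA machine
  reversible t σ s t′ c d = bit-∈ _

  move-bit-on : ∀ h c d → move-bit h c d c d ≡ bit h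
  move-bit-on h c d rewrite eqC-refl c | eqD-refl d = cong bit (Bool.∧-identityʳ h)

  move-bit-off : ∀ h c* d* c d → eqC c* c ∧ eqD d* d ≡ false → move-bit h c* d* c d ≡ 0ᶜ
  move-bit-off h c* d* c d e = cong bit (trans (cong (h ∧_) e) (Bool.∧-zeroʳ h))

  simple : Simple machine
  simple = record
    { V = λ σ s t′ t → bit (hit t σ s t′) ; C = λ t′ σ → C t′ ; D = D
    ; δ-on = λ { t σ s t′ c d (refl , refl) → move-bit-on (hit t σ s t′) (C t′) (D t′) }
    ; δ-off = λ t σ s t′ c d ne → move-bit-off (hit t σ s t′) (C t′) (D t′) c d
        (Bool.¬-not λ e → let e₁ , e₂ = ∧-true e in ne (eqC-sound _ _ e₁ , eqD-sound _ _ e₂)) }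

  halting : A → Bool
  halting t = acc t ∨ rej t

  module OnInput (x : List Σ) where
    open 2Q1CA machine using (U; P; Vector; ∣q₀,0,0⟩; continuing; neither; prob; probUpTo; ∥_∥²[_]; counters; SupportedWithin; U-support; continuing-support)

    n : ℕ
    n = length x

    Conf : Set
    Conf = Config A n

    w : Position n → Γ Σ
    w = Vec.lookup (tape x)

    rstep : Conf → Conf
    rstep (t , a , b) = V (w b) (sign a) t , a ℤ.+ ⟦ C (V (w b) (sign a) t) ⟧ , b ⊕ μ (D (V (w b) (sign a) t))

    Indicates : Conf → Vector x → Set
    Indicates κ ψ = ψ κ ≡ 1ᶜ × (∀ κ′ → κ′ ≢ κ → ψ κ′ ≡ 0ᶜ)

    Null : Vector x → Set
    Null ψ = ∀ κ → ψ κ ≡ 0ᶜ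

    source : Conf → ℤ × Position n
    source (t′ , a′ , b′) = a′ ℤ.- ⟦ C t′ ⟧ , b′ ⊕ (ℤ.- μ (D t′))

    term : Vector x → Conf → A → Change → Direction → ℚ[i]
    term ψ (t′ , a′ , b′) t c d =
      amplitude t (w (b′ ⊕ (ℤ.- μ d))) (sign (a′ ℤ.- ⟦ c ⟧)) t′ c d *ᶜ ψ (t , a′ ℤ.- ⟦ c ⟧ , b′ ⊕ (ℤ.- μ d))

    contribution : Vector x → Conf → A → ℚ[i]
    contribution ψ κ′ t = bit (hit t (w (proj₂ (source κ′))) (sign (proj₁ (source κ′))) (proj₁ κ′)) *ᶜ ψ (t , source κ′)

    -- Change and direction depend on the target state, so all contributions come from one place on
    -- the tape and one value of the counter.
    U-collapse : ∀ ψ κ′ → U x ψ κ′ ≡ ∑ᶜ elements (contribution ψ κ′)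
    U-collapse ψ κ′@(t′ , a′ , b′) = ℂ-sum.sum-cong elements {g = contribution ψ κ′} λ t →
      trans (∑ᶜ-changes (λ c → ∑ᶜ[ d ← directions ] term ψ κ′ t c d) (C t′) λ c e → ∑ᶜ-zero directions λ d →
        off t c d (cong (_∧ eqD (D t′) d) e))
      (trans (∑ᶜ-directions (term ψ κ′ t (C t′)) (D t′) λ d e → off t (C t′) d (trans (cong (eqC (C t′) (C t′) ∧_) e) (Bool.∧-zeroʳ _)))
      (cong (_*ᶜ ψ (t , source κ′)) (move-bit-on (hit t (w (proj₂ (source κ′))) (sign (proj₁ (source κ′))) t′) (C t′) (D t′))))
      where
      off : ∀ t c d → eqC (C t′) c ∧ eqD (D t′) d ≡ false → term ψ κ′ t c d ≡ 0ᶜ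
      off t c d e = trans (cong (_*ᶜ ψ (t , a′ ℤ.- ⟦ c ⟧ , b′ ⊕ (ℤ.- μ d)))
        (move-bit-off (hit t (w (b′ ⊕ (ℤ.- μ d))) (sign (a′ ℤ.- ⟦ c ⟧)) t′) (C t′) (D t′) c d e)) (*ᶜ-zeroˡ (ψ (t , a′ ℤ.- ⟦ c ⟧ , b′ ⊕ (ℤ.- μ d))))

    U-null : ∀ {ψ} → Null ψ → Null (U x ψ)
    U-null {ψ} ψ≡0 κ′ = trans (U-collapse ψ κ′) (∑ᶜ-zero elements λ t → *ᶜ-zeroʳ (bit (hit t (w (proj₂ (source κ′))) (sign (proj₁ (source κ′))) (proj₁ κ′))) (ψ≡0 (t , source κ′)))

    rstep-source : ∀ t κ′ → V (w (proj₂ (source κ′))) (sign (proj₁ (source κ′))) t ≡ proj₁ κ′ → rstep (t , source κ′) ≡ κ′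
    rstep-source t (t′ , a′ , b′) e = trans (cong (λ u → u , a′ ℤ.- ⟦ C t′ ⟧ ℤ.+ ⟦ C u ⟧ , b′ ⊕ (ℤ.- μ (D t′)) ⊕ μ (D u)) e)
      (cong (t′ ,_) (cong₂ _,_ (minus-plus a′ ⟦ C t′ ⟧) (⊖-⊕ b′ (D t′))))

    source-rstep : ∀ κ → source (rstep κ) ≡ proj₂ κ
    source-rstep (t , a , b) = cong₂ _,_ (plus-minus a _) (⊕-⊖ b (D (V (w b) (sign a) t)))

    _≟C_ : (κ κ′ : Conf) → Dec (κ ≡ κ′)
    _≟C_ = Product.≡-dec _≟_ (Product.≡-dec ℤ._≟_ Fin._≟_)

    U-indicates : ∀ {κ ψ} → Indicates κ ψ → Indicates (rstep κ) (U x ψ)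
    U-indicates {κ@(t , a , b)} {ψ} (one , zero′) = at-image , elsewhere
      where
      κ⁺ = rstep κ
      at-image : U x ψ κ⁺ ≡ 1ᶜ
      at-image = trans (U-collapse ψ κ⁺) (trans (ℂ-sum.sum-elements F (contribution ψ κ⁺) t
          λ u u≢t → *ᶜ-zeroʳ (bit (hit u (w (proj₂ (source κ⁺))) (sign (proj₁ (source κ⁺))) (proj₁ κ⁺))) (zero′ (u , source κ⁺) λ e → u≢t (cong proj₁ e)))
        (trans (cong (λ z → bit (hit t (w (proj₂ z)) (sign (proj₁ z)) (proj₁ κ⁺)) *ᶜ ψ (t , z)) (source-rstep κ))
          (cong₂ (λ h z → bit h *ᶜ z) (≟-yes refl) one)))
      elsewhere : ∀ κ′ → κ′ ≢ κ⁺ → U x ψ κ′ ≡ 0ᶜ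
      elsewhere κ′ ne = trans (U-collapse ψ κ′) (∑ᶜ-zero elements λ u → go u ((u , source κ′) ≟C κ))
        where
        go : ∀ u → Dec ((u , source κ′) ≡ κ) → contribution ψ κ′ u ≡ 0ᶜ
        go u (no ne′) = *ᶜ-zeroʳ (bit (hit u (w (proj₂ (source κ′))) (sign (proj₁ (source κ′))) (proj₁ κ′))) (zero′ (u , source κ′) ne′)
        go u (yes e) = trans (cong (λ h → bit h *ᶜ ψ (u , source κ′)) (≟-no λ e′ →
          ne (trans (sym (rstep-source u κ′ e′)) (cong rstep e)))) (*ᶜ-zeroˡ (ψ (u , source κ′)))

    P-keeps : ∀ {G κ ψ} → G (proj₁ κ) ≡ true → Indicates κ ψ → Indicates κ (P x G ψ)
    P-keeps {G} {κ} {ψ} e (one , zero′) = trans (cong (λ g → if g then ψ κ else 0ᶜ) e) one ,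
      λ κ′ ne → if-0 (G (proj₁ κ′)) (zero′ κ′ ne)

    P-kills : ∀ {G κ ψ} → G (proj₁ κ) ≡ false → Indicates κ ψ → Null (P x G ψ)
    P-kills {G} {κ} {ψ} e (one , zero′) κ′ = go (κ′ ≟C κ)
      where
      go : Dec (κ′ ≡ κ) → P x G ψ κ′ ≡ 0ᶜ
      go (yes refl) = cong (λ g → if g then ψ κ else 0ᶜ) e
      go (no ne) = if-0 (G (proj₁ κ′)) (zero′ κ′ ne)

    P-null : ∀ {G ψ} → Null ψ → Null (P x G ψ)
    P-null {G} ψ≡0 κ = if-0 (G (proj₁ κ)) (ψ≡0 κ)

    initial : Conf
    initial = t₀ , 0ℤ , zero

    initial-indicates : Indicates initial (∣q₀,0,0⟩ x)
    initial-indicates = trans (cong (λ h → if h then 1ᶜ else 0ᶜ) (≟-yes refl)) refl , other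
      where
      other : ∀ κ → κ ≢ initial → ∣q₀,0,0⟩ x κ ≡ 0ᶜ
      other (t , a , b) ne with t ≟ t₀ | a ℤ.≟ 0ℤ | b Fin.≟ zero
      ... | no _ | _ | _ = refl
      ... | yes _ | no _ | _ = refl
      ... | yes _ | yes _ | no _ = refl
      ... | yes refl | yes refl | yes refl = ⊥-elim (ne refl)

    norm-null : ∀ m {ψ} → Null ψ → ∥_∥²[_] x ψ m ≡ 0ℚ
    norm-null m ψ≡0 = ℚ-sum.sum-o elements λ t → ℚ-sum.sum-o (counters x m) λ a → ℚ-sum.sum-o (allFin (2 + n)) λ b →
      cong ∣_∣² (ψ≡0 (t , a , b))

    norm-indicates : ∀ m {κ ψ} → ℤ.∣ proj₁ (proj₂ κ) ∣ ≤ m → Indicates κ ψ → ∥_∥²[_] x ψ m ≡ 1ℚ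
    norm-indicates m {t , a , b} {ψ} a≤m (one , zero′) =
      trans (ℚ-sum.sum-elements F _ t λ t′ ne → ℚ-sum.sum-o (counters x m) λ a′ → ℚ-sum.sum-o (allFin (2 + n)) λ b′ →
        vanish (t′ , a′ , b′) λ e → ne (cong proj₁ e))
      (trans (cong (λ as → ℚ-sum.sum as inner) (List.map-applyUpTo (λ k → k) value (suc (2 * m))))
      (trans (ℚ-sum.sum-applyUpTo (suc (2 * m)) value inner k k< λ l l≢k → ℚ-sum.sum-o (allFin (2 + n)) λ b′ →
        vanish (t , value l , b′) λ e → l≢k (ℤ.+-injective (trans (sym (minus-plus (+ l) (+ m)))
          (trans (cong (λ z → z ℤ.+ + m) (trans (cong (proj₁ ∘ proj₂) e) (sym value-k))) (minus-plus (+ k) (+ m))))))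
      (trans (cong inner value-k)
      (trans (ℚ-sum.sum-tabulate (λ b → b) (λ b′ → ∣ ψ (t , a , b′) ∣²) b λ b′ ne → vanish (t , a , b′) λ e → ne (cong (proj₂ ∘ proj₂) e))
      (cong ∣_∣² one)))))
      where
      vanish : ∀ κ′ → κ′ ≢ (t , a , b) → ∣ ψ κ′ ∣² ≡ 0ℚ
      vanish κ′ ne = cong ∣_∣² (zero′ κ′ ne)
      inner : ℤ → ℚ
      inner a′ = ∑[ b′ ← allFin (2 + n) ] ∣ ψ (t , a′ , b′) ∣²
      value : ℕ → ℤ
      value k = + k ℤ.- + m
      shifted : ∃ λ k → k < suc (2 * m) × + k ≡ a ℤ.+ + m
      shifted = locate a a≤m
        where
        locate : ∀ a → ℤ.∣ a ∣ ≤ m → ∃ λ k → k < suc (2 * m) × + k ≡ a ℤ.+ + m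
        locate (+ j) j≤m = j + m , s≤s (ℕ.≤-trans (ℕ.+-monoˡ-≤ m j≤m) (ℕ.≤-reflexive (cong (λ z → m + z) (sym (ℕ.+-identityʳ m))))) , refl
        locate -[1+ j ] j<m = m ∸ suc j , s≤s (ℕ.≤-trans (ℕ.m∸n≤m m (suc j)) (ℕ.m≤m+n m (m + 0))) , sym (ℤ.⊖-≥ j<m)
      k : ℕ
      k = proj₁ shifted
      k< : k < suc (2 * m)
      k< = proj₁ (proj₂ shifted)
      value-k : value k ≡ a
      value-k = trans (cong (λ z → z ℤ.- + m) (proj₂ (proj₂ shifted))) (plus-minus a (+ m))

    module Halting (H : ℕ) (running : ∀ (u : ℕ) → u < H → halting (proj₁ (iter rstep (suc u) initial)) ≡ false)
                   (halted : halting (proj₁ (iter rstep (suc H) initial)) ≡ true) where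

      indicates : ∀ u → u ≤ H → Indicates (iter rstep u initial) (continuing x u)
      indicates-U : ∀ u → u ≤ H → Indicates (iter rstep (suc u) initial) (U x (continuing x u))
      indicates-U u u≤H = subst (λ κ → Indicates κ (U x (continuing x u))) (sym (iter-suc rstep u initial)) (U-indicates (indicates u u≤H))
      indicates zero _ = initial-indicates
      indicates (suc u) u<H = P-keeps (cong not (running u u<H)) (indicates-U u (ℕ.<⇒≤ u<H))

      -- Without renormalization, the vector left after a certain halt is zero and stays so.
      null-after : ∀ u → Null (continuing x (suc H + u))
      null-after zero = subst (λ t → Null (continuing x (suc t))) (sym (ℕ.+-identityʳ H))
        (P-kills (cong not halted) (indicates-U H ℕ.≤-refl))
      null-after (suc u) = subst (λ t → Null (continuing x (suc t))) (sym (ℕ.+-suc H u)) (P-null (U-null (null-after u)))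

      module Outcome (G : A → Bool) (G-halting : ∀ t → halting t ≡ false → G t ≡ false)
                     (good : G (proj₁ (iter rstep (suc H) initial)) ≡ true) where

        final : Conf
        final = iter rstep (suc H) initial

        final-indicates : Indicates final (U x (continuing x H))
        final-indicates = indicates-U H ℕ.≤-refl

        outside : suc H < ℤ.∣ proj₁ (proj₂ final) ∣ → U x (continuing x H) final ≡ 0ᶜ
        outside = U-support x {H} {continuing x H} (continuing-support x H) (proj₁ final) (proj₁ (proj₂ final)) (proj₂ (proj₂ final))

        prob-at : prob x G H ≡ 1ℚ
        prob-at = norm-indicates (suc H) {final} {P x G (U x (continuing x H))}
          -- The bound on the counter is read off the vector: beyond the window its coefficient
          -- would be 0, but it is 1.
          (ℕ.≮⇒≥ λ lt → 1ᶜ≢0ᶜ (trans (sym (proj₁ final-indicates)) (outside lt)))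
          (P-keeps {G} {final} {U x (continuing x H)} good final-indicates)

        prob-before : ∀ t → t < H → prob x G t ≡ 0ℚ
        prob-before t t<H = norm-null (suc t) {P x G (U x (continuing x t))}
          (P-kills {G} {iter rstep (suc t) initial} {U x (continuing x t)} (G-halting _ (running t t<H)) (indicates-U t (ℕ.<⇒≤ t<H)))

        prob-after : ∀ t → H < t → prob x G t ≡ 0ℚ
        prob-after t H<t = norm-null (suc t) {P x G (U x (continuing x t))} (P-null {G} {U x (continuing x t)} (U-null {continuing x t}
          (subst (λ t → Null (continuing x t)) (ℕ.m+[n∸m]≡n H<t) (null-after (t ∸ suc H)))))

        prob-else : ∀ t → t ≢ H → prob x G t ≡ 0ℚ
        prob-else t ne = go (ℕ.≤-total t H)
          where
          go : t ≤ H ⊎ H ≤ t → prob x G t ≡ 0ℚ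
          go (inj₁ t≤H) = prob-before t (ℕ.≤∧≢⇒< t≤H ne)
          go (inj₂ H≤t) = prob-after t (ℕ.≤∧≢⇒< H≤t (≢-sym ne))

        certain : probUpTo x G ConvergesTo 1ℚ
        certain ε 0<ε = suc H , λ T H<T → subst (λ p → ℚ.∣ p ℚ.- 1ℚ ∣ ℚ.< ε)
          (sym (trans (ℚ-sum.sum-applyUpTo T (λ k → k) (prob x G) H H<T prob-else) prob-at)) 0<ε

-- The tour on an actual input

tape-end : {Σ : Set} (xs : List Σ) (b : Fin (suc (length xs))) →
           let σ = Vec.lookup (Vec.map input (Vec.fromList xs) Vec.∷ʳ $) b in
           (∃ λ y → σ ≡ input y × toℕ b < length xs) ⊎ (σ ≡ $ × toℕ b ≡ length xs)
tape-end []       zero    = inj₂ (refl , refl)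
tape-end (x ∷ xs) zero    = inj₁ (x , refl , s≤s z≤n)
tape-end (x ∷ xs) (suc b) with tape-end xs b
... | inj₁ (y , e , lt) = inj₁ (y , e , s≤s lt)
... | inj₂ (e , eq)     = inj₂ (e , cong suc eq)

module _ {Σ : Set} (x : List Σ) where

  private
    w : Position (length x) → Γ Σ
    w = Vec.lookup (tape x)

  tape-¢ : ∀ b → w b ≡ ¢ → b ≡ zero
  tape-¢ zero    _ = refl
  tape-¢ (suc b) e with tape-end x b
  ... | inj₁ (_ , e′ , _) with trans (sym e) e′
  ...   | ()
  tape-¢ (suc b) e | inj₂ (e′ , _) with trans (sym e) e′
  ...   | ()

  tape-$ : ∀ b → w b ≡ $ → toℕ b ≡ suc (length x)
  tape-$ (suc b) e with tape-end x b
  ... | inj₂ (_ , eq) = cong suc eq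
  ... | inj₁ (_ , e′ , _) with trans (sym e) e′
  ...   | ()

  tape-last : ∀ b → toℕ b ≡ suc (length x) → w b ≡ $
  tape-last (suc b) eq with tape-end x b
  ... | inj₂ (e , _) = e
  ... | inj₁ (_ , _ , lt) = ⊥-elim (ℕ.<-irrefl (ℕ.suc-injective eq) lt)

module TourMachine {Σ Q : Set} (F : Finite Q) (q₀ : Q) (acc rej : Q → Bool)
  (disjoint : ∀ (q : Q) → ¬ (T (acc q) × T (rej q))) (δ : Q → Γ Σ → S → Q × Change × Direction) where

  open Euler F δ (λ q _ → acc q ∨ rej q)

  -- A `try` state stands at the node whose state it carries and halts with it at any cursor. An
  -- `arr` state stands beside its node and must not halt.
  on-try : (Q → Bool) → State → Bool
  on-try G (try q j) = G q
  on-try G (arr q k) = false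

  disjoint′ : ∀ t → ¬ (T (on-try acc t) × T (on-try rej t))
  disjoint′ (try q j) = disjoint q

  open Permutation fin-State V V⁻¹ V⁻¹∘V C D (try q₀ zero) (on-try acc) (on-try rej) disjoint′ public
    using (machine; reversible; simple; module OnInput; halting)

  module _ (xs : List Σ) where

    open Run (Vec.lookup (tape xs))
    open OnInput xs using (module Halting) renaming (initial to origin)

    stopped-halting : ∀ c → stopped c ≡ halting (proj₁ c)
    stopped-halting (try q j , a , b) = refl
    stopped-halting (arr q k , a , b) = refl

    certain : ∀ (G : State → Bool) → (∀ t → halting t ≡ false → G t ≡ false) → ∀ {y} → Acc _≺_ y →
              Reaches y (q₀ , 0ℤ , zero) → (∀ j → G (try (proj₁ y) j) ≡ true) → 2Q1CA.probUpTo machine xs G ConvergesTo 1ℚ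
    certain G G-halting {y} a r good = finish (tour-halts a r)
      where
      finish : (∃ λ j → rstep origin ↝ at y j) → 2Q1CA.probUpTo machine xs G ConvergesTo 1ℚ
      finish (j , p) = let l , e , none = ↝-iter p in
        -- The first step of the tour is unconditional, so the halt falls on step `suc l`.
        Halting.Outcome.certain l (λ u u<l → trans (sym (stopped-halting (iter rstep (suc u) origin))) (none u u<l))
          (trans (sym (stopped-halting (iter rstep (suc l) origin))) (trans (cong stopped e) (reaches-stop r)))
          G G-halting (trans (cong (G ∘ proj₁) e) (good j))

-- Machines with labels, and the detours that maintain them

module Labelled {Σ N P : Set} (stepP : P → Γ Σ → P) (δN : N → P → Γ Σ → S → N × Change × Direction)
  (haltedN : N → Bool) (deadN : N) {n : ℕ} (w : Position n → Γ Σ) where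

  NC : Set
  NC = N × ℤ × Position n

  perform : N × Change × Direction → ℤ × Position n → NC
  perform (x , c , d) (a , b) = x , a ℤ.+ ⟦ c ⟧ , b ⊕ μ d

  module Labelling (lab : Position n → P) where

    nstep : NC → NC
    nstep (x , a , b) = perform (δN x (lab b) (w b) (sign a)) (a , b)

    infix 4 _⟹_
    infixr 5 _◁_
    data _⟹_ : NC → NC → Set where
      ε   : ∀ {x} → x ⟹ x
      _◁_ : ∀ {x y} → haltedN (proj₁ x) ≡ false → nstep x ⟹ y → x ⟹ y

    infixr 5 _◁◁_
    _◁◁_ : ∀ {x y z} → x ⟹ y → y ⟹ z → x ⟹ z
    ε       ◁◁ q = q
    (e ◁ p) ◁◁ q = e ◁ (p ◁◁ q)

    onward : ∀ {x y z} → haltedN (proj₁ x) ≡ false → nstep x ≡ y → y ⟹ z → x ⟹ z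
    onward e refl p = e ◁ p

  -- The walk with nonzero counter from an arbitrary label, which hu updates
  -- when the head moves to the left.
  module Walking (hu : Position n → P → Maybe P) where

    Pseudo : Set
    Pseudo = N × Position n × P

    -- A label that no label of the target cell leads to is false; the walk then dies.
    relabelled : Maybe P → N → Position n → P → Pseudo
    relabelled (just r) n′ b p = n′ , b , r
    relabelled nothing  n′ b p = deadN , b , p

    arrive : N → Direction → Position n → P → Pseudo
    arrive n′ ← b p = relabelled (hu (b ⊕ -1ℤ) p) n′ (b ⊕ -1ℤ) p
    arrive n′ ↓ b p = n′ , b ⊕ 0ℤ , p
    arrive n′ ⟶ b p = n′ , b ⊕ 1ℤ , stepP p (w b)

    transit : N × Change × Direction → Position n → P → Pseudo
    transit (n′ , _ , d) b p = arrive n′ d b p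

    pf : Pseudo → Pseudo
    pf (n , b , p) = transit (if haltedN n then (n , keep , ↓) else δN n p (w b) 𝟏) b p

module HopcroftUllman {Σ N P : Set} (FN : Finite N) (FP : Finite P) (stepP : P → Γ Σ → P) (blank : P)
  (step-¢ : ∀ (p : P) → stepP p ¢ ≡ blank) (step-$ : ∀ (p : P) → stepP p $ ≡ blank)
  (δN : N → P → Γ Σ → S → N × Change × Direction)
  (accN rejN : N → Bool) (disjointN : ∀ (x : N) → ¬ (T (accN x) × T (rejN x))) (deadN n₀ : N) where

  haltedN : N → Bool
  haltedN x = accN x ∨ rejN x

  _≟P_ : (p p′ : P) → Dec (p ≡ p′)
  _≟P_ = Finite._≟_ FP

  -- It matters only whether there are no values, one, or more; in the last case two arguments are
  -- kept, to start the two runs that find the way back.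
  data Image (g : P → Maybe P) : Set where
    none : (∀ r j → g r ≢ just j) → Image g
    one  : ∀ r k → g r ≡ just k → (∀ r′ j → g r′ ≡ just j → j ≡ k) → Image g
    two  : ∀ r₁ r₂ {j₁ j₂} → g r₁ ≡ just j₁ → g r₂ ≡ just j₂ → j₁ ≢ j₂ → Image g

  search : {T : P → Set} → (∀ r → Dec (T r)) → Dec (∃ T)
  search {T} T? = map′ (λ (x , t) → Finite.element FP x , t)
    (λ (r , t) → index FP r , subst T (sym (element∘index FP r)) t) (Fin.any? (λ x → T? (Finite.element FP x)))

  value? : ∀ (x : Maybe P) → Dec (∃ λ j → x ≡ just j)
  value? (just j) = yes (j , refl)
  value? nothing  = no λ ()

  value≢? : ∀ k (x : Maybe P) → Dec (∃ λ j → x ≡ just j × j ≢ k)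
  value≢? k nothing = no λ ()
  value≢? k (just j) with j ≟P k
  ... | yes e = no λ { (_ , refl , ne) → ne e }
  ... | no ne = yes (j , refl , ne)

  image : ∀ g → Image g
  image g with search (λ r → value? (g r))
  ... | no ¬v = none λ r j e → ¬v (r , j , e)
  ... | yes (r , k , e) with search (λ r → value≢? k (g r))
  ...   | yes (r′ , j , e′ , ne) = two r r′ e e′ (≢-sym ne)
  ...   | no ¬v = one r k e λ r′ j e′ → decidable-stable (j ≟P k) λ ne → ¬v (r′ , j , e′ , ne)

  Fun : Set
  Fun = FP ⇒ Maybe P

  -- The states lsw₀, lsw, rsw and fin carry out a step to the left: lsw₀ and lsw
  -- sweep left with the map from labels of the current cell to the candidate
  -- labels of the target cell; once a single candidate remains, rsw follows two
  -- runs to the right that merge just behind the target cell.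
  data State₁ : Set where
    main lsw₀ fin : N → P → State₁
    lsw           : N → Fun → State₁
    rsw           : N → P → P → P → State₁
    dead          : State₁

  fin-State₁ : Finite State₁
  fin-State₁ = fin-map (mk↔ₛ′ to from to∘from from∘to)
    (fin-⊎ (fin-⊎ (fin-× FN FP) (fin-× FN FP)) (fin-⊎ (fin-⊎ (fin-× FN FP) (fin-× FN (fin-Vec (fin-Maybe FP) (Finite.size FP))))
      (fin-⊎ (fin-× FN (fin-× FP (fin-× FP FP))) fin-⊤)))
    where
    Code : Set
    Code = ((N × P) ⊎ (N × P)) ⊎ (((N × P) ⊎ (N × Fun)) ⊎ ((N × P × P × P) ⊎ ⊤))
    to : State₁ → Code
    to (main x p) = inj₁ (inj₁ (x , p))
    to (lsw₀ x p) = inj₁ (inj₂ (x , p))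
    to (fin x p) = inj₂ (inj₁ (inj₁ (x , p)))
    to (lsw x f) = inj₂ (inj₁ (inj₂ (x , f)))
    to (rsw x p q r) = inj₂ (inj₂ (inj₁ (x , p , q , r)))
    to dead = inj₂ (inj₂ (inj₂ tt))
    from : Code → State₁
    from (inj₁ (inj₁ (x , p))) = main x p
    from (inj₁ (inj₂ (x , p))) = lsw₀ x p
    from (inj₂ (inj₁ (inj₁ (x , p)))) = fin x p
    from (inj₂ (inj₁ (inj₂ (x , f)))) = lsw x f
    from (inj₂ (inj₂ (inj₁ (x , p , q , r)))) = rsw x p q r
    from (inj₂ (inj₂ (inj₂ tt))) = dead
    to∘from : ∀ c → to (from c) ≡ c
    to∘from (inj₁ (inj₁ _)) = refl
    to∘from (inj₁ (inj₂ _)) = refl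
    to∘from (inj₂ (inj₁ (inj₁ _))) = refl
    to∘from (inj₂ (inj₁ (inj₂ _))) = refl
    to∘from (inj₂ (inj₂ (inj₁ _))) = refl
    to∘from (inj₂ (inj₂ (inj₂ _))) = refl
    from∘to : ∀ s → from (to s) ≡ s
    from∘to (main _ _) = refl
    from∘to (lsw₀ _ _) = refl
    from∘to (fin _ _) = refl
    from∘to (lsw _ _) = refl
    from∘to (rsw _ _ _ _) = refl
    from∘to dead = refl

  -- That `dead` rejects is arbitrary: it has to halt, and runs with true labels do not enter it.
  acc₁ rej₁ halted₁ : State₁ → Bool
  acc₁ (main x p) = accN x
  acc₁ _ = false
  rej₁ (main x p) = rejN x
  rej₁ dead = true
  rej₁ _ = false
  halted₁ q = acc₁ q ∨ rej₁ q

  disjoint₁ : ∀ q → ¬ (T (acc₁ q) × T (rej₁ q))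
  disjoint₁ (main x p) = disjointN x

  Out : Set
  Out = State₁ × Change × Direction

  dying : Out
  dying = dead , keep , ↓

  candidate : P → Γ Σ → P → Maybe P
  candidate p σ r with stepP r σ ≟P p
  ... | yes _ = just r
  ... | no  _ = nothing

  before-step : Fun → Γ Σ → P → Maybe P
  before-step f σ r = app FP f (stepP r σ)

  start : ∀ {g} → N → Image g → Out
  start         x (none _)        = dying
  start         x (one _ k _ _)   = main x k , keep , ↓
  start {g}     x (two _ _ _ _ _) = lsw x (⟪_⟫ FP g) , keep , ←

  -- The sweep has just found a single value, whereas `f` still takes two one cell to the right.
  -- Arguments with different values start the runs there; the other cases belong to inconsistent
  -- states and only have to halt.
  turn-back : ∀ {g} → N → P → Image g → Out
  turn-back x k (two r₁ r₂ _ _ _) = rsw x r₁ r₂ k , keep , ⟶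
  turn-back x k (one _ _ _ _)     = dying
  turn-back x k (none _)          = dying

  sweep-left : ∀ {g} → N → Fun → Image g → Out
  sweep-left     x f (none _)        = dying
  sweep-left     x f (one _ k _ _)   = turn-back x k (image (app FP f))
  sweep-left {g} x f (two _ _ _ _ _) = lsw x (⟪_⟫ FP g) , keep , ←

  sweep-right : ∀ {r₁ r₂} → N → P → Dec (r₁ ≡ r₂) → Out
  sweep-right           x k (yes _) = fin x k , keep , ⟶
  sweep-right {r₁} {r₂} x k (no _)  = rsw x r₁ r₂ k , keep , ⟶

  -- The counter changes at once; the detour after a left move keeps it and ignores its sign.
  go-main : P → Γ Σ → N × Change × Direction → Out
  go-main p σ (x , c , ←) = lsw₀ x p , c , ←
  go-main p σ (x , c , ↓) = main x p , c , ↓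
  go-main p σ (x , c , ⟶) = main x (stepP p σ) , c , ⟶

  δ₁ : State₁ → Γ Σ → S → Out
  δ₁ (main x p)      σ s = go-main p σ (δN x p σ s)
  δ₁ (lsw₀ x p)      σ s = start x (image (candidate p σ))
  δ₁ (lsw x f)       σ s = sweep-left x f (image (before-step f σ))
  δ₁ (rsw x r₁ r₂ k) σ s = sweep-right x k (stepP r₁ σ ≟P stepP r₂ σ)
  δ₁ (fin x k)       σ s = main x k , keep , ←
  δ₁ dead            σ s = dying

  module Detours {n : ℕ} (w : Position n → Γ Σ) (w0 : w zero ≡ ¢)
              (wN : ∀ (b : Position n) → toℕ b ≡ suc n → w b ≡ $) where

    Node : Set
    Node = State₁ × Position n

    infixr 5 _∷_
    data Detour : Node → Node → Set where
      []  : ∀ {y} → Detour y y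
      _∷_ : ∀ {q b q′ d y} → halted₁ q ≡ false × (∀ s → δ₁ q (w b) s ≡ (q′ , keep , d)) → Detour (q′ , b ⊕ μ d) y → Detour (q , b) y

    candidate-sound : ∀ p σ r j → candidate p σ r ≡ just j → j ≡ r × stepP r σ ≡ p
    candidate-sound p σ r j e with stepP r σ ≟P p
    candidate-sound p σ r .r refl | yes e = refl , e

    candidate-complete : ∀ p σ r → stepP r σ ≡ p → candidate p σ r ≡ just r
    candidate-complete p σ r e with stepP r σ ≟P p
    ... | yes _ = refl
    ... | no ¬e = ⊥-elim (¬e e)

    along : ℕ → P → Position n → P
    along zero    r x = r
    along (suc t) r x = along t (stepP r (w x)) (x ⊕ 1ℤ)

    right : ℕ → Position n → Position n
    right zero    x = x
    right (suc t) x = right t (x ⊕ 1ℤ)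

    module Target (b : Position n) (p : P) where

      -- f maps a label of cell x, t cells to the left of b, to the label it
      -- leads to at b, if that one in turn leads to p.
      Traces : Fun → Position n → ℕ → Set
      Traces f x t = right t x ≡ b × (∀ r → app FP f r ≡ candidate p (w b) (along t r x) )

      Result : Maybe P → (N → Node) → Set
      Result (just r) from = stepP r (w b) ≡ p × (∀ x → Detour (from x) (main x r , b))
      Result nothing  from = ∀ x → ∃ λ c → Detour (from x) (dead , c)

      -- The runs differ at `b`, hence at every cell before it, and both give `p` behind it. Merging
      -- there and nowhere earlier, they mark the target cell.
      merge : ∀ t x k r₁ r₂ → right t x ≡ b → along t r₁ x ≢ along t r₂ x →
              stepP (along t r₁ x) (w b) ≡ p → stepP (along t r₂ x) (w b) ≡ p →
              ∀ y → Detour (rsw y r₁ r₂ k , x) (main y k , b)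
      merge zero x k r₁ r₂ refl ne e₁ e₂ y = (refl , λ _ → met (stepP r₁ (w x) ≟P stepP r₂ (w x))) ∷
        subst (λ c → Detour (fin y k , x ⊕ 1ℤ) (main y k , c)) (right-left x) ((refl , λ _ → refl) ∷ [])
        where
        met : (d : Dec (stepP r₁ (w x) ≡ stepP r₂ (w x))) → sweep-right y k d ≡ (fin y k , keep , ⟶)
        met (yes _) = refl
        met (no ¬e) = ⊥-elim (¬e (trans e₁ (sym e₂)))
      merge (suc t) x k r₁ r₂ rt ne e₁ e₂ y = (refl , λ _ → apart (stepP r₁ (w x) ≟P stepP r₂ (w x))) ∷
        merge t (x ⊕ 1ℤ) k (stepP r₁ (w x)) (stepP r₂ (w x)) rt ne e₁ e₂ y
        where
        apart : (d : Dec (stepP r₁ (w x) ≡ stepP r₂ (w x))) →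
                sweep-right y k d ≡ (rsw y (stepP r₁ (w x)) (stepP r₂ (w x)) k , keep , ⟶)
        apart (yes e) = ⊥-elim (ne (cong (λ r → along t r (x ⊕ 1ℤ)) e))
        apart (no _) = refl

      Two : Fun → Set
      Two f = ∃₂ λ r₁ r₂ → ∃₂ λ j₁ j₂ → app FP f r₁ ≡ just j₁ × app FP f r₂ ≡ just j₂ × j₁ ≢ j₂

      turning : ∀ {f t x} k → Traces f x t → Two f → (m : Image (app FP f)) →
                ∀ y → ∃ λ q → turn-back y k m ≡ (q , keep , ⟶) × Detour (q , x) (main y k , b)
      turning {f} {t} {x} k (rt , tr) _ (two r₁ r₂ {j₁} {j₂} e₁ e₂ ne) y = rsw y r₁ r₂ k , refl ,
        merge t x k r₁ r₂ rt (λ e → ne (trans (proj₁ (hit r₁ j₁ e₁)) (trans e (sym (proj₁ (hit r₂ j₂ e₂))))))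
          (proj₂ (hit r₁ j₁ e₁)) (proj₂ (hit r₂ j₂ e₂)) y
        where
        hit : ∀ r j → app FP f r ≡ just j → j ≡ along t r x × stepP (along t r x) (w b) ≡ p
        hit r j e = candidate-sound p (w b) (along t r x) j (trans (sym (tr r)) e)
      turning k _ (r₁ , r₂ , j₁ , j₂ , e₁ , e₂ , ne) (one _ _ _ u) y = ⊥-elim (ne (trans (u r₁ j₁ e₁) (sym (u r₂ j₂ e₂))))
      turning k _ (r₁ , r₂ , j₁ , j₂ , e₁ , e₂ , ne) (none u) y = ⊥-elim (u r₁ j₁ e₁)

      -- At ¢ all labels lead to the same one, so at most one value is left and the sweep cannot go
      -- further.
      ¢-constant : ∀ c f r₁ r₂ → toℕ c ≡ 0 → before-step f (w c) r₁ ≡ before-step f (w c) r₂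
      ¢-constant c f r₁ r₂ e = subst (λ σ → before-step f σ r₁ ≡ before-step f σ r₂)
        (sym (trans (cong w (Fin.toℕ-injective {j = zero} e)) w0)) (cong (app FP f) (trans (step-¢ r₁) (sym (step-¢ r₂))))

      traces-left : ∀ {f c t} → Traces f (c ⊕ 1ℤ) t → Traces (⟪_⟫ FP (before-step f (w c))) c (suc t)
      traces-left {f} {c} (rt , tr) = rt , λ r → trans (app-⟪⟫ FP (before-step f (w c)) r) (tr (stepP r (w c)))

      traces-here : Traces (⟪_⟫ FP (candidate p (w b))) b 0
      traces-here = refl , app-⟪⟫ FP (candidate p (w b))

      two-⟪⟫ : ∀ g r₁ r₂ {j₁ j₂} → g r₁ ≡ just j₁ → g r₂ ≡ just j₂ → j₁ ≢ j₂ → Two (⟪_⟫ FP g)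
      two-⟪⟫ g r₁ r₂ e₁ e₂ ne = r₁ , r₂ , _ , _ , trans (app-⟪⟫ FP g r₁) e₁ , trans (app-⟪⟫ FP g r₂) e₂ , ne

      module _ (lab : Position n → P) (lab-right : ∀ (c : Position n) → lab (c ⊕ 1ℤ) ≡ stepP (lab c) (w c)) where

        along-lab : ∀ t x → along t (lab x) x ≡ lab (right t x)
        along-lab zero    x = refl
        along-lab (suc t) x = trans (cong (λ r → along t r (x ⊕ 1ℤ)) (sym (lab-right x))) (along-lab t (x ⊕ 1ℤ))

        traces-lab : ∀ {f x t} → Traces f x t → lab (b ⊕ 1ℤ) ≡ p → app FP f (lab x) ≡ just (lab b)
        traces-lab {f} {x} {t} (rt , tr) e = trans (tr (lab x)) (trans (cong (candidate p (w b)) (trans (along-lab t x) (cong lab rt)))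
          (candidate-complete p (w b) (lab b) (trans (sym (lab-right b)) e)))

      -- A single outcome serves all labellings that fit the tape and give `p` behind `b`. For a
      -- false `p` it still says how the detour ends.
      LeftResult : (N → Node) → Set
      LeftResult from = ∃ λ res → Result res from ×
        (∀ (lab : Position n → P) → (∀ c → lab (c ⊕ 1ℤ) ≡ stepP (lab c) (w c)) → lab (b ⊕ 1ℤ) ≡ p → res ≡ just (lab b))

      left : ∀ K c f t → toℕ c ≤ K → Traces f (c ⊕ 1ℤ) t → Two f → LeftResult (λ x → lsw x f , c)
      left-image : ∀ K c f t → toℕ c ≤ K → Traces f (c ⊕ 1ℤ) t → Two f → (m : Image (before-step f (w c))) →
        image (before-step f (w c)) ≡ m → LeftResult (λ x → lsw x f , c)
      left-two : ∀ K c f t k → toℕ c ≡ k → k ≤ K → Traces (⟪_⟫ FP (before-step f (w c))) c (suc t) →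
        ∀ r₁ r₂ {j₁ j₂} → before-step f (w c) r₁ ≡ just j₁ → before-step f (w c) r₂ ≡ just j₂ → j₁ ≢ j₂ →
        LeftResult (λ x → lsw x (⟪_⟫ FP (before-step f (w c))) , c ⊕ -1ℤ)

      left K c f t c≤K tr tw = left-image K c f t c≤K tr tw (image (before-step f (w c))) refl

      prepend : ∀ {from from′ : N → Node} → (∀ {x y} → Detour (from′ x) y → Detour (from x) y) → LeftResult from′ → LeftResult from
      prepend f (just r , (e , d) , l) = just r , (e , λ x → f (d x)) , l
      prepend f (nothing , d , l) = nothing , (λ x → proj₁ (d x) , f (proj₂ (d x))) , l

      left-image K c f t c≤K tr tw (two r₁ r₂ e₁ e₂ ne) eq =
        prepend ((refl , λ _ → cong (sweep-left _ f) eq) ∷_) (left-two K c f t (toℕ c) refl c≤K (traces-left {f} {c} {t} tr) r₁ r₂ e₁ e₂ ne)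
      left-image K c f t c≤K tr tw (one r k e u) eq = just k ,
        (proj₂ (sound k (trans (sym (proj₂ tr (stepP r (w c)))) e)) , λ x →
          let q , e′ , d = turning {f} {t} k tr tw (image (app FP f)) x in
          (refl , λ _ → trans (cong (sweep-left x f) eq) e′) ∷ d) ,
        λ lab lr lp → cong just (sym (u (lab c) (lab b) (trans (cong (app FP f) (sym (lr c))) (traces-lab lab lr {f} {c ⊕ 1ℤ} {t} tr lp))))
        where
        sound : ∀ j → candidate p (w b) (along t (stepP r (w c)) (c ⊕ 1ℤ)) ≡ just j →
                j ≡ along t (stepP r (w c)) (c ⊕ 1ℤ) × stepP j (w b) ≡ p
        sound j e = let e₁ , e₂ = candidate-sound p (w b) (along t (stepP r (w c)) (c ⊕ 1ℤ)) j e in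
          e₁ , trans (cong (λ r → stepP r (w b)) e₁) e₂
      left-image K c f t c≤K tr tw (none u) eq = nothing ,
        (λ x → _ , (refl , λ _ → cong (sweep-left x f) eq) ∷ []) ,
        λ lab lr lp → ⊥-elim (u (lab c) (lab b) (trans (cong (app FP f) (sym (lr c))) (traces-lab lab lr {f} {c ⊕ 1ℤ} {t} tr lp)))

      left-two K c f t zero c≡ k≤K tr r₁ r₂ e₁ e₂ ne =
        ⊥-elim (ne (just-injective (trans (sym e₁) (trans (¢-constant c f r₁ r₂ c≡) e₂))))
      left-two (suc K) c f t (suc k) c≡ (s≤s k≤K) tr r₁ r₂ e₁ e₂ ne =
        left K (c ⊕ -1ℤ) _ (suc t) (subst (_≤ K) (sym (toℕ-left c c≡)) k≤K)
          (subst (λ x → Traces (⟪_⟫ FP (before-step f (w c))) x (suc t)) (sym (left-right c)) tr)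
          (two-⟪⟫ (before-step f (w c)) r₁ r₂ e₁ e₂ ne)

      begin-left : (m : Image (candidate p (w b))) → image (candidate p (w b)) ≡ m → LeftResult (λ x → lsw₀ x p , b)
      begin-left (none u) eq = nothing , (λ x → _ , (refl , λ _ → cong (start x) eq) ∷ []) ,
        λ lab lr lp → ⊥-elim (u (lab b) (lab b) (candidate-complete p (w b) (lab b) (trans (sym (lr b)) lp)))
      begin-left (one r k e u) eq = just k ,
        (trans (cong (λ r → stepP r (w b)) (proj₁ (candidate-sound p (w b) r k e))) (proj₂ (candidate-sound p (w b) r k e)) ,
          λ x → subst (λ c → Detour (lsw₀ x p , b) (main x k , c)) (⊕-0 b) ((refl , λ _ → cong (start x) eq) ∷ [])) ,
        λ lab lr lp → cong just (sym (u (lab b) (lab b) (candidate-complete p (w b) (lab b) (trans (sym (lr b)) lp))))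
      begin-left (two r₁ r₂ e₁ e₂ ne) eq = prepend ((refl , λ _ → cong (start _) eq) ∷_) (sweep (b ⊕ -1ℤ) (left-right b))
        where
        sweep : ∀ c → c ⊕ 1ℤ ≡ b → LeftResult (λ x → lsw x (⟪_⟫ FP (candidate p (w b))) , c)
        sweep c e = left (toℕ c) c _ 0 ℕ.≤-refl (subst (λ x → Traces (⟪_⟫ FP (candidate p (w b))) x 0) (sym e) traces-here)
          (two-⟪⟫ (candidate p (w b)) r₁ r₂ e₁ e₂ ne)

      step-left : LeftResult (λ x → lsw₀ x p , b)
      step-left = begin-left (image (candidate p (w b))) refl

    hu : Position n → P → Maybe P
    hu b p = proj₁ (Target.step-left b p)

    hu-result : ∀ b p → Target.Result b p (hu b p) (λ x → lsw₀ x p , b)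
    hu-result b p = proj₁ (proj₂ (Target.step-left b p))

    hu-sound : ∀ b p r → hu b p ≡ just r → stepP r (w b) ≡ p
    hu-sound b p r e = proj₁ (subst (λ m → Target.Result b p m (λ x → lsw₀ x p , b)) e (hu-result b p))

    hu-true : ∀ (lab : Position n → P) → (∀ c → lab (c ⊕ 1ℤ) ≡ stepP (lab c) (w c)) →
              ∀ b → hu (b ⊕ -1ℤ) (lab b) ≡ just (lab (b ⊕ -1ℤ))
    hu-true lab lr b = proj₂ (proj₂ (Target.step-left (b ⊕ -1ℤ) (lab b))) lab lr (cong lab (left-right b))

  module TM = TourMachine fin-State₁ (main n₀ blank) acc₁ rej₁ disjoint₁ δ₁
  open TM using (machine; reversible; simple)

  module Simulation {n : ℕ} (w : Position n → Γ Σ) (w0 : w zero ≡ ¢)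
              (wN : ∀ (b : Position n) → toℕ b ≡ suc n → w b ≡ $) where

    open Detours w w0 wN hiding (Node)
    open Euler.Run fin-State₁ δ₁ (λ q _ → halted₁ q) w hiding (module Lap)
    open Bounded
    open Labelled stepP δN haltedN deadN w
    open Walking hu

    halts-dead : ∀ c → Halts (dead , c)
    halts-dead c = 0 , refl

    halts-detour : ∀ {v v′} → Detour v v′ → Halts v′ → Halts v
    halts-detour [] h = h
    halts-detour {q , b} (_∷_ {q′ = q′} {d} (_ , e) ds) h =
      halts-next q b (subst (λ x → Halts (proj₁ x , b ⊕ μ (proj₂ (proj₂ x)))) (sym (e 𝟏)) (halts-detour ds h))

    module _ (walks-halt : ∀ (y : Pseudo) → ∃ λ (k : ℕ) → haltedN (proj₁ (iter pf k y)) ≡ true) where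

      embed : Pseudo → State₁ × Position n
      embed (x , b , p) = main x p , b

      halts-result : ∀ b p m x → Target.Result b p m (λ x → lsw₀ x p , b) →
                     Halts (embed (relabelled m x b p)) → Halts (lsw₀ x p , b)
      halts-result b p (just r) x (_ , ds) h = halts-detour (ds x) h
      halts-result b p nothing  x ds h = halts-detour (proj₂ (ds x)) (halts-dead _)

      halts-move : ∀ o b p → Halts (embed (transit o b p)) →
                   Halts (proj₁ (go-main p (w b) o) , b ⊕ μ (proj₂ (proj₂ (go-main p (w b) o))))
      halts-move (x , c , ←) b p h = halts-result (b ⊕ -1ℤ) p (hu (b ⊕ -1ℤ) p) x (hu-result (b ⊕ -1ℤ) p) h
      halts-move (x , c , ↓) b p h = h
      halts-move (x , c , ⟶) b p h = h

      halts-main : ∀ k y → haltedN (proj₁ (iter pf k y)) ≡ true → Halts (embed y)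
      halts-main zero    (x , b , p) e = 0 , e
      halts-main (suc k) (x , b , p) e = go (haltedN x) refl
        where
        go : ∀ h → haltedN x ≡ h → Halts (main x p , b)
        go true  eq = 0 , eq
        go false eq = halts-next (main x p) b (halts-move (δN x p (w b) 𝟏) b p
          (subst (λ h → Halts (embed (transit (if h then (x , keep , ↓) else δN x p (w b) 𝟏) b p))) eq
            (halts-main k (pf (x , b , p)) e)))

      halts-main′ : ∀ x p b → Halts (main x p , b)
      halts-main′ x p b = let k , e = walks-halt (x , b , p) in halts-main k (x , b , p) e

      halts-fin : ∀ x p b → Halts (fin x p , b)
      halts-fin x p b = halts-next (fin x p) b (halts-main′ x p (b ⊕ -1ℤ))

      $-constant : ∀ b r₁ r₂ → toℕ b ≡ suc n → stepP r₁ (w b) ≡ stepP r₂ (w b)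
      $-constant b r₁ r₂ e = subst (λ σ → stepP r₁ σ ≡ stepP r₂ σ) (sym (wN b e)) (trans (step-$ r₁) (sym (step-$ r₂)))

      -- The two labels may be arbitrary here; at the latest `$` makes the runs merge.
      halts-rsw : ∀ K x r₁ r₂ k b → suc n ≤ toℕ b + K → Halts (rsw x r₁ r₂ k , b)
      halts-met : ∀ K x r₁ r₂ k b → suc n ≤ toℕ b + K → (d : Dec (stepP r₁ (w b) ≡ stepP r₂ (w b))) → Dec (suc (toℕ b) < 2 + n) →
                  Halts (proj₁ (sweep-right x k d) , b ⊕ μ (proj₂ (proj₂ (sweep-right x k d))))
      halts-rsw K x r₁ r₂ k b le = halts-next (rsw x r₁ r₂ k) b
        (halts-met K x r₁ r₂ k b le (stepP r₁ (w b) ≟P stepP r₂ (w b)) (suc (toℕ b) ℕ.<? 2 + n))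
      halts-met K x r₁ r₂ k b le (yes _) _ = halts-fin x k (b ⊕ 1ℤ)
      halts-met K x r₁ r₂ k b le (no ne) (no ¬lt) = ⊥-elim (ne ($-constant b r₁ r₂
        (ℕ.≤-antisym (ℕ.s≤s⁻¹ (Fin.toℕ<n b)) (ℕ.s≤s⁻¹ (ℕ.≮⇒≥ ¬lt)))))
      halts-met zero x r₁ r₂ k b le (no ne) (yes lt) = ⊥-elim (ℕ.<⇒≱ (ℕ.s<s⁻¹ lt) (ℕ.≤-trans le (ℕ.≤-reflexive (ℕ.+-identityʳ _))))
      halts-met (suc K) x r₁ r₂ k b le (no ne) (yes lt) = halts-rsw K x (stepP r₁ (w b)) (stepP r₂ (w b)) k (b ⊕ 1ℤ)
        (ℕ.≤-trans le (ℕ.≤-reflexive (trans (ℕ.+-suc (toℕ b) K) (cong (λ z → z + K) (sym (toℕ-right b lt))))))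

      halts-turn : ∀ {g} x k (m : Image g) b → Halts (proj₁ (turn-back x k m) , b ⊕ μ (proj₂ (proj₂ (turn-back x k m))))
      halts-turn x k (two r₁ r₂ _ _ _) b = halts-rsw (suc n) x r₁ r₂ k (b ⊕ 1ℤ) (ℕ.m≤n+m (suc n) _)
      halts-turn x k (one _ _ _ _) b = halts-dead _
      halts-turn x k (none _) b = halts-dead _

      halts-lsw : ∀ K x f b → toℕ b ≤ K → Halts (lsw x f , b)
      halts-left : ∀ K x f b → toℕ b ≤ K → (m : Image (before-step f (w b))) →
                   Halts (proj₁ (sweep-left x f m) , b ⊕ μ (proj₂ (proj₂ (sweep-left x f m))))
      halts-further : ∀ K k x f b → toℕ b ≡ k → k ≤ K → ∀ r₁ r₂ {j₁ j₂} → before-step f (w b) r₁ ≡ just j₁ →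
                      before-step f (w b) r₂ ≡ just j₂ → j₁ ≢ j₂ → ∀ f′ → Halts (lsw x f′ , b ⊕ -1ℤ)
      halts-lsw K x f b b≤K = halts-next (lsw x f) b (halts-left K x f b b≤K (image (before-step f (w b))))
      halts-left K x f b b≤K (none _) = halts-dead _
      halts-left K x f b b≤K (one _ k _ _) = halts-turn x k (image (app FP f)) b
      halts-left K x f b b≤K (two r₁ r₂ e₁ e₂ ne) = halts-further K (toℕ b) x f b refl b≤K r₁ r₂ e₁ e₂ ne _
      halts-further K zero x f b b≡ k≤ r₁ r₂ e₁ e₂ ne f′ =
        ⊥-elim (ne (just-injective (trans (sym e₁) (trans (Target.¢-constant b blank b f r₁ r₂ b≡) e₂))))
      halts-further (suc K) (suc k) x f b b≡ (s≤s k≤) r₁ r₂ e₁ e₂ ne f′ =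
        halts-lsw K x f′ (b ⊕ -1ℤ) (subst (_≤ K) (sym (toℕ-left b b≡)) k≤)

      halts-always : ∀ v → Halts v
      halts-always (main x p , b) = halts-main′ x p b
      halts-always (lsw₀ x p , b) = halts-result b p (hu b p) x (hu-result b p) (halts-embed (relabelled (hu b p) x b p))
        where
        halts-embed : ∀ y → Halts (embed y)
        halts-embed (x , b , p) = halts-main′ x p b
      halts-always (fin x p , b) = halts-fin x p b
      halts-always (lsw x f , b) = halts-lsw (toℕ b) x f b ℕ.≤-refl
      halts-always (rsw x r₁ r₂ k , b) = halts-rsw (suc n) x r₁ r₂ k b (ℕ.m≤n+m (suc n) _)
      halts-always (dead , b) = halts-dead b

      halting-acc₁ : ∀ κ → stop κ ≡ true → Acc _≺_ κ
      halting-acc₁ = halting-acc halts-always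

    module _ (lab : Position n → P) (lab-right : ∀ (c : Position n) → lab (c ⊕ 1ℤ) ≡ stepP (lab c) (w c)) where

      open Labelling lab

      labelled : NC → K
      labelled (x , a , b) = main x (lab b) , a , b

      reaches-detour : ∀ {z v v′ a} → Detour v v′ → Reaches z (proj₁ v′ , a , proj₂ v′) → Reaches z (proj₁ v , a , proj₂ v)
      reaches-detour [] r = r
      reaches-detour {z} {q , b} {v′} {a} (_∷_ {q′ = q′} {d} (h , e) ds) r = next h (subst (Reaches z) (sym eq) (reaches-detour ds r))
        where
        eq : mnext (q , a , b) ≡ (q′ , a , b ⊕ μ d)
        eq = trans (cong (λ o → proj₁ o , a ℤ.+ ⟦ proj₁ (proj₂ o) ⟧ , b ⊕ μ (proj₂ (proj₂ o))) (e (sign a)))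
          (cong (λ a → q′ , a , b ⊕ μ d) (ℤ.+-identityʳ a))

      applied : Out → ℤ → Position n → K
      applied (q , c , d) a b = q , a ℤ.+ ⟦ c ⟧ , b ⊕ μ d

      reaches-move : ∀ {z} o a b → Reaches z (labelled (perform o (a , b))) → Reaches z (applied (go-main (lab b) (w b) o) a b)
      reaches-move {z} (x , c , ⟶) a b r = subst (λ p → Reaches z (main x p , a ℤ.+ ⟦ c ⟧ , b ⊕ 1ℤ)) (lab-right b) r
      reaches-move {z} (x , c , ↓) a b r = subst (λ p → Reaches z (main x p , a ℤ.+ ⟦ c ⟧ , b ⊕ 0ℤ)) (cong lab (⊕-0 b)) r
      reaches-move {z} (x , c , ←) a b r = reaches-detour (proj₂ (subst (λ m → Target.Result (b ⊕ -1ℤ) (lab b) m (λ x → lsw₀ x (lab b) , b ⊕ -1ℤ))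
        (hu-true lab lab-right b) (hu-result (b ⊕ -1ℤ) (lab b))) x) r

      reaches-run : ∀ {y x} → x ⟹ y → haltedN (proj₁ y) ≡ true → Reaches (labelled y) (labelled x)
      reaches-run ε h = here refl h
      reaches-run {x = x , a , b} (e ◁ p) h = next e (reaches-move (δN x (lab b) (w b) (sign a)) a b (reaches-run p h))

  -- What a machine with labels must satisfy before its left moves are implemented. `hu` is
  -- abstract: walks have to halt from any label under any fitting choice of labels, while the run
  -- may assume that true labels stay true.
  record Verdict (G : N → Bool) (xs : List Σ) : Set where
    w : Position (length xs) → Γ Σ
    w = Vec.lookup (tape xs)
    open Labelled stepP δN haltedN deadN w
    field
      lab       : Position (length xs) → P
      lab-zero  : lab zero ≡ blank
      lab-right : ∀ c → lab (c ⊕ 1ℤ) ≡ stepP (lab c) (w c)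
    open Labelling lab
    field
      walks-halt : ∀ (hu : Position (length xs) → P → Maybe P) → (∀ b p r → hu b p ≡ just r → stepP r (w b) ≡ p) →
                   (y : Walking.Pseudo hu) → ∃ λ k → haltedN (proj₁ (iter (Walking.pf hu) k y)) ≡ true
      run        : ∀ (hu : Position (length xs) → P → Maybe P) → (∀ b p r → hu b p ≡ just r → stepP r (w b) ≡ p) →
                   (∀ b → hu (b ⊕ -1ℤ) (lab b) ≡ just (lab (b ⊕ -1ℤ))) →
                   ∃ λ y → (n₀ , 0ℤ , zero) ⟹ y × G (proj₁ y) ≡ true

  certainly : ∀ {G} xs (G₁ : State₁ → Bool) → (∀ x → G x ≡ true → haltedN x ≡ true) → (∀ x p → G₁ (main x p) ≡ G x) →
              (∀ t → TM.halting t ≡ false → TM.on-try G₁ t ≡ false) →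
              Verdict G xs → 2Q1CA.probUpTo machine xs (TM.on-try G₁) ConvergesTo 1ℚ
  certainly {G} xs G₁ G-halts G₁-main G₁-halting v = conclude (run hu hu-sound (hu-true lab lab-right))
    where
    open Verdict v
    open Detours w refl (tape-last xs) using (hu; hu-sound; hu-true)
    open Labelled.Labelling stepP δN haltedN deadN w lab
    conclude : (∃ λ y → (n₀ , 0ℤ , zero) ⟹ y × G (proj₁ y) ≡ true) → 2Q1CA.probUpTo machine xs (TM.on-try G₁) ConvergesTo 1ℚ
    conclude (y , r , e) = TM.certain xs (TM.on-try G₁) G₁-halting
      (Simulation.halting-acc₁ w refl (tape-last xs) (walks-halt hu hu-sound) (main (proj₁ y) (lab (proj₂ (proj₂ y))) , proj₂ y) (G-halts (proj₁ y) e))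
      (subst (λ p → Euler.Run.Reaches fin-State₁ δ₁ (λ q _ → halted₁ q) w (main (proj₁ y) (lab (proj₂ (proj₂ y))) , proj₂ y) (main n₀ p , 0ℤ , zero)) lab-zero
        (Simulation.reaches-run w refl (tape-last xs) lab lab-right r (G-halts (proj₁ y) e)))
      (λ j → trans (G₁-main _ _) e)

  solution : ∀ {ℓ : Level} (L : Pred (List Σ) ℓ) →
             (∀ xs → (L xs → Verdict accN xs) × (¬ L xs → Verdict rejN xs)) →
             ∃ λ (M′ : 2Q1CA Σ) → Is2R1CA M′ × Simple M′ × 2Q1CA.RecognizesWithoutError M′ L
  solution L verdicts = machine , reversible , simple , λ xs →
    (λ l → certainly xs acc₁ (λ x e → cong (_∨ rejN x) e) (λ x p → refl) (λ t → ∨-falseˡ) (proj₁ (verdicts xs) l)) ,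
    (λ ¬l → certainly xs rej₁ (λ x e → trans (cong (accN x ∨_) e) (Bool.∨-zeroʳ (accN x))) (λ x p → refl)
      (λ t → ∨-falseʳ (TM.on-try acc₁ t)) (proj₂ (verdicts xs) ¬l))
    where
    ∨-falseˡ : ∀ {a b} → a ∨ b ≡ false → a ≡ false
    ∨-falseˡ {false} _ = refl
    ∨-falseʳ : ∀ a {b} → a ∨ b ≡ false → b ≡ false
    ∨-falseʳ false e = e

-- The machine that tours the excursions

module Reversal {Σ Q : Set} (finite : Finite Q) (q₀ : Q) (acc rej : Q → Bool)
  (disjoint : ∀ (q : Q) → ¬ (T (acc q) × T (rej q))) (δ : Q → Γ Σ → S → Q × Change × Direction) where

  halted : Q → Bool
  halted q = acc q ∨ rej q

  open Euler finite δ (zeroOr halted)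
  open Labels fin-State (λ σ → V σ 𝟏) (λ σ → V⁻¹ σ 𝟏) (λ σ → V⁻¹∘V σ 𝟏) D hiding (run; f)

  Mem : Set
  Mem = fin-State ⇒ Bool

  ∅ : Mem
  ∅ = ⟪_⟫ fin-State λ _ → false

  _∈?_ : State → Mem → Bool
  t ∈? M = app fin-State M t

  insert : State → Mem → Mem
  insert t M = M Vec.[ index fin-State t ]≔ true

  ∈-∅ : ∀ t → t ∈? ∅ ≡ false
  ∈-∅ t = app-⟪⟫ fin-State _ t

  ∈-insert : ∀ t M → t ∈? insert t M ≡ true
  ∈-insert t M = Vec.lookup∘update (index fin-State t) M true

  same-index? : ∀ t t′ → Dec (index fin-State t ≡ index fin-State t′)
  same-index? t t′ = index fin-State t Fin.≟ index fin-State t′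

  ∈-insert-keep : ∀ t t′ M → t ∈? M ≡ true → t ∈? insert t′ M ≡ true
  ∈-insert-keep t t′ M e = go (same-index? t t′)
    where
    go : Dec (index fin-State t ≡ index fin-State t′) → t ∈? insert t′ M ≡ true
    go (yes e′) = trans (cong (λ k → Vec.lookup (insert t′ M) k) e′) (∈-insert t′ M)
    go (no ¬e) = trans (Vec.lookup∘update′ ¬e M true) e

  ∈-insert⁻ : ∀ t t′ M → t ∈? insert t′ M ≡ true → t ≡ t′ ⊎ t ∈? M ≡ true
  ∈-insert⁻ t t′ M e = go (same-index? t t′)
    where
    go : Dec (index fin-State t ≡ index fin-State t′) → t ≡ t′ ⊎ t ∈? M ≡ true
    go (yes e′) = inj₁ (index-injective fin-State e′)
    go (no ¬e) = inj₂ (trans (sym (Vec.lookup∘update′ ¬e M true)) e)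

  -- zeroN performs one step of the given machine from counter zero; fwd and bwd
  -- run the tour and its inverse towards the next stop, with the set of states
  -- in which a node has fired since the counter was last zero; pre is the
  -- inverse tour between its movement and its transition.
  data NState : Set where
    zeroN       : Q → NState
    fwd pre bwd : State → Mem → NState
    dead        : NState

  fin-NState : Finite NState
  fin-NState = fin-map (mk↔ₛ′
    (λ { (zeroN q) → inj₁ (inj₁ q) ; dead → inj₁ (inj₂ tt)
       ; (fwd t M) → inj₂ (inj₁ (t , M)) ; (pre t M) → inj₂ (inj₂ (inj₁ (t , M))) ; (bwd t M) → inj₂ (inj₂ (inj₂ (t , M))) })
    (λ { (inj₁ (inj₁ q)) → zeroN q ; (inj₁ (inj₂ _)) → dead
       ; (inj₂ (inj₁ (t , M))) → fwd t M ; (inj₂ (inj₂ (inj₁ (t , M)))) → pre t M ; (inj₂ (inj₂ (inj₂ (t , M)))) → bwd t M })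
    (λ { (inj₁ (inj₁ q)) → refl ; (inj₁ (inj₂ _)) → refl
       ; (inj₂ (inj₁ (t , M))) → refl ; (inj₂ (inj₂ (inj₁ (t , M)))) → refl ; (inj₂ (inj₂ (inj₂ (t , M)))) → refl })
    (λ { (zeroN q) → refl ; dead → refl ; (fwd t M) → refl ; (pre t M) → refl ; (bwd t M) → refl }))
    (fin-⊎ (fin-⊎ finite fin-⊤) (fin-⊎ finTM (fin-⊎ finTM finTM)))
    where
    finTM : Finite (State × Mem)
    finTM = fin-× fin-State (fin-Vec fin-Bool (Finite.size fin-State))

  fin-Label : Finite Label
  fin-Label = fin-Vec (fin-Maybe fin-State) (Finite.size fin-State)

  accN rejN haltedN : NState → Bool
  accN (zeroN q) = acc q
  accN _ = false
  rejN (zeroN q) = rej q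
  rejN dead = true
  rejN _ = false
  haltedN x = accN x ∨ rejN x

  stopAt : State → S → Maybe Q
  stopAt (try q j) s = if zeroOr halted q s then just q else nothing
  stopAt (arr q k) s = nothing

  advance : Γ Σ → S → State → Mem → NState × Change × Direction
  advance σ s t M = fwd (V σ s t) M , C (V σ s t) , D (V σ s t)

  -- The inverse tour must move before it can read the symbol and the sign that its inverse
  -- transition depends on; hence the intermediate state `pre`.
  retract : State → Mem → NState × Change × Direction
  retract t M = pre t M , negate (C t) , opposite (D t)

  forward : Maybe Q → S → Bool → Bool → Γ Σ → State → Mem → NState × Change × Direction
  forward (just q) _ _     _     σ t M = zeroN q , keep , ↓
  -- At counter zero the memory starts afresh: a repetition is conclusive only within a stretch of
  -- nonzero counter, as in `lap`.
  forward nothing  𝟎 _     _     σ t M = advance σ 𝟎 t ∅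
  forward nothing  𝟏 false _     σ t M = advance σ 𝟏 t M
  forward nothing  𝟏 true  false σ t M = advance σ 𝟏 t (insert t M)
  forward nothing  𝟏 true  true  σ t M = retract t ∅

  backward : Maybe Q → S → Bool → Bool → State → Mem → NState × Change × Direction
  backward (just q) _ _     _     t M = zeroN q , keep , ↓
  backward nothing  𝟎 _     _     t M = retract t ∅
  backward nothing  𝟏 false _     t M = retract t M
  backward nothing  𝟏 true  false t M = retract t (insert t M)
  backward nothing  𝟏 true  true  t M = dead , keep , ↓

  δN : NState → Label → Γ Σ → S → NState × Change × Direction
  -- The tour is entered as if the slot of the old configuration had just been dealt with. At
  -- counter zero that configuration is stopped and no child, so on the tour this is the cursor
  -- after a skipped slot.
  δN (zeroN q) p σ s = fwd (try (proj₁ (up σ s q)) (suc (proj₂ (up σ s q)))) ∅ , proj₂ (δ q σ s)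
  δN (fwd t M) p σ s = forward (stopAt t s) s (fire σ p t) (t ∈? M) σ t M
  δN (pre t M) p σ s = bwd (V⁻¹ σ s t) M , keep , ↓
  δN (bwd t M) p σ s = backward (stopAt t s) s (fire σ p t) (t ∈? M) t M
  δN dead      p σ s = dead , keep , ↓

  top : ℕ
  top = suc (Finite.size fin-State)

  -- At nonzero counter, insertions and changes of phase increase the rank. `top` exceeds every
  -- `count`, so turning around outweighs emptying the memory.
  rank : NState → ℕ
  rank (zeroN q) = 0
  rank (fwd t M) = 1 + count M
  rank (pre t M) = 1 + (top + count M)
  rank (bwd t M) = 1 + (top + count M)
  rank dead      = 1 + (top + top)

  disjointN : ∀ x → ¬ (T (accN x) × T (rejN x))
  disjointN (zeroN q) = disjoint q

  module OnTape {n : ℕ} (w : Position n → Γ Σ) (w0 : w zero ≡ ¢)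
    (w¢ : ∀ (b : Position n) → w b ≡ ¢ → b ≡ zero) (w$ : ∀ (b : Position n) → w b ≡ $ → toℕ b ≡ suc n)
    (wN : ∀ (b : Position n) → toℕ b ≡ suc n → w b ≡ $) where

    open Run w hiding (module Bounded)
    open Lap
    open Tape w w0 w¢ w$ wN
    open Labelled step δN haltedN dead w
    open Labelling lab

    -- One of the two directions reaches the next stop

    module Path where

      Node : Set
      Node = Q × Position n

      fin-Node : Finite Node
      fin-Node = fin-× finite (fin-Fin (2 + n))

      node : K → Node
      node (q , a , b) = q , b

      g : Node → Node
      g (q , b) = proj₁ (δ q (w b) 𝟏) , b ⊕ μ (proj₂ (proj₂ (δ q (w b) 𝟏)))

      slot𝟏 : Node → Fin m
      slot𝟏 (q , b) = proj₂ (up (w b) 𝟏 q)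

      node-mnext : ∀ κ → stop κ ≡ false → node (mnext κ) ≡ g (node κ)
      node-mnext (q , a , b) e rewrite zeroOr-𝟏 {q = q} (sign a) e = refl

      slot-node : ∀ κ → stop κ ≡ false → slot κ ≡ slot𝟏 (node κ)
      slot-node (q , a , b) e rewrite zeroOr-𝟏 {q = q} (sign a) e = refl

      Periodic : Node → Set
      Periodic v = ∃ λ p → iter g (suc p) v ≡ v

      periodic-g : ∀ {v} → Periodic v → Periodic (g v)
      periodic-g {v} (p , e) = p , trans (iter-suc g p (g v)) (cong g e)

      -- A common multiple of both periods brings each point back, after the first step along a
      -- common orbit.
      periodic-unique : ∀ {u v} → Periodic u → Periodic v → g u ≡ g v → u ≡ v
      periodic-unique {u} {v} (p , e) (p′ , e′) guv = begin
        u                              ≡⟨ iter-* g (suc p′) (suc p) u e ⟨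
        iter g (suc p′ * suc p) u      ≡⟨ cong (iter g (p + p′ * suc p)) guv ⟩
        iter g (suc p′ * suc p) v      ≡⟨ cong (λ k → iter g k v) (ℕ.*-comm (suc p′) (suc p)) ⟩
        iter g (suc p * suc p′) v      ≡⟨ iter-* g (suc p) (suc p′) v e′ ⟩
        v                              ∎
        where open ≡-Reasoning

      depth : ℕ
      depth = Finite.size fin-Node

      -- After as many steps as there are nodes, an orbit has entered its cycle.
      periodic-deep : ∀ v → Periodic (iter g depth v)
      periodic-deep v with pigeonhole fin-Node (λ k → iter g k v)
      ... | k , l , k<l , l≤d , e = l ∸ suc k , (begin
        iter g (suc c) (iter g depth v)            ≡⟨ iter-+ g depth (suc c) v ⟨
        iter g (depth + suc c) v                   ≡⟨ cong (λ k → iter g k v) arith ⟩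
        iter g (l + (depth ∸ k)) v                 ≡⟨ iter-+ g l (depth ∸ k) v ⟩
        iter g (depth ∸ k) (iter g l v)            ≡⟨ cong (iter g (depth ∸ k)) e ⟨
        iter g (depth ∸ k) (iter g k v)            ≡⟨ iter-+ g k (depth ∸ k) v ⟨
        iter g (k + (depth ∸ k)) v                 ≡⟨ cong (λ k → iter g k v) (ℕ.m+[n∸m]≡n k≤d) ⟩
        iter g depth v                             ∎)
        where
        open ≡-Reasoning
        c = l ∸ suc k
        k≤d : k ≤ depth
        k≤d = ℕ.≤-trans (ℕ.<⇒≤ k<l) l≤d
        arith : depth + suc c ≡ l + (depth ∸ k)
        arith = begin
          depth + suc c                    ≡⟨ cong (λ x → x + suc c) (ℕ.m∸n+n≡m k≤d) ⟨
          depth ∸ k + k + suc c            ≡⟨ ℕ.+-assoc (depth ∸ k) k (suc c) ⟩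
          depth ∸ k + (k + suc c)          ≡⟨ cong (λ x → depth ∸ k + x) (ℕ.+-suc k c) ⟩
          depth ∸ k + (suc k + c)          ≡⟨ cong (λ x → depth ∸ k + x) (ℕ.m+[n∸m]≡n k<l) ⟩
          depth ∸ k + l                    ≡⟨ ℕ.+-comm (depth ∸ k) l ⟩
          l + (depth ∸ k)                  ∎

      data Chain : ℕ → K → Set where
        [_]   : ∀ κ → Chain zero κ
        _⟨_∷⟩ : ∀ {f κ κ′} → Chain f κ′ → stop κ′ ≡ false × mnext κ′ ≡ κ → Chain (suc f) κ

      chain-node : ∀ {f κ} → Chain f κ → ∃ λ v → node κ ≡ iter g f v
      chain-node [ κ ] = node κ , refl
      chain-node {suc f} (_⟨_∷⟩ {κ′ = κ′} c (e , refl)) with chain-node c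
      ... | v , e′ = v , trans (node-mnext κ′ e) (trans (cong g e′) (sym (iter-suc g f v)))

      Deep : K → Fin m → Set
      Deep κ k = IsChild κ k × Chain depth (ch κ k)

      deep-periodic : ∀ κ {k} → Deep κ k → Periodic (node (ch κ k))
      deep-periodic κ (_ , c) with chain-node c
      ... | v , e = subst Periodic (sym e) (periodic-deep v)

      mutual
        -- Bounded depth replaces infinite depth: a subtree whose tour is not finished by depth `f`
        -- yields a chain of that length, and length `depth` already forces a cycle.
        sub : ∀ f κ → stop κ ≡ false → (at κ zero ↝ at κ (fromℕ m)) ⊎ Chain f κ
        sub zero    κ e = inj₂ [ κ ]
        sub (suc f) κ e with after f κ e zero
        ... | inj₁ p = inj₁ p
        ... | inj₂ (k , _ , r , c) = inj₂ (c ⟨ child-stop κ k r , child-mnext κ k r ∷⟩)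

        trying : ∀ f κ k → stop κ ≡ false →
                 (at κ (inject₁ k) ↝ at κ (suc k)) ⊎ (IsChild κ k × Chain f (ch κ k))
        trying f κ k e with isChild? κ k
        ... | no ¬r = inj₁ (skip κ k e ¬r)
        ... | yes r with sub f (ch κ k) (child-stop κ k r)
        ...   | inj₁ p = inj₁ (visit κ k e r p)
        ...   | inj₂ c = inj₂ (r , c)

        after : ∀ f κ → stop κ ≡ false → ∀ j → (at κ j ↝ at κ (fromℕ m)) ⊎
                (∃ λ k → toℕ j ≤ toℕ k × IsChild κ k × Chain f (ch κ k))
        after f κ e = Fin.>-weakInduction (λ j → (at κ j ↝ at κ (fromℕ m)) ⊎
                (∃ λ k → toℕ j ≤ toℕ k × IsChild κ k × Chain f (ch κ k))) (inj₁ ε) widened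
          where
          widened : ∀ k → _ → _
          widened k (inj₂ (k′ , k<k′ , d)) = inj₂ (k′ , ℕ.≤-trans (ℕ.≤-reflexive (Fin.toℕ-inject₁ k)) (ℕ.<⇒≤ k<k′) , d)
          widened k (inj₁ p) with trying f κ k e
          ... | inj₁ q = inj₁ (q ◅◅ p)
          ... | inj₂ d = inj₂ (k , ℕ.≤-reflexive (Fin.toℕ-inject₁ k) , d)

      before : ∀ f κ → stop κ ≡ false → ∀ j → (at κ zero ↝ at κ j) ⊎
               (∃ λ k → toℕ k < toℕ j × IsChild κ k × Chain f (ch κ k))
      before f κ e = Fin.<-weakInduction (λ j → (at κ zero ↝ at κ j) ⊎
               (∃ λ k → toℕ k < toℕ j × IsChild κ k × Chain f (ch κ k))) (inj₁ ε) widened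
        where
        widened : ∀ k → _ → _
        widened k (inj₂ (k′ , k′<k , d)) = inj₂ (k′ , ℕ.<-trans k′<k (s≤s (ℕ.≤-reflexive (Fin.toℕ-inject₁ k))) , d)
        widened k (inj₁ p) with trying f κ k e
        ... | inj₁ q = inj₁ (p ◅◅ q)
        ... | inj₂ d = inj₂ (k , ℕ.≤-refl , d)

      -- A deep child lies on a cycle of g, and its parent has only one such child.
      periodic-sibling : ∀ κ {k k′} → IsChild κ k → IsChild κ k′ →
                         Periodic (node (ch κ k)) → Periodic (node (ch κ k′)) → k ≡ k′
      periodic-sibling κ {k} {k′} r r′ p p′ = begin
        k                          ≡⟨ child-slot κ k r ⟨
        slot (ch κ k)              ≡⟨ slot-node (ch κ k) (child-stop κ k r) ⟩
        slot𝟏 (node (ch κ k))      ≡⟨ cong slot𝟏 (periodic-unique p p′ (trans (parent k r) (sym (parent k′ r′)))) ⟩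
        slot𝟏 (node (ch κ k′))     ≡⟨ slot-node (ch κ k′) (child-stop κ k′ r′) ⟨
        slot (ch κ k′)             ≡⟨ child-slot κ k′ r′ ⟩
        k′                         ∎
        where
        open ≡-Reasoning
        parent : ∀ k → IsChild κ k → g (node (ch κ k)) ≡ node κ
        parent k r = trans (sym (node-mnext (ch κ k) (child-stop κ k r))) (cong node (child-mnext κ k r))

      -- `Backward` is the inverse tour from the slot to `y`, written as the tour from `y` to the
      -- slot.
      Forward Backward : K → K → Fin m → Set
      Forward  y κ k = ∃ λ j → at κ (suc k) ↝ at y j
      Backward y κ k = ∃ λ j → rstep (at y j) ↝ trial κ k

      forward-next : ∀ {y κ k} → stop κ ≡ false → at κ (suc k) ↝ at κ (fromℕ m) →
                     Forward y (mnext κ) (slot κ) → Forward y κ k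
      forward-next {κ = κ} e p (j , q) = j , p ◅◅ climb κ e ◅◅ q

      backward-here : ∀ {κ} k → Backward κ κ k
      backward-here {κ} k = inject₁ k , subst (rstep (at κ (inject₁ k)) ↝_) (rstep-down κ k) ε

      backward-next : ∀ {y κ k} → stop κ ≡ false → at κ zero ↝ at κ (inject₁ k) →
                      Backward y (mnext κ) (slot κ) → Backward y κ k
      backward-next {κ = κ} {k} e p (j , q) = j , q ◅◅
        one refl (trans (rstep-enter (mnext κ) (slot κ) (slot-isChild κ e)) (cong (λ κ → at κ zero) (ch-slot κ)))
        ◅◅ p ◅◅ one e (rstep-down κ k)

      slot-periodic : ∀ κ → Periodic (node κ) → Periodic (node (ch (mnext κ) (slot κ)))
      slot-periodic κ = subst (Periodic ∘ node) (sym (ch-slot κ))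

      periodic-parent : ∀ κ k → IsChild κ k → Periodic (node (ch κ k)) → Periodic (node κ)
      periodic-parent κ k r p = subst Periodic
        (trans (sym (node-mnext (ch κ k) (child-stop κ k r))) (cong node (child-mnext κ k r))) (periodic-g p)

      -- A path that is on a cycle of `g` stays on it all the way up. At each ancestor the child on
      -- the path is then the only one that can be deep, and the siblings on either side are toured
      -- in finite time.
      both : ∀ {y κ} → Reaches y κ → ∀ k → IsChild κ k → Periodic (node (ch κ k)) →
             Forward y κ k × Backward y κ k
      both (here refl _) k _ _ = (suc k , ε) , backward-here k
      both {κ = κ} (next e p) k r per
        with both p (slot κ) (slot-isChild κ e) (slot-periodic κ (periodic-parent κ k r per))
           | after depth κ e (suc k) | before depth κ e (inject₁ k)
      ... | f , b | inj₁ q | inj₁ q′ = forward-next e q f , backward-next e q′ b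
      ... | _ | inj₂ (k′ , k<k′ , d) | _ =
        ⊥-elim (ℕ.<⇒≢ k<k′ (cong toℕ (periodic-sibling κ r (proj₁ d) per (deep-periodic κ d))))
      ... | _ | inj₁ _ | inj₂ (k′ , k′<k , d) =
        ⊥-elim (ℕ.<⇒≢ (ℕ.<-≤-trans k′<k (ℕ.≤-reflexive (Fin.toℕ-inject₁ k)))
          (cong toℕ (periodic-sibling κ (proj₁ d) r (deep-periodic κ d) per)))

      -- Siblings on both sides of slot `k` cannot be deep. If one is, its parent lies on a cycle,
      -- the shallow side is taken, and `both` clears the rest of the path.
      either : ∀ {y κ} → Reaches y κ → ∀ k → Forward y κ k ⊎ Backward y κ k
      either (here refl _) k = inj₁ (suc k , ε)
      either {κ = κ} (next e p) k with after depth κ e (suc k) | before depth κ e (inject₁ k)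
      ... | inj₂ (k₁ , k<k₁ , d₁) | inj₂ (k₂ , k₂<k , d₂) =
        ⊥-elim (ℕ.<⇒≢ (ℕ.<-trans (ℕ.<-≤-trans k₂<k (ℕ.≤-reflexive (Fin.toℕ-inject₁ k))) k<k₁)
          (cong toℕ (periodic-sibling κ (proj₁ d₂) (proj₁ d₁) (deep-periodic κ d₂) (deep-periodic κ d₁))))
      ... | inj₂ (k′ , _ , d) | inj₁ q =
        inj₂ (backward-next e q (proj₂ (both p (slot κ) (slot-isChild κ e)
          (slot-periodic κ (periodic-parent κ k′ (proj₁ d) (deep-periodic κ d))))))
      ... | inj₁ q | inj₂ (k′ , _ , d) =
        inj₁ (forward-next e q (proj₁ (both p (slot κ) (slot-isChild κ e)
          (slot-periodic κ (periodic-parent κ k′ (proj₁ d) (deep-periodic κ d))))))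
      ... | inj₁ q | inj₁ q′ with either p (slot κ)
      ...   | inj₁ f = inj₁ (forward-next e q f)
      ...   | inj₂ b = inj₂ (backward-next e q′ b)

    -- Termination at nonzero counter, for arbitrary labels

    module Terminates (hu : Position n → Label → Maybe Label)
      (hu-sound : ∀ (b : Position n) (p r : Label) → hu b p ≡ just r → step r (w b) ≡ p) where

      open Walking hu

      fin-Pseudo : Finite Pseudo
      fin-Pseudo = fin-× fin-NState (fin-× (fin-Fin (2 + n)) fin-Label)

      Halted : Pseudo → Set
      Halted (n , _) = haltedN n ≡ true

      halted? : ∀ x → Dec (Halted x)
      halted? (n , _) = haltedN n Bool.≟ true

      rankP : Pseudo → ℕ
      rankP (n , _) = rank n

      data Arrived (n′ : NState) (b : Position n) (p : Label) (d : Direction) : Pseudo → Set where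
        died    : ∀ {b′ p′} → Arrived n′ b p d (dead , b′ , p′)
        arrived : ∀ {p′} → (∀ {b″} → b″ ≡ b ⊕ μ d → Relabel d p (w b) p′ (w b″)) → Arrived n′ b p d (n′ , b ⊕ μ d , p′)

      arrive-view : ∀ n′ d b p → Arrived n′ b p d (arrive n′ d b p)
      arrive-view n′ ↓ b p = arrived λ _ → refl
      arrive-view n′ ⟶ b p = arrived λ _ → refl
      arrive-view n′ ← b p = go (hu (b ⊕ -1ℤ) p) refl
        where
        go : ∀ x → hu (b ⊕ -1ℤ) p ≡ x → Arrived n′ b p ← (relabelled x n′ (b ⊕ -1ℤ) p)
        go (just r) e  = arrived λ { refl → hu-sound _ p r e }
        go nothing _ = died

      retract-rank : ∀ (M M′ : Mem) → 1 + count M < 1 + (top + count M′)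
      retract-rank M M′ = s≤s (ℕ.≤-trans (s≤s (count≤n M)) (ℕ.m≤m+n top (count M′)))

      data Progress : NState → Label → Γ Σ → NState × Change × Direction → Set where
        grows : ∀ {x p σ n′ c d} → rank x < rank n′ → Progress x p σ (n′ , c , d)
        halts : ∀ {x p σ q c d} → halted q ≡ true → Progress x p σ (zeroN q , c , d)
        ahead : ∀ {p σ t M} → fire σ p t ≡ false → Progress (fwd t M) p σ (advance σ 𝟏 t M)
        aback : ∀ {p σ t M} → fire σ p t ≡ false → Progress (bwd t M) p σ (retract t M)
        turn  : ∀ {p σ t M} → Progress (pre t M) p σ (bwd (V⁻¹ σ 𝟏 t) M , keep , ↓)

      stopAt-𝟏 : ∀ t {q} → stopAt t 𝟏 ≡ just q → halted q ≡ true
      stopAt-𝟏 (try q j) e with halted q in e′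
      stopAt-𝟏 (try q j) refl | true = e′

      forward-progress : ∀ {t M p σ} o x y → stopAt t 𝟏 ≡ o → fire σ p t ≡ x → t ∈? M ≡ y →
                         Progress (fwd t M) p σ (forward o 𝟏 x y σ t M)
      forward-progress {t} (just q) x y e₁ e₂ e₃ = halts (stopAt-𝟏 t e₁)
      forward-progress nothing false y e₁ e₂ e₃ = ahead e₂
      forward-progress {M = M} nothing true false e₁ e₂ e₃ = grows (s≤s (ℕ.≤-reflexive (sym (count-insert M _ e₃))))
      forward-progress {M = M} nothing true true e₁ e₂ e₃ = grows (retract-rank M ∅)

      backward-progress : ∀ {t M p σ} o x y → stopAt t 𝟏 ≡ o → fire σ p t ≡ x → t ∈? M ≡ y →
                          Progress (bwd t M) p σ (backward o 𝟏 x y t M)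
      backward-progress {t} (just q) x y e₁ e₂ e₃ = halts (stopAt-𝟏 t e₁)
      backward-progress nothing false y e₁ e₂ e₃ = aback e₂
      backward-progress {M = M} nothing true false e₁ e₂ e₃ =
        grows (s≤s (ℕ.+-monoʳ-< top (ℕ.≤-reflexive (sym (count-insert M _ e₃)))))
      backward-progress {M = M} nothing true true e₁ e₂ e₃ = grows (s≤s (ℕ.+-monoʳ-< top (s≤s (count≤n M))))

      progress : ∀ x p σ → haltedN x ≡ false → Progress x p σ (δN x p σ 𝟏)
      progress (zeroN q) p σ _ = grows (s≤s z≤n)
      progress (fwd t M) p σ _ = forward-progress (stopAt t 𝟏) (fire σ p t) (t ∈? M) refl refl refl
      progress (pre t M) p σ _ = turn
      progress (bwd t M) p σ _ = backward-progress (stopAt t 𝟏) (fire σ p t) (t ∈? M) refl refl refl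

      data QuietStep : Pseudo → Pseudo → Set where
        ahead : ∀ {t M b p t′ b′ p′} → Quiet (t , b , p) → LStep (t , b , p) (t′ , b′ , p′) →
                QuietStep (fwd t M , b , p) (fwd t′ M , b′ , p′)
        aback : ∀ {t M b p b′ p′} → Quiet (t , b , p) → b′ ≡ b ⊕ μ (opposite (D t)) →
                Relabel (opposite (D t)) p (w b) p′ (w b′) → QuietStep (bwd t M , b , p) (pre t M , b′ , p′)
        turn  : ∀ {t M b p} → QuietStep (pre t M , b , p) (bwd (V⁻¹ (w b) 𝟏 t) M , b , p)

      data Next (x : Pseudo) : Pseudo → Set where
        grows : ∀ {y} → rankP x < rankP y → Next x y
        halts : ∀ {y} → Halted y → Next x y
        quiet : ∀ {y} → QuietStep x y → Next x y

      next-from : ∀ {x b p n′ c d y} → Progress x p (w b) (n′ , c , d) → Arrived n′ b p d y → Next (x , b , p) y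
      next-from _ died = halts refl
      next-from (grows lt) (arrived _) = grows lt
      next-from (halts h) (arrived _) = halts h
      next-from (ahead q) (arrived r) = quiet (ahead q (refl , r refl))
      next-from (aback q) (arrived r) = quiet (aback q refl (r refl))
      next-from {b = b} {p} (turn {t = t} {M}) (arrived r) = quiet (subst₂
        (λ b′ p′ → QuietStep (pre t M , b , p) (bwd (V⁻¹ (w b) 𝟏 t) M , b′ , p′)) (sym (⊕-0 b)) (sym (r refl)) turn)

      next-view : ∀ x → ¬ Halted x → Next x (pf x)
      next-view (x , b , p) ¬h = subst (λ h → Next (x , b , p) (transit (if h then (x , keep , ↓) else δN x p (w b) 𝟏) b p))
        (sym (Bool.¬-not ¬h)) (next-from (progress x p (w b) (Bool.¬-not ¬h)) (arrive-view _ _ b p))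

      data QuietRun : ℕ → Pseudo → Pseudo → Set where
        []  : ∀ {x} → QuietRun 0 x x
        _∷_ : ∀ {k x y z} → QuietStep x y → QuietRun k y z → QuietRun (suc k) x z

      _∷ʳ_ : ∀ {k x y z} → QuietRun k x y → QuietStep y z → QuietRun (suc k) x z
      []       ∷ʳ q′ = q′ ∷ []
      (q ∷ qs) ∷ʳ q′ = q ∷ (qs ∷ʳ q′)

      run-iter : ∀ k x → (∀ u → QuietStep (iter pf u x) (iter pf (suc u) x)) → QuietRun k x (iter pf k x)
      run-iter zero    x qs = []
      run-iter (suc k) x qs = qs 0 ∷ run-iter k (pf x) (λ u → qs (suc u))

      FwdWalk : ℕ → Pseudo → Z → Set
      FwdWalk k y z = ∃₂ λ t M → ∃₂ λ b p → y ≡ (fwd t M , b , p) × Walk (suc n) k z (t , b , p)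

      fwd-cons : ∀ {k y z z′} → Quiet z → LStep z z′ → FwdWalk k y z′ → FwdWalk (suc k) y z
      fwd-cons {z = s , b , p} q l (t′ , M′ , b′ , p′ , e , W) = t′ , M′ , b′ , p′ , e , ((ℕ.s≤s⁻¹ (Fin.toℕ<n b) , q) , l) ∷ W

      fwd-walk : ∀ {k t M b p y} → QuietRun k (fwd t M , b , p) y → FwdWalk k y (t , b , p)
      fwd-walk [] = _ , _ , _ , _ , refl , []
      fwd-walk (ahead q l ∷ qs) = fwd-cons q l (fwd-walk qs)

      -- `Relabel` is symmetric under exchanging source and target together with reversing the
      -- direction, so a backward move read in reverse is a step of a labelled walk.
      reverse-step : ∀ {t b p b′ p′} → b′ ≡ b ⊕ μ (opposite (D t)) → Relabel (opposite (D t)) p (w b) p′ (w b′) →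
                     LStep (V⁻¹ (w b′) 𝟏 t , b′ , p′) (t , b , p)
      reverse-step {t} {b} {p} {b′} {p′} refl r = sym e , relabel (D t) r
        where
        e : ρ (V⁻¹ (w b′) 𝟏 t , b′) ≡ (t , b)
        e rewrite V∘V⁻¹ (w b′) 𝟏 t | μ-opposite (D t) = cong (t ,_) (⊖-⊕ b (D t))
        relabel : ∀ d → Relabel (opposite d) p (w b) p′ (w b′) → Relabel d p′ (w b′) p (w b)
        relabel ← r = sym r
        relabel ↓ r = sym r
        relabel ⟶ r = sym r

      bwd-quiet : ∀ {k t M b p t′ M′ b′ p′} → QuietRun k (bwd t M , b , p) (bwd t′ M′ , b′ , p′) →
                  Quiet (t′ , b′ , p′) → Quiet (t , b , p)
      bwd-quiet [] q = q
      bwd-quiet (aback q _ _ ∷ _) _ = q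

      -- An `aback` and a `turn` together make one step of the walk. The last component keeps a
      -- nonempty run from producing an empty walk.
      BwdWalk : ℕ → Z → Z → Set
      BwdWalk k z z′ = ∃ λ l → Walk (suc n) l z z′ × (1 ≤ k → 1 ≤ l)

      bwd-snoc : ∀ {k z z₁ z₂} → Quiet z₁ → LStep z₁ z₂ → BwdWalk k z z₁ → BwdWalk (suc (suc k)) z z₂
      bwd-snoc {z₁ = s , b , p} q l (k , W , _) = k + 1 , W ++ (((ℕ.s≤s⁻¹ (Fin.toℕ<n b) , q) , l) ∷ []) , λ _ → ℕ.m≤n+m 1 k

      bwd-walk : ∀ {k t M b p t′ M′ b′ p′} → QuietRun k (bwd t M , b , p) (bwd t′ M′ , b′ , p′) → Quiet (t′ , b′ , p′) →
                 BwdWalk k (t′ , b′ , p′) (t , b , p)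
      bwd-walk [] q = 0 , [] , λ ()
      bwd-walk (aback q e r ∷ (turn ∷ qs)) q′ = bwd-snoc (bwd-quiet qs q′) (reverse-step e r) (bwd-walk qs q′)

      fwd-closed : ∀ {k t M b p} → ¬ FwdWalk (suc k) (fwd t M , b , p) (t , b , p)
      fwd-closed (_ , _ , _ , _ , refl , W) = no-quiet-cycle W

      bwd-closed : ∀ {k z} → ¬ BwdWalk (suc k) z z
      bwd-closed (zero , W , pos) with pos (s≤s z≤n)
      ... | ()
      bwd-closed (suc l , W , _) = no-quiet-cycle W

      no-fwd-loop : ∀ {k t M b p} → ¬ QuietRun (suc k) (fwd t M , b , p) (fwd t M , b , p)
      no-fwd-loop qs = fwd-closed (fwd-walk qs)

      no-bwd-loop : ∀ {k t M b p} → ¬ QuietRun (suc k) (bwd t M , b , p) (bwd t M , b , p)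
      no-bwd-loop qs@(aback q _ _ ∷ _) = bwd-closed (bwd-walk qs q)

      no-quiet-loop : ∀ {k x} → ¬ QuietRun (suc k) x x
      no-quiet-loop {x = fwd t M , b , p} qs = no-fwd-loop qs
      no-quiet-loop {x = bwd t M , b , p} qs = no-bwd-loop qs
      -- The loop is rotated by one step so that it begins in `bwd`.
      no-quiet-loop {x = pre t M , b , p} (turn ∷ qs) = no-bwd-loop (qs ∷ʳ turn)
      no-quiet-loop {x = zeroN q , b , p} (() ∷ _)
      no-quiet-loop {x = dead , b , p} (() ∷ _)

      rank-next : ∀ {x y} → Next x y → ¬ Halted y → rankP x ≤ rankP y
      rank-next (grows lt) _ = ℕ.<⇒≤ lt
      rank-next (halts h) ¬h = ⊥-elim (¬h h)
      rank-next (quiet (ahead _ _)) _ = ℕ.≤-refl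
      rank-next (quiet (aback _ _ _)) _ = ℕ.≤-refl
      rank-next (quiet turn) _ = ℕ.≤-refl

      rank-step : ∀ x → ¬ Halted x → ¬ Halted (pf x) → rankP x ≤ rankP (pf x)
      rank-step x ¬h = rank-next (next-view x ¬h)

      module _ (x : Pseudo) (never : ∀ t → ¬ Halted (iter pf t x)) where

        never-suc : ∀ t → ¬ Halted (pf (iter pf t x))
        never-suc t = subst (λ y → ¬ Halted y) (iter-suc pf t x) (never (suc t))

        rank-mono : ∀ u v → rankP (iter pf u x) ≤ rankP (iter pf (u + v) x)
        rank-mono u zero = ℕ.≤-reflexive (cong (λ u → rankP (iter pf u x)) (sym (ℕ.+-identityʳ u)))
        rank-mono u (suc v) = ℕ.≤-trans (rank-mono u v) (subst (λ y → rankP (iter pf (u + v) x) ≤ rankP y)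
          (trans (sym (iter-suc pf (u + v) x)) (cong (λ k → iter pf k x) (sym (ℕ.+-suc u v))))
          (rank-step (iter pf (u + v) x) (never (u + v)) (never-suc (u + v))))

        -- The rank never decreases, so along a loop it is constant and only quiet steps remain.
        quiet-forever : ∀ k → iter pf (suc k) x ≡ x → ∀ u → QuietStep (iter pf u x) (iter pf (suc u) x)
        quiet-forever k e u = subst (QuietStep (iter pf u x)) (sym (iter-suc pf u x)) (go (next-view (iter pf u x) (never u)))
          where
          back : iter pf (suc u + (k + u * k)) x ≡ x
          back = trans (cong (λ j → iter pf j x) (trans (cong suc (trans (sym (ℕ.+-assoc u k (u * k)))
            (trans (cong (λ z → z + u * k) (ℕ.+-comm u k)) (ℕ.+-assoc k u (u * k)))))
              (cong (λ z → suc (k + z)) (sym (ℕ.*-suc u k))))) (iter-* pf (suc u) (suc k) x e)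
          go : Next (iter pf u x) (pf (iter pf u x)) → QuietStep (iter pf u x) (pf (iter pf u x))
          go (quiet q) = q
          go (halts h) = ⊥-elim (never-suc u h)
          go (grows lt) = ⊥-elim (ℕ.<-irrefl refl (ℕ.<-≤-trans (ℕ.≤-<-trans (rank-mono 0 u) lt)
            (ℕ.≤-trans (ℕ.≤-reflexive (cong rankP (sym (iter-suc pf u x))))
              (ℕ.≤-trans (rank-mono (suc u) (k + u * k)) (ℕ.≤-reflexive (cong rankP back))))))

      terminates : ∀ x → ∃ λ k → k ≤ Finite.size fin-Pseudo × Halted (iter pf k x)
      terminates = escape fin-Pseudo halted? pf λ x k e never →
        no-quiet-loop (subst (QuietRun (suc k) x) e (run-iter (suc k) x (quiet-forever x never k e)))

    -- The run with true labels

    zeroC : K → NC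
    zeroC (q , a , b) = zeroN q , a , b

    fwdC bwdC preC : R → Mem → NC
    fwdC (t , a , b) M = fwd t M , a , b
    bwdC (t , a , b) M = bwd t M , a , b
    preC c M = pre (proj₁ c) M , unmove c

    fires : R → Bool
    fires (t , a , b) = fire (w b) (lab b) t

    remember : S → Bool → State → Mem → Mem
    remember 𝟎 _     t M = ∅
    remember 𝟏 false t M = M
    remember 𝟏 true  t M = insert t M

    mem : R → Mem → Mem
    mem c M = remember (sign (counter c)) (fires c) (proj₁ c) M

    Over : R → Mem → Set
    Over c M = sign (counter c) ≡ 𝟏 × fires c ≡ true × proj₁ c ∈? M ≡ true

    _≟S_ : (s s′ : S) → Dec (s ≡ s′)
    𝟎 ≟S 𝟎 = yes refl
    𝟎 ≟S 𝟏 = no λ ()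
    𝟏 ≟S 𝟎 = no λ ()
    𝟏 ≟S 𝟏 = yes refl

    over? : ∀ c M → Dec (Over c M)
    over? c M = (sign (counter c) ≟S 𝟏) ×-dec (fires c Bool.≟ true) ×-dec (proj₁ c ∈? M Bool.≟ true)

    ¬𝟎 : ∀ s → s ≢ 𝟎 → s ≡ 𝟏
    ¬𝟎 𝟎 ne = ⊥-elim (ne refl)
    ¬𝟎 𝟏 _ = refl

    going : ∀ c → stopped c ≡ false → stopAt (proj₁ c) (sign (counter c)) ≡ nothing
    going (try q j , a , b) e rewrite e = refl
    going (arr q k , a , b) e = refl

    stay-put : ∀ a (b : Position n) x → perform (x , keep , ↓) (a , b) ≡ (x , a , b)
    stay-put a b x = cong (x ,_) (cong₂ _,_ (ℤ.+-identityʳ a) (⊕-0 b))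

    perform-retract : ∀ c M → perform (retract (proj₁ c) M) (proj₂ c) ≡ preC c M
    perform-retract (t , a , b) M = cong₂ (λ x y → pre t M , a ℤ.+ x , b ⊕ y) (⟦⟧-negate (C t)) (μ-opposite (D t))

    forward-cont : ∀ {s x y} σ t M → ¬ (s ≡ 𝟏 × x ≡ true × y ≡ true) →
                   forward nothing s x y σ t M ≡ advance σ s t (remember s x t M)
    forward-cont {𝟎} σ t M ¬o = refl
    forward-cont {𝟏} {false} σ t M ¬o = refl
    forward-cont {𝟏} {true} {false} σ t M ¬o = refl
    forward-cont {𝟏} {true} {true} σ t M ¬o = ⊥-elim (¬o (refl , refl , refl))

    backward-cont : ∀ {s x y} t M → ¬ (s ≡ 𝟏 × x ≡ true × y ≡ true) →
                    backward nothing s x y t M ≡ retract t (remember s x t M)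
    backward-cont {𝟎} t M ¬o = refl
    backward-cont {𝟏} {false} t M ¬o = refl
    backward-cont {𝟏} {true} {false} t M ¬o = refl
    backward-cont {𝟏} {true} {true} t M ¬o = ⊥-elim (¬o (refl , refl , refl))

    forward-over : ∀ {s x y} σ t M → s ≡ 𝟏 × x ≡ true × y ≡ true → forward nothing s x y σ t M ≡ retract t ∅
    forward-over σ t M (refl , refl , refl) = refl

    forwards backwards : R → Mem → Maybe Q → NState × Change × Direction
    forwards  (t , a , b) M o = forward o (sign a) (fire (w b) (lab b) t) (t ∈? M) (w b) t M
    backwards (t , a , b) M o = backward o (sign a) (fire (w b) (lab b) t) (t ∈? M) t M

    nstep-fwd : ∀ c M → stopped c ≡ false → ¬ Over c M → nstep (fwdC c M) ≡ fwdC (rstep c) (mem c M)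
    nstep-fwd c@(t , a , b) M e ¬o = trans (cong (λ o → perform (forwards c M o) (a , b)) (going c e))
      (cong (λ x → perform x (a , b)) (forward-cont (w b) t M ¬o))

    nstep-over : ∀ c M → stopped c ≡ false → Over c M → nstep (fwdC c M) ≡ preC c ∅
    nstep-over c@(t , a , b) M e o = trans (cong (λ o → perform (forwards c M o) (a , b)) (going c e))
      (trans (cong (λ x → perform x (a , b)) (forward-over (w b) t M o)) (perform-retract c ∅))

    nstep-pre : ∀ c M → nstep (preC c M) ≡ bwdC (rback c) M
    nstep-pre c@(t , a , b) M = stay-put (a ℤ.- ⟦ C t ⟧) (b ⊕ (ℤ.- μ (D t))) (bwd (proj₁ (rback c)) M)

    nstep-bwd : ∀ c M → stopped c ≡ false → ¬ Over c M → nstep (bwdC c M) ≡ preC c (mem c M)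
    nstep-bwd c@(t , a , b) M e ¬o = trans (cong (λ o → perform (backwards c M o) (a , b)) (going c e))
      (trans (cong (λ x → perform x (a , b)) (backward-cont t M ¬o)) (perform-retract c (mem c M)))

    stopping : ∀ κ j → stop κ ≡ true → stopAt (try (proj₁ κ) j) (sign (proj₁ (proj₂ κ))) ≡ just (proj₁ κ)
    stopping (q , a , b) j e = cong (λ x → if x then just q else nothing) e

    nstep-fstop : ∀ κ j M → stop κ ≡ true → nstep (fwdC (at κ j) M) ≡ zeroC κ
    nstep-fstop κ@(q , a , b) j M e = trans (cong (λ o → perform (forwards (at κ j) M o) (a , b)) (stopping κ j e)) (stay-put a b (zeroN q))

    nstep-bstop : ∀ κ j M → stop κ ≡ true → nstep (bwdC (at κ j) M) ≡ zeroC κ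
    nstep-bstop κ@(q , a , b) j M e = trans (cong (λ o → perform (backwards (at κ j) M o) (a , b)) (stopping κ j e)) (stay-put a b (zeroN q))

    place-rstep : ∀ c → Live c → place (rstep c) ≡ ρ (place c)
    place-rstep (t , a , b) (s , _) rewrite s = refl

    place-iter : ∀ u c → (∀ v → v < u → Live (iter rstep v c)) → place (iter rstep u c) ≡ iter ρ u (place c)
    place-iter zero c live = refl
    place-iter (suc u) c live = trans (place-iter u (rstep c) (λ v v<u → live (suc v) (s≤s v<u)))
      (cong (iter ρ u) (place-rstep c (live 0 (s≤s z≤n))))

    -- Two firings lie in the same cell by `firing-same-cell`, so an equal state means an equal
    -- place and `lap` applies.
    refire : ∀ c k → (∀ u → u ≤ suc k → Live (iter rstep u c)) → fires c ≡ true →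
             fires (iter rstep (suc k) c) ≡ true → proj₁ (iter rstep (suc k) c) ≡ proj₁ c →
             (∀ u → Live (iter rstep u c)) ⊎ (∀ u → Live (iter rback u (iter rstep (suc k) c)))
    refire c k live f f′ st = lap c k live (cong₂ _,_ st (sym same-cell))
      where
      pl : place (iter rstep (suc k) c) ≡ iter ρ (suc k) (place c)
      pl = place-iter (suc k) c λ v v<u → live v (ℕ.<⇒≤ v<u)
      same-cell : proj₂ (place c) ≡ proj₂ (place (iter rstep (suc k) c))
      same-cell = trans (firing-same-cell (place c) (suc k) f (subst Firing pl f′)) (cong proj₂ (sym pl))

    ¬live-stopped : ∀ c → stopped c ≡ true → ¬ Live c
    ¬live-stopped c e (_ , e′) with trans (sym e) e′
    ... | ()

    ¬live-zero : ∀ c → sign (counter c) ≡ 𝟎 → ¬ Live c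
    ¬live-zero c e (e′ , _) with trans (sym e) e′
    ... | ()

    remember-cases : ∀ s f t′ M t → t ∈? remember s f t′ M ≡ true → s ≡ 𝟏 × (t ∈? M ≡ true ⊎ t ≡ t′ × f ≡ true)
    remember-cases 𝟎 f t′ M t t∈ with trans (sym (∈-∅ t)) t∈
    ... | ()
    remember-cases 𝟏 false t′ M t t∈ = refl , inj₁ t∈
    remember-cases 𝟏 true t′ M t t∈ = refl , (case ∈-insert⁻ t t′ M t∈ of λ
      { (inj₁ e) → inj₂ (e , refl) ; (inj₂ t∈′) → inj₁ t∈′ })

    FiredAt : R → State → Set
    FiredAt c t = ∃ λ k → ∃ λ c₀ → iter rstep (suc k) c₀ ≡ c × proj₁ c₀ ≡ t ×
                  fires c₀ ≡ true × (∀ u → u ≤ k → Live (iter rstep u c₀))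

    Fired : R → Mem → Set
    Fired c M = ∀ t → t ∈? M ≡ true → FiredAt c t

    live-snoc : ∀ k c₀ c → iter rstep (suc k) c₀ ≡ c → Live c → (∀ u → u ≤ k → Live (iter rstep u c₀)) →
                ∀ u → u ≤ suc k → Live (iter rstep u c₀)
    live-snoc k c₀ c e l live u u≤ = go (ℕ.m≤n⇒m<n∨m≡n u≤)
      where
      go : u < suc k ⊎ u ≡ suc k → Live (iter rstep u c₀)
      go (inj₁ u<) = live u (ℕ.s≤s⁻¹ u<)
      go (inj₂ u≡) = subst Live (trans (sym e) (cong (λ x → iter rstep x c₀) (sym u≡))) l

    fired-keep : ∀ c t → Live c → FiredAt c t → FiredAt (rstep c) t
    fired-keep c t l (k , c₀ , e , et , f , live) =
      suc k , c₀ , trans (iter-suc rstep (suc k) c₀) (cong rstep e) , et , f , live-snoc k c₀ c e l live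

    fired-step : ∀ c M → stopped c ≡ false → Fired c M → Fired (rstep c) (mem c M)
    fired-step c M e fd t t∈ = go (remember-cases (sign (counter c)) (fires c) (proj₁ c) M t t∈)
      where
      go : sign (counter c) ≡ 𝟏 × (t ∈? M ≡ true ⊎ t ≡ proj₁ c × fires c ≡ true) → FiredAt (rstep c) t
      go (es , inj₁ t∈M) = fired-keep c t (es , e) (fd t t∈M)
      go (es , inj₂ (et , ef)) = 0 , c , refl , sym et , ef , λ { zero _ → es , e }

    nothing-in : ∀ {A : Set} t → t ∈? ∅ ≡ true → A
    nothing-in t t∈ with trans (sym (∈-∅ t)) t∈
    ... | ()

    fwd-leg : ∀ {c y j} M → c ↝ at y j → stop y ≡ true → Fired c M → (∃ λ m → ¬ Live (iter rback m c)) → fwdC c M ⟹ zeroC y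

    -- A repeated firing would make the tour live for ever in one direction; but a stop lies ahead,
    -- and `m` steps behind there is a configuration that is not live.
    no-refire : ∀ c {y j} → stopped c ≡ false → rstep c ↝ at y j → stop y ≡ true → sign (counter c) ≡ 𝟏 → fires c ≡ true →
                FiredAt c (proj₁ c) → (∃ λ m → ¬ Live (iter rback m c)) → ⊥
    no-refire c {y} {j} e′ p e s f (k , c₀ , ec , et , f₀ , live) (m , ¬live) =
      decide (refire c₀ k (live-snoc k c₀ c ec (s , e′) live) f₀ (trans (cong fires ec) f) (trans (cong proj₁ ec) (sym et)))
      where
      at-stop : ∃ λ k′ → iter rstep k′ (rstep c) ≡ at y j × (∀ u → u < k′ → stopped (iter rstep u (rstep c)) ≡ false)
      at-stop = ↝-iter p
      decide : (∀ u → Live (iter rstep u c₀)) ⊎ (∀ u → Live (iter rback u (iter rstep (suc k) c₀))) → ⊥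
      decide (inj₂ back) = ¬live (subst (λ c → Live (iter rback m c)) ec (back m))
      decide (inj₁ on) = ¬live-stopped (at y j) e (subst Live
        (trans (iter-+ rstep (suc k) (suc (proj₁ at-stop)) c₀) (trans (cong (iter rstep (suc (proj₁ at-stop))) ec) (proj₁ (proj₂ at-stop))))
        (on (suc k + suc (proj₁ at-stop))))

    fwd-leg {y = y} {j} M ε e fd _ = onward refl (nstep-fstop y j M e) ε
    fwd-leg {c} {y} {j} M (e′ ◅ p) e fd (m , ¬live) = go (over? c M)
      where
      go : Dec (Over c M) → fwdC c M ⟹ zeroC y
      go (no ¬o) = onward refl (nstep-fwd c M e′ ¬o) (fwd-leg (mem c M) p e (fired-step c M e′ fd)
        (suc m , subst (λ c → ¬ Live (iter rback m c)) (sym (rback-rstep c)) ¬live))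
      go (yes (s , f , t∈)) = ⊥-elim (no-refire c e′ p e s f (fd (proj₁ c) t∈) (m , ¬live))

    data HaltsAt : ℕ → K → K → Set where
      done : ∀ {κ} → halted (proj₁ κ) ≡ true → HaltsAt 0 κ κ
      onto : ∀ {k κ y} → halted (proj₁ κ) ≡ false → HaltsAt k (mnext κ) y → HaltsAt (suc k) κ y

    first-stop : ∀ {k κ z} → HaltsAt k κ z → ∃ λ y → Reaches y κ × ∃ λ l → l ≤ k × HaltsAt l y z
    first-stop {k} {κ} H = go (stop κ) refl H
      where
      halted-stop : ∀ s q → halted q ≡ true → zeroOr halted q s ≡ true
      halted-stop 𝟎 q _ = refl
      halted-stop 𝟏 q e = e
      go : ∀ {k κ z} → ∀ s → stop κ ≡ s → HaltsAt k κ z → ∃ λ y → Reaches y κ × ∃ λ l → l ≤ k × HaltsAt l y z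
      go {k} {κ} true e H = κ , here refl e , k , ℕ.≤-refl , H
      go {κ = q , a , b} false e (done h) = ⊥-elim (Bool.not-¬ {x = false} refl (trans (sym e) (halted-stop (sign a) q h)))
      go false e (onto h H) = let y , r , l , l≤ , H′ = first-stop H in y , next e r , l , ℕ.m≤n⇒m≤1+n l≤ , H′

    module Steps (hu : Position n → Label → Maybe Label)
      (hu-sound : ∀ (b : Position n) (p r : Label) → hu b p ≡ just r → step r (w b) ≡ p)
      (hu-lab : ∀ (b : Position n) → hu (b ⊕ -1ℤ) (lab b) ≡ just (lab (b ⊕ -1ℤ))) where

      open Walking hu
      open Terminates hu hu-sound

      pseudo : NC → Pseudo
      pseudo (x , a , b) = x , b , lab b

      arrive-true : ∀ x d b → arrive x d b (lab b) ≡ (x , b ⊕ μ d , lab (b ⊕ μ d))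
      arrive-true x ⟶ b = cong (λ p → x , b ⊕ 1ℤ , p) (sym (lab-right b))
      arrive-true x ↓ b = cong (λ p → x , b ⊕ 0ℤ , p) (cong lab (sym (⊕-0 b)))
      arrive-true x ← b = cong (λ r → relabelled r x (b ⊕ -1ℤ) (lab b)) (hu-lab b)

      pf-true : ∀ x → haltedN (proj₁ x) ≡ false → sign (proj₁ (proj₂ x)) ≡ 𝟏 → pf (pseudo x) ≡ pseudo (nstep x)
      pf-true (x , a , b) e s = trans (cong (λ h → transit (if h then (x , keep , ↓) else δN x (lab b) (w b) 𝟏) b (lab b)) e)
        (trans (cong (λ s → transit (δN x (lab b) (w b) s) b (lab b)) (sym s)) (arrive-true (proj₁ (δN x (lab b) (w b) (sign a))) (proj₂ (proj₂ (δN x (lab b) (w b) (sign a)))) b))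

      -- The timeline of the tour through a stopped node y₀ whose forward orbit is
      -- free of stops up to the start of the forward leg at time m.
      module Timeline (c₀ : R) (m₀ : ℕ) (stopped₀ : stopped c₀ ≡ true)
        (zero₀ : sign (counter (iter rstep m₀ c₀)) ≡ 𝟎)
        (unstopped : ∀ (u : ℕ) → suc u ≤ m₀ → stopped (iter rstep (suc u) c₀) ≡ false) where

        c : ℕ → R
        c u = iter rstep u c₀

        m₁ : ℕ
        m₁ = suc m₀

        M : ℕ → Mem
        M zero    = ∅
        M (suc u) = mem (c (m₁ + u)) (M u)

        End : ℕ → Set
        End u = stopped (c (m₁ + u)) ≡ true ⊎ Over (c (m₁ + u)) (M u)

        end? : ∀ u → Dec (End u)
        end? u = (stopped (c (m₁ + u)) Bool.≟ true) ⊎-dec over? (c (m₁ + u)) (M u)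

        ¬true : ∀ {x} → x ≢ true → x ≡ false
        ¬true {false} _ = refl
        ¬true {true} ne = ⊥-elim (ne refl)

        c-suc : ∀ u → c (m₁ + suc u) ≡ rstep (c (m₁ + u))
        c-suc u = trans (cong c (ℕ.+-suc m₁ u)) (iter-suc rstep (m₁ + u) c₀)

        nstep-time : ∀ u → ¬ End u → nstep (fwdC (c (m₁ + u)) (M u)) ≡ fwdC (c (m₁ + suc u)) (M (suc u))
        nstep-time u ¬e = trans (nstep-fwd (c (m₁ + u)) (M u) (¬true (λ e → ¬e (inj₁ e))) (λ o → ¬e (inj₂ o)))
          (cong (λ x → fwdC x (M (suc u))) (sym (c-suc u)))

        run-to : ∀ u → (∀ v → v < u → ¬ End v) → fwdC (c m₁) ∅ ⟹ fwdC (c (m₁ + u)) (M u)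
        run-to zero _ = subst (λ x → fwdC (c m₁) ∅ ⟹ fwdC (c x) ∅) (sym (ℕ.+-identityʳ m₁)) ε
        run-to (suc u) none = run-to u (λ v v<u → none v (ℕ.m<n⇒m<1+n v<u)) ◁◁
          onward refl (nstep-time u (none u ℕ.≤-refl)) ε

        L Big : ℕ
        L = Finite.size fin-Pseudo
        Big = recurrence-bound (fin-× fin-State (fin-Fin (2 + n))) L

        Zero : ℕ → Set
        Zero u = sign (counter (c (m₁ + u))) ≡ 𝟎

        module _ (none : ∀ u → u < Big → ¬ End u) where

          pseudo-run : ∀ u k → u + k ≤ Big → (∀ v → v < k → ¬ Zero (u + v)) →
                       iter pf k (pseudo (fwdC (c (m₁ + u)) (M u))) ≡ pseudo (fwdC (c (m₁ + (u + k))) (M (u + k)))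
          pseudo-run u zero _ _ = cong (λ u → pseudo (fwdC (c (m₁ + u)) (M u))) (sym (ℕ.+-identityʳ u))
          pseudo-run u (suc k) u+k≤ nz = trans (iter-suc pf k _) (trans
            (cong pf (pseudo-run u k (ℕ.≤-trans (ℕ.+-monoʳ-≤ u (ℕ.n≤1+n k)) u+k≤) (λ v v<k → nz v (ℕ.m<n⇒m<1+n v<k))))
            (trans (pf-true (fwdC (c (m₁ + (u + k))) (M (u + k))) refl (nonzero (nz k ℕ.≤-refl)))
              (trans (cong pseudo (nstep-time (u + k) (none (u + k) (ℕ.≤-trans (ℕ.≤-reflexive (sym (ℕ.+-suc u k))) u+k≤))))
                (cong (λ u → pseudo (fwdC (c (m₁ + u)) (M u))) (sym (ℕ.+-suc u k))))))
            where
            nonzero : ¬ Zero (u + k) → sign (counter (c (m₁ + (u + k)))) ≡ 𝟏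
            nonzero = ¬𝟎 _

          windows : ∀ u → u + L < Big → ∃ λ v → u ≤ v × v ≤ u + L × Zero v
          windows u lt = search (any-below fin-Pseudo (λ k → sign (counter (c (m₁ + (u + k)))) ≟S 𝟎) (suc L))
            where
            stuck : (∀ k → k < suc L → ¬ Zero (u + k)) → ¬ (∃ λ k → k ≤ L × Halted (iter pf k (pseudo (fwdC (c (m₁ + u)) (M u)))))
            stuck nz (k , k≤L , h) = Bool.not-¬ {x = false} refl (trans (sym (cong (haltedN ∘ proj₁) (pseudo-run u k
              (ℕ.≤-trans (ℕ.+-monoʳ-≤ u k≤L) (ℕ.<⇒≤ lt)) (λ v v<k → nz v (ℕ.≤-trans v<k (ℕ.≤-trans k≤L (ℕ.n≤1+n L))))))) h)
            search : (∃ λ k → k < suc L × Zero (u + k)) ⊎ (∀ k → k < suc L → ¬ Zero (u + k)) → ∃ λ v → u ≤ v × v ≤ u + L × Zero v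
            search (inj₁ (k , k≤ , z)) = u + k , ℕ.m≤m+n u k , ℕ.+-monoʳ-≤ u (ℕ.s≤s⁻¹ k≤) , z
            search (inj₂ nz) = ⊥-elim (stuck nz (terminates (pseudo (fwdC (c (m₁ + u)) (M u)))))

          open Recurrence (fin-× fin-State (fin-Fin (2 + n))) (λ u → place (c (m₁ + u))) L windows

          rstep-injective : ∀ k {x y} → iter rstep k x ≡ iter rstep k y → x ≡ y
          rstep-injective k {x} {y} e = trans (sym (iter-cancel rback-rstep k x))
            (trans (cong (iter rback k) e) (iter-cancel rback-rstep k y))

          c-+ : ∀ u v → c (u + v) ≡ iter rstep v (c u)
          c-+ u v = iter-+ rstep u v c₀

          same-zero : ∀ x y → sign (counter x) ≡ 𝟎 → sign (counter y) ≡ 𝟎 → place x ≡ place y → x ≡ y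
          same-zero (t , a , b) (t′ , a′ , b′) z z′ e =
            cong₂ (λ p a → proj₁ p , a , proj₂ p) e (trans (≡0-sign {a} z) (sym (≡0-sign {a′} z′)))

          -- Equal configurations make the orbit periodic, and since `rstep` is injective the period
          -- extends back to `c₀`. So the stopped `c₀` recurs within one period after `m₁`, against
          -- the absence of ends.
          repeats : ∀ u v → u < v → v < Big → Zero u → Zero v → place (c (m₁ + u)) ≢ place (c (m₁ + v))
          repeats u v u<v v<Big zu zv e = none (r ℕ.% suc d) small (inj₁ (trans (cong stopped hit) stopped₀))
            where
            d = v ∸ suc u
            period : iter rstep (suc d) (c m₁) ≡ c m₁
            period = rstep-injective u (trans (sym (iter-+ rstep (suc d) u (c m₁))) (trans
              (cong (λ k → iter rstep k (c m₁)) (trans (ℕ.+-comm (suc d) u) (trans (ℕ.+-suc u d) (ℕ.m+[n∸m]≡n u<v))))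
              (trans (sym (c-+ m₁ v)) (trans (sym (same-zero _ _ zu zv e)) (c-+ m₁ u)))))
            -- Modulo the period `suc d`, going `m₁ * d` steps forward amounts to going `m₁` steps
            -- back.
            r = m₁ * d
            back : iter rstep r (c m₁) ≡ c₀
            back = rstep-injective m₁ (trans (sym (iter-+ rstep r m₁ (c m₁))) (trans
              (cong (λ k → iter rstep k (c m₁)) (trans (ℕ.+-comm r m₁) (sym (ℕ.*-suc m₁ d))))
              (iter-* rstep m₁ (suc d) (c m₁) period)))
            hit : c (m₁ + r ℕ.% suc d) ≡ c₀
            hit = trans (c-+ m₁ (r ℕ.% suc d)) (trans (cong (iter rstep (r ℕ.% suc d))
              (sym (iter-* rstep (r ℕ./ suc d) (suc d) (c m₁) period)))
              (trans (sym (iter-+ rstep (r ℕ./ suc d * suc d) (r ℕ.% suc d) (c m₁)))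
              (trans (cong (λ k → iter rstep k (c m₁)) (trans (ℕ.+-comm (r ℕ./ suc d * suc d) _) (sym (ℕ.m≡m%n+[m/n]*n r (suc d))))) back)))
            small : r ℕ.% suc d < Big
            small = ℕ.≤-<-trans (ℕ.≤-trans (ℕ.s≤s⁻¹ (ℕ.m%n<n r (suc d))) (ℕ.m∸n≤m v (suc u))) v<Big

          absurd : ⊥
          absurd = let u , v , u<v , v<Big , zu , zv , e = recurs in repeats u v u<v v<Big zu zv e

        first-end : ∃ λ e → End e × (∀ v → v < e → ¬ End v)
        first-end = go (least end? Big)
          where
          go : (∃ λ e → e < Big × End e × (∀ v → v < e → ¬ End v)) ⊎ (∀ u → u < Big → ¬ End u) →
               ∃ λ e → End e × (∀ v → v < e → ¬ End v)
          go (inj₁ (e , _ , end , none)) = e , end , none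
          go (inj₂ none) = ⊥-elim (absurd none)

        module _ (e : ℕ) (over : Over (c (m₁ + e)) (M e)) (going-at : stopped (c (m₁ + e)) ≡ false)
                 (none : ∀ v → v < e → ¬ End v) where

          unstopped′ : ∀ u → suc u ≤ m₁ + e → stopped (c (suc u)) ≡ false
          unstopped′ u u< = go (suc u ℕ.≤? m₀)
            where
            late : ∀ x → m₁ + x ≡ suc u → x < e ⊎ x ≡ e → stopped (c (suc u)) ≡ false
            late x eq (inj₁ x<e) = subst (λ u → stopped (c u) ≡ false) eq (¬true λ st → none x x<e (inj₁ st))
            late x eq (inj₂ refl) = subst (λ u → stopped (c u) ≡ false) eq going-at
            go : Dec (suc u ≤ m₀) → stopped (c (suc u)) ≡ false
            go (yes u≤) = unstopped u u≤
            go (no ¬u≤) = late x eq (ℕ.m≤n⇒m<n∨m≡n (ℕ.+-cancelˡ-≤ m₁ x e (ℕ.≤-trans (ℕ.≤-reflexive eq) u<)))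
              where
              x = suc u ∸ m₁
              eq : m₁ + x ≡ suc u
              eq = ℕ.m+[n∸m]≡n (ℕ.≰⇒> ¬u≤)

          -- The counterpart of `FiredAt` on the way back: the recorded firing lies later on the
          -- timeline.
          LaterAt : ℕ → State → Set
          LaterAt u t = ∃ λ v → u < v × v < m₁ + e × proj₁ (c v) ≡ t × fires (c v) ≡ true × (∀ x → u < x → x ≤ v → Live (c x))

          Later : ℕ → Mem → Set
          Later u N = ∀ t → t ∈? N ≡ true → LaterAt u t

          live-cons : ∀ u v → Live (c (suc u)) → (∀ x → suc u < x → x ≤ v → Live (c x)) → ∀ x → u < x → x ≤ v → Live (c x)
          live-cons u v l live x u<x x≤v = go (ℕ.m≤n⇒m<n∨m≡n u<x)
            where
            go : suc u < x ⊎ suc u ≡ x → Live (c x)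
            go (inj₁ lt) = live x lt x≤v
            go (inj₂ eq) = subst (Live ∘ c) eq l

          later-step : ∀ u N → suc u < m₁ + e → Later (suc u) N → Later u (mem (c (suc u)) N)
          later-step u N u< lt t t∈ = go (remember-cases (sign (counter (c (suc u)))) (fires (c (suc u))) (proj₁ (c (suc u))) N t t∈)
            where
            now-live : sign (counter (c (suc u))) ≡ 𝟏 → Live (c (suc u))
            now-live es = es , unstopped′ u (ℕ.<⇒≤ u<)
            go : sign (counter (c (suc u))) ≡ 𝟏 × (t ∈? N ≡ true ⊎ t ≡ proj₁ (c (suc u)) × fires (c (suc u)) ≡ true) → LaterAt u t
            go (es , inj₂ (et , f)) = suc u , ℕ.≤-refl , u< , sym et , f ,
              λ y u<y y≤u → subst (Live ∘ c) (ℕ.≤-antisym u<y y≤u) (now-live es)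
            go (es , inj₁ t∈N) = let v , u<v , v< , et , f , live = lt t t∈N in
              v , ℕ.<-trans (ℕ.n<1+n u) u<v , v< , et , f , live-cons u v (now-live es) live

          kept : ∀ x k t → x + k ≤ e → t ∈? M x ≡ true → (∀ v → v < k → sign (counter (c (m₁ + (x + v)))) ≡ 𝟏) → t ∈? M (x + k) ≡ true
          kept x zero t _ t∈ _ = subst (λ x → t ∈? M x ≡ true) (sym (ℕ.+-identityʳ x)) t∈
          kept x (suc k) t x+k≤ t∈ nz = subst (λ x → t ∈? M x ≡ true) (sym (ℕ.+-suc x k))
            (keeps _ (fires (c (m₁ + (x + k)))) (nz k ℕ.≤-refl)
              (kept x k t (ℕ.≤-trans (ℕ.+-monoʳ-≤ x (ℕ.n≤1+n k)) x+k≤) t∈ (λ v v<k → nz v (ℕ.m<n⇒m<1+n v<k))))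
            where
            keeps : ∀ s f {t′ N} → s ≡ 𝟏 → t ∈? N ≡ true → t ∈? remember s f t′ N ≡ true
            keeps _ false refl t∈ = t∈
            keeps _ true {t′} {N} refl t∈ = ∈-insert-keep t t′ N t∈

          -- Living for ever backwards contradicts the stop `c₀`. Forwards, the zero at time `m₀`
          -- intervenes, or else both firings lie on the forward leg, which would already have
          -- turned at the second of them.
          refired : ∀ u → suc u < m₁ + e → sign (counter (c (suc u))) ≡ 𝟏 → fires (c (suc u)) ≡ true →
                    LaterAt (suc u) (proj₁ (c (suc u))) → ⊥
          refired u u< s f (v , u<v , v< , et , fv , live) = decide (refire (c (suc u)) k live′ f
                  (trans (cong fires (trans (c≡ (suc k)) (cong c v≡))) fv) (trans (cong proj₁ (trans (c≡ (suc k)) (cong c v≡))) et))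
            where
            k = v ∸ suc (suc u)
            v≡ : suc u + suc k ≡ v
            v≡ = trans (ℕ.+-suc (suc u) k) (ℕ.m+[n∸m]≡n u<v)
            c≡ : ∀ x → iter rstep x (c (suc u)) ≡ c (suc u + x)
            c≡ x = sym (iter-+ rstep (suc u) x c₀)
            live′ : ∀ x → x ≤ suc k → Live (iter rstep x (c (suc u)))
            live′ x x≤ = subst Live (sym (c≡ x)) (live-cons u v (s , unstopped′ u (ℕ.<⇒≤ u<)) live (suc u + x) (ℕ.m≤m+n (suc u) x)
              (ℕ.≤-trans (ℕ.+-monoʳ-≤ (suc u) x≤) (ℕ.≤-reflexive v≡)))
            decide : (∀ x → Live (iter rstep x (c (suc u)))) ⊎ (∀ x → Live (iter rback x (iter rstep (suc k) (c (suc u))))) → ⊥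
            decide (inj₂ back) = ¬live-stopped c₀ stopped₀ (subst Live (trans
              (cong (iter rback v) (trans (c≡ (suc k)) (cong c v≡))) (iter-cancel rback-rstep v c₀)) (back v))
            decide (inj₁ on) = go (suc u ℕ.≤? m₀)
              where
              go : Dec (suc u ≤ m₀) → ⊥
              go (yes u≤) = ¬live-zero (c m₀) zero₀ (subst Live (trans (c≡ (m₀ ∸ suc u)) (cong c (ℕ.m+[n∸m]≡n u≤))) (on (m₀ ∸ suc u)))
              go (no ¬u≤) = none (x + suc k) x′<e (inj₂ (over-at , trans (cong fires time) fv , again))
                where
                x = suc u ∸ m₁
                x≡ : m₁ + x ≡ suc u
                x≡ = ℕ.m+[n∸m]≡n (ℕ.≰⇒> ¬u≤)
                time≡ : m₁ + (x + suc k) ≡ v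
                time≡ = trans (sym (ℕ.+-assoc m₁ x (suc k))) (trans (cong (λ z → z + suc k) x≡) v≡)
                time : c (m₁ + (x + suc k)) ≡ c v
                time = cong c time≡
                x′<e : x + suc k < e
                x′<e = ℕ.+-cancelˡ-< m₁ (x + suc k) e (subst (_< m₁ + e) (sym time≡) v<)
                over-at : sign (counter (c (m₁ + (x + suc k)))) ≡ 𝟏
                over-at = trans (cong (sign ∘ counter) time) (proj₁ (live v u<v ℕ.≤-refl))
                recorded : proj₁ (c (suc u)) ∈? M (suc x) ≡ true
                recorded = records (sign (counter (c (m₁ + x)))) (fires (c (m₁ + x))) {N = M x} (cong (proj₁ ∘ c) x≡)
                  (trans (cong (sign ∘ counter ∘ c) x≡) s) (trans (cong (fires ∘ c) x≡) f)
                  where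
                  records : ∀ s f {t t′ N} → t ≡ t′ → s ≡ 𝟏 → f ≡ true → t′ ∈? remember s f t N ≡ true
                  records _ _ {t} {N = N} refl refl refl = ∈-insert t N
                again : proj₁ (c (m₁ + (x + suc k))) ∈? M (x + suc k) ≡ true
                again = subst (λ t → t ∈? M (x + suc k) ≡ true) (sym (trans (cong proj₁ time) et))
                  (subst (λ y → proj₁ (c (suc u)) ∈? M y ≡ true) (sym (ℕ.+-suc x k))
                    (kept (suc x) k _ (ℕ.≤-trans (ℕ.≤-reflexive (sym (ℕ.+-suc x k))) (ℕ.<⇒≤ x′<e)) recorded
                      (λ y y<k → trans (cong (sign ∘ counter ∘ c) (shifted y)) (proj₁ (subst Live (c≡ (suc y)) (live′ (suc y) (s≤s (ℕ.<⇒≤ y<k))))))))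
                  where
                  shifted : ∀ y → m₁ + (suc x + y) ≡ suc u + suc y
                  shifted y = trans (cong (λ z → m₁ + z) (sym (ℕ.+-suc x y))) (trans (sym (ℕ.+-assoc m₁ x (suc y))) (cong (λ z → z + suc y) x≡))

          ¬over-back : ∀ u N → suc u < m₁ + e → Later (suc u) N → ¬ Over (c (suc u)) N
          ¬over-back u N u< lt (s , f , t∈) = refired u u< s f (lt (proj₁ (c (suc u))) t∈)

          back-leg : ∀ u N → u < m₁ + e → Later u N → ∀ {y j} → c₀ ≡ at y j → bwdC (c u) N ⟹ zeroC y
          back-leg zero N _ _ {y} {j} e₀ = subst (λ x → bwdC x N ⟹ zeroC y) (sym e₀)
            (onward refl (nstep-bstop y j N (trans (cong stopped (sym e₀)) stopped₀)) ε)
          back-leg (suc u) N u< lt e₀ =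
            onward refl (nstep-bwd (c (suc u)) N (unstopped′ u (ℕ.<⇒≤ u<)) (¬over-back u N u< lt))
            (onward refl (trans (nstep-pre (c (suc u)) (mem (c (suc u)) N))
              (cong (λ x → bwdC x (mem (c (suc u)) N)) (trans (cong rback (iter-suc rstep u c₀)) (rback-rstep (c u)))))
            (back-leg u (mem (c (suc u)) N) (ℕ.<-trans (ℕ.n<1+n u) u<) (later-step u N u< lt) e₀))

          turned-leg : ∀ {y j} → c₀ ≡ at y j → fwdC (c m₁) ∅ ⟹ zeroC y
          turned-leg e₀ = run-to e none ◁◁ onward refl (nstep-over (c (m₁ + e)) (M e) going-at over)
            (onward refl (trans (nstep-pre (c (m₁ + e)) ∅) (cong (λ x → bwdC x ∅)
              (trans (cong rback (iter-suc rstep (m₀ + e) c₀)) (rback-rstep (c (m₀ + e))))))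
            (back-leg (m₀ + e) ∅ ℕ.≤-refl (λ t → nothing-in t) e₀))

      -- The node whose slots are being tried. The tour preserves that its path leads to `y`, so no
      -- stop other than `y` can be met.
      owner : R → K
      owner (try q j , a , b) = q , a , b
      owner (arr q k , a , b) = q , a ℤ.+ ⟦ childC k ⟧ , b ⊕ μ (childD k)

      owner-trial : ∀ κ k → owner (trial κ k) ≡ κ
      owner-trial (q , a , b) k = cong (q ,_) (cong₂ _,_ (minus-plus a _) (⊖-⊕ b (childD k)))

      trial-owner : ∀ q k a b → trial (owner (arr q k , a , b)) k ≡ (arr q k , a , b)
      trial-owner q k a b = cong (arr q k ,_) (cong₂ _,_ (plus-minus a _) (⊕-⊖ b (childD k)))

      reaches-up : ∀ {y} κ → stop κ ≡ false → Reaches y κ → Reaches y (mnext κ)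
      reaches-up κ e (next _ r) = r
      reaches-up κ e (here _ e′) = ⊥-elim (Bool.not-¬ {x = false} refl (trans (sym e) e′))

      reaches-try : ∀ {y} κ j → Last-View j → stop κ ≡ false → Reaches y κ → Reaches y (owner (rstep (at κ j)))
      reaches-try {y} κ _ (inject k) e r = subst (Reaches y) (sym (trans (cong owner (rstep-down κ k)) (owner-trial κ k))) r
      reaches-try {y} κ _ last e r = subst (Reaches y ∘ owner) (sym (rstep-up κ e)) (reaches-up κ e r)

      reaches-step : ∀ {y} c → stopped c ≡ false → Reaches y (owner c) → Reaches y (owner (rstep c))
      reaches-step {y} (try q j , a , b) e r = reaches-try (q , a , b) j (last-view j) e r
      reaches-step {y} (arr q k , a , b) e r = subst (Reaches y ∘ owner ∘ rstep) (trial-owner q k a b) (go (isChild? κ k))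
        where
        κ = owner (arr q k , a , b)
        go : Dec (IsChild κ k) → Reaches y (owner (rstep (trial κ k)))
        go (yes ch) = subst (Reaches y ∘ owner) (sym (rstep-enter κ k ch)) (next (child-stop κ k ch) (subst (Reaches y) (sym (child-mnext κ k ch)) r))
        go (no ¬ch) = subst (Reaches y ∘ owner) (sym (rstep-skip κ k ¬ch)) r

      stopped-owner : ∀ {y} c M → stopped c ≡ true → Reaches y (owner c) → fwdC c M ⟹ zeroC y
      stopped-owner (try q j , a , b) M e (here refl _) = onward refl (nstep-fstop (q , a , b) j M e) ε
      stopped-owner (try q j , a , b) M e (next e′ _) = ⊥-elim (Bool.not-¬ {x = false} refl (trans (sym e′) e))

      excursion : ∀ κ {y} → sign (proj₁ (proj₂ κ)) ≡ 𝟎 → halted (proj₁ κ) ≡ false → Reaches y (mnext κ) → zeroC κ ⟹ zeroC y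
      excursion κ@(q , a , b) {y} z nh r = nh ◁ leg (either r (slot κ))
        where
        open Path using (either; Forward; Backward)
        κ₁ = mnext κ
        σ₀ trial₀ : R
        σ₀ = at κ₁ (suc (slot κ))
        trial₀ = trial κ₁ (slot κ)
        stop-κ : stop κ ≡ true
        stop-κ = cong (zeroOr halted q) z
        fake : ¬ IsChild κ₁ (slot κ)
        fake ch with trans (sym stop-κ) (trans (sym (cong stop (ch-slot κ))) (child-stop κ₁ (slot κ) ch))
        ... | ()
        departs : rstep trial₀ ≡ σ₀
        departs = rstep-skip κ₁ (slot κ) fake
        trial-zero : sign (counter trial₀) ≡ 𝟎
        trial-zero = trans (cong (sign ∘ proj₁ ∘ proj₂) (ch-slot κ)) z
        leg : Forward y κ₁ (slot κ) ⊎ Backward y κ₁ (slot κ) → fwdC σ₀ ∅ ⟹ zeroC y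
        -- One step behind the start lies `trial₀`, whose counter is zero; it is the configuration
        -- that is not live.
        leg (inj₁ (j , p)) = fwd-leg ∅ p (reaches-stop r) (λ t → nothing-in t)
          (1 , subst (λ c → ¬ Live c) (trans (sym (rback-rstep trial₀)) (cong rback departs)) (¬live-zero trial₀ trial-zero))
        -- Here the timeline begins at the stop `y`, reaches `trial₀` after `suc k` steps, and
        -- continues into the forward leg that starts at `σ₀`.
        leg (inj₂ (j , p)) with ↝-iter p
        ... | k , at-trial , none = subst (λ x → fwdC x ∅ ⟹ zeroC y) c-m₁ (conclude first-end)
          where
          unstopped : ∀ u → suc u ≤ suc k → stopped (iter rstep (suc u) (at y j)) ≡ false
          unstopped u (s≤s u≤k) with ℕ.m≤n⇒m<n∨m≡n u≤k
          ... | inj₁ u<k = none u u<k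
          ... | inj₂ refl = cong stopped at-trial
          open Timeline (at y j) (suc k) (reaches-stop r) (trans (cong (sign ∘ counter) at-trial) trial-zero) unstopped
          c-m₁ : c m₁ ≡ σ₀
          c-m₁ = trans (iter-suc rstep (suc k) (at y j)) (trans (cong rstep at-trial) departs)
          reach-at : ∀ u → (∀ v → v < u → ¬ End v) → Reaches y (owner (c (m₁ + u)))
          reach-at zero _ = subst (Reaches y ∘ owner) (sym (trans (cong c (ℕ.+-identityʳ m₁)) c-m₁)) r
          reach-at (suc u) ne = subst (Reaches y ∘ owner) (sym (c-suc u))
            (reaches-step (c (m₁ + u)) (¬true λ st → ne u ℕ.≤-refl (inj₁ st)) (reach-at u (λ v v<u → ne v (ℕ.m<n⇒m<1+n v<u))))
          conclude : (∃ λ e → End e × (∀ v → v < e → ¬ End v)) → fwdC (c m₁) ∅ ⟹ zeroC y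
          conclude (e , end , ne) = go (stopped (c (m₁ + e)) Bool.≟ true) end
            where
            go : Dec (stopped (c (m₁ + e)) ≡ true) → End e → fwdC (c m₁) ∅ ⟹ zeroC y
            go (yes st) _ = run-to e ne ◁◁ stopped-owner (c (m₁ + e)) (M e) st (reach-at e ne)
            go (no ¬st) (inj₁ st) = ⊥-elim (¬st st)
            go (no ¬st) (inj₂ o) = turned-leg e o (¬true ¬st) ne refl

      zero-run : ∀ K {k κ z} → k ≤ K → HaltsAt k κ z → stop κ ≡ true → zeroC κ ⟹ zeroC z
      zero-run K k≤ (done h) s = ε
      zero-run (suc K) {κ = κ@(q , a , b)} (s≤s k≤) (onto h H) s =
        let y , r , l , l≤ , H′ = first-stop H
        in excursion κ (at-zero (sign a) s) h r ◁◁ zero-run K (ℕ.≤-trans l≤ k≤) H′ (reaches-stop r)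
        where
        at-zero : ∀ s → zeroOr halted q s ≡ true → s ≡ 𝟎
        at-zero 𝟎 _ = refl
        at-zero 𝟏 e = ⊥-elim (Bool.not-¬ {x = false} refl (trans (sym h) e))

  -- Transfer of acceptance and rejection

  given : 2D1CA Σ
  given = record { Q = Q ; finite = finite ; q₀ = q₀ ; acc = acc ; rej = rej ; disjoint = disjoint ; δ = δ }

  Verdict : (NState → Bool) → List Σ → Set
  Verdict = HopcroftUllman.Verdict fin-NState fin-Label step blank (λ _ → refl) (λ _ → refl) δN accN rejN disjointN dead (zeroN q₀)

  ¬T-false : ∀ {b} → ¬ T b → b ≡ false
  ¬T-false {false} _ = refl
  ¬T-false {true} ¬t = ⊥-elim (¬t tt)

  T-true : ∀ {b} → T b → b ≡ true
  T-true {true} _ = refl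

  module _ (xs : List Σ) (G : Q → Bool) (G-halts : ∀ (q : Q) → T (G q) → halted q ≡ true) where

    open OnTape (Vec.lookup (tape xs)) refl (tape-¢ xs) (tape-$ xs) (tape-last xs)
    open Tape (Vec.lookup (tape xs)) refl (tape-¢ xs) (tape-$ xs) (tape-last xs) using (lab; lab-right)

    halts-at : ∀ {κ} → 2D1CA.HaltsIn given xs G κ → ∃₂ λ k z → HaltsAt k κ z × G (proj₁ z) ≡ true
    halts-at {κ} (2D1CA.done t) = 0 , κ , done (G-halts _ t) , T-true t
    halts-at (2D1CA.step ¬h H) = let k , z , H′ , g = halts-at H in suc k , z , onto (¬T-false ¬h) H′ , g

    verdict : 2D1CA.HaltsIn given xs G (2D1CA.initial given xs) → ∀ G′ → (∀ q → G′ (zeroN q) ≡ G q) → Verdict G′ xs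
    verdict H G′ agrees = let k , z , Hz , g = halts-at H in record
      { lab = lab ; lab-zero = refl ; lab-right = lab-right
      ; walks-halt = λ hu s y → let k , _ , e = Terminates.terminates hu s y in k , e
      ; run = λ hu s t → zeroC z , Steps.zero-run hu s t k ℕ.≤-refl Hz refl , trans (agrees (proj₁ z)) g }

  solution : ∀ {ℓ : Level} (L : Pred (List Σ) ℓ) → 2D1CA.Recognizes given L →
             ∃ λ (M′ : 2Q1CA Σ) → Is2R1CA M′ × Simple M′ × 2Q1CA.RecognizesWithoutError M′ L
  solution L rec = HopcroftUllman.solution fin-NState fin-Label step blank (λ _ → refl) (λ _ → refl) δN accN rejN disjointN dead (zeroN q₀) L
    λ xs → (λ l → accepting xs (Equivalence.from (proj₂ (rec xs)) l)) , λ ¬l → rejecting xs ¬l (proj₁ (rec xs))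
    where
    accepting : ∀ xs → 2D1CA.Accepts given xs → Verdict accN xs
    accepting xs a = verdict xs acc (λ q t → cong (_∨ rej q) (T-true t)) a accN (λ q → refl)
    rejecting : ∀ xs → ¬ L xs → 2D1CA.Accepts given xs ⊎ 2D1CA.Rejects given xs → Verdict rejN xs
    rejecting xs ¬l (inj₁ a) = ⊥-elim (¬l (Equivalence.to (proj₂ (rec xs)) a))
    rejecting xs ¬l (inj₂ r) = verdict xs rej (λ q t → trans (cong (acc q ∨_) (T-true t)) (Bool.∨-zeroʳ (acc q))) r rejN (λ q → refl)

theorem12 : {ℓ : Level} (Σ : Set) → Finite Σ → (L : Pred (List Σ) ℓ) →
    (∃ λ (M : 2D1CA Σ) → 2D1CA.Recognizes M L) →
    ∃ λ (M′ : 2Q1CA Σ) →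
    Is2R1CA M′ × Simple M′ × 2Q1CA.RecognizesWithoutError M′ L
theorem12 Σ _ L (M , rec) = Reversal.solution finite q₀ acc rej disjoint δ L rec
  where open 2D1CA M
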